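{- Let $\alpha$ be a positive root of $\Phi$ and let $P$ be the directed graph of stretching classes constructed from $\alpha$ (as in the context). Let $n_0$ be the smallest value such that every stretching class in $P$ with a single asterisk has an element defined on $\mathrm{st}_{n_0}(G)$. Then for all $n\ge n_0+1$, $$\{\beta\in\mathrm{st}_n(\Phi)^+ : \beta\le\mathrm{st}_n(\alpha)\}=\bigcup_{\overline{\beta}\in P}\overline{\beta}[n],$$ where $\le$ is the root poset of $\mathrm{st}_n(\Phi)$.
   Context: $\Phi$ is the root system of a crystallographic Cartan matrix $A$ for a Coxeter group with diagram $G$ (simple roots $\alpha_i$ indexed by vertices, $s_i(\beta)=\beta-(\alpha_i,\beta)\alpha_i$ with $(\alpha_i,\alpha_j)=A_{ij}$, $\Phi$ the union of $W$-orbits of simple roots); roots are identified with integer-valued functions on vertices. Depth of a positive root: $1+$ the minimal $\ell$ in an expression $s_{y_\ell}\cdots s_{y_1}(\alpha_{y_0})$. Root poset: $\beta\le\gamma$ iff $\gamma=s_{i_k}\cdots s_{i_1}(\beta)$ with depth increasing by exactly $1$ at each step. Elastic data $(x,L_x,R_x)$: a vertex $x$ and partition of its neighbors. $\mathrm{st}_m(G)$ replaces $x$ by a path $x_0-\cdots-x_m$ of unlabeled edges with $x_0$ joined to $L_x$, $x_m$ joined to $R_x$ by the original labeled edges; $\mathrm{st}_m(A)$ has entries $A_{yz}$ off the path, $A_{xz}$ at $(x_0,z)$ for $z\in L_x$ and at $(x_m,z)$ for $z\in R_x$, $A_{yx}$ at $(y,x_0)$ for $y\in L_x$ and at $(y,x_m)$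 for $y\in R_x$, $2$ at $(x_i,x_i)$, $-1$ at $(x_i,x_{i\pm1})$, $0$ otherwise; $\mathrm{st}_m(\Phi)$ is its root system; $\mathrm{st}_0(G)=G$. $\mathrm{st}_n(\alpha)$ takes value $\alpha(x)$ at all $x_i$ and agrees with $\alpha$ elsewhere. Stretching class: given an integer-valued function $b$ on the vertices of some $\mathrm{st}_m(G)$ and a marking (asterisks) of consecutive path vertices $x_p,\dots,x_q$ ($0\le p\le q\le m$) with $b(x_j)\ne b(x_{j+1})$ for $p\le j<q$, the class $\overline{b}$ consists of all functions on vertices of $\mathrm{st}_n(G)$ (any $n$) agreeing with $b$ off the path, with values $b(x_0),\dots,b(x_{p-1})$ on $x_0,\dots,x_{p-1}$, values $b(x_{q+1}),\dots,b(x_m)$ on the last $m-q$ path vertices, and on the remaining path vertices the values $b(x_p),\dots,b(x_q)$ in this order, each repeated a positive number of times. $\overline{b}[n]$ is the set of its elements on $\mathrm{st}_n(G)$. Left endpoint $x_p$, right endpoint $x_q$, internal vertices $x_{p+1},\dots,x_{q-1}$. Class left neighbors: $L_x$ if $p=0$, else $\{x_{p-1}\}$; class right neighbors: $R_x$ if $q=m$, else $\{x_{q+1}\}$. Weighted left sum $S_L=\sum_y-\mathrm{st}_m(A)_{x_p y}b(y)$ over class left neighbors; weighted right sum $S_R$ analogously at $x_q$. Reflecting at $z$ replaces $b(z)$ by $\sum_{y\text{ adj. }z}-\mathrm{st}_m(A)_{zy}b(y)-b(z)$, keeping marks. Operations: (1) reflect at an unmarked vertex where this decreases the value; (2) reflect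 at an internal vertex where this decreases the value; (3) if $S_L<b(x_p)$, insert a new marked vertex with value $S_L$ immediately left of $x_p$ (passing to $\mathrm{st}_{m+1}(G)$), symmetrically on the right if $S_R<b(x_q)$; (4) if $q>p$, reflect at $x_p$ when this decreases its value, removing its mark if the new value is $\ge b(x_{p+1})$; symmetrically at $x_q$. $P$ is the directed graph whose vertices form the smallest set of such marked functions containing $\alpha^*$ ($\alpha$ on $G$ with $x_0=x$ marked) and closed under these operations, with arrows from each to the results of operations on it, results with a negative value being discarded. A class in $P$ "with a single asterisk" defined by $b$ on $\mathrm{st}_m(G)$ has elements exactly on $\mathrm{st}_n(G)$ for $n\ge m$. -}

module Defs where

open import Data.Nat as ℕ using (ℕ; zero; suc; _∸_; _≡ᵇ_; _<ᵇ_; z≤n; s≤s)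
open import Data.Nat.Properties using (m≤n⇒m≤1+n; ≤-trans; m∸n≤m; pred-mono-≤)
open import Data.Integer as ℤ using (ℤ; +_; -[1+_]; 0ℤ; 1ℤ; _-_; -_)
open import Data.Fin as Fin using (Fin; toℕ; fromℕ<)
open import Data.Bool using (Bool; true; false; if_then_else_; _∧_; _∨_; not)
open import Data.Sum using (_⊎_; inj₁; inj₂)
open import Data.Sum.Properties using (≡-dec)
open import Data.Maybe using (Maybe; just; nothing)
open import Data.List using (List; []; _∷_; map; _++_; foldr; allFin; upTo; take; drop; zipWith; replicate; concat; length)
open import Data.List.Relation.Unary.All using (All)
open import Data.Product using (Σ; _×_; _,_; ∃)
open import Relation.Binary.PropositionalEquality using (_≡_; _≢_; _≗_)
open import Relation.Binary.Definitions using (DecidableEquality)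
open import Relation.Nullary using (¬_; does)
open import Relation.Nullary.Decidable using (⌊_⌋)

sumℤ : List ℤ → ℤ
sumℤ = foldr ℤ._+_ 0ℤ

-- Generalized (crystallographic) Cartan matrix on vertex set Fin k.
-- Every integer GCM is the Cartan matrix of a Coxeter group whose
-- diagram G has an edge i - j iff A i j ≠ 0 (label determined by
-- A i j * A j i ∈ {1,2,3} or ≥ 4).

IsGCM : {k : ℕ} → (Fin k → Fin k → ℤ) → Set
IsGCM {k} A =
  (∀ i → A i i ≡ + 2) ×
  (∀ i j → i ≢ j → A i j ℤ.≤ 0ℤ) ×
  (∀ i j → A i j ≡ 0ℤ → A j i ≡ 0ℤ)

-- Root system of a Cartan matrix A on a finite vertex type V
-- (enumerated without repetition by vs).  Roots are integer-valued
-- functions on vertices; equality of roots is pointwise (_≗_).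

module RootSys {V : Set} (_≟V_ : DecidableEquality V) (vs : List V)
               (A : V → V → ℤ) where

  Vec' : Set
  Vec' = V → ℤ

  pair : V → Vec' → ℤ
  pair i β = sumℤ (map (λ j → A i j ℤ.* β j) vs)

  simple : V → Vec'
  simple i j = if does (i ≟V j) then 1ℤ else 0ℤ

  refl : V → Vec' → Vec'
  refl i β j = β j - pair i β ℤ.* simple i j

  applyWord : List V → Vec' → Vec'
  applyWord []      β = β
  applyWord (i ∷ w) β = refl i (applyWord w β)

  Reach : ℕ → Vec' → Set
  Reach ℓ β = Σ V λ y₀ → Σ (List V) λ w → length w ≡ ℓ × applyWord w (simple y₀) ≗ β

  IsRoot : Vec' → Set
  IsRoot β = Σ ℕ λ ℓ → Reach ℓ β

  IsPosRoot : Vec' → Set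
  IsPosRoot β = IsRoot β × (∀ j → 0ℤ ℤ.≤ β j)

  HasDepth : Vec' → ℕ → Set
  HasDepth β d = IsPosRoot β × Σ ℕ λ ℓ → d ≡ suc ℓ × Reach ℓ β × (∀ ℓ' → Reach ℓ' β → ℓ ℕ.≤ ℓ')

  data _≤R_ (β : Vec') : Vec' → Set where
    ≤R-refl : ∀ {γ} → β ≗ γ → β ≤R γ
    ≤R-step : ∀ {γ δ} (i : V) (d : ℕ) → β ≤R γ → HasDepth γ d →
              HasDepth (refl i γ) (suc d) → refl i γ ≗ δ → β ≤R δ

-- Stretching with respect to elastic data (x, L_x, R_x).
-- inL y = true means y ∈ L_x, false means y ∈ R_x (only relevant for
-- neighbours y of x).

module Stretch {k : ℕ} (A : Fin k → Fin k → ℤ) (x : Fin k) (inL : Fin k → Bool) where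

  -- vertices of st_m(G): inj₁ y for y ∈ G (inj₁ x is x_0), inj₂ j is x_{j+1}
  V : ℕ → Set
  V m = Fin k ⊎ Fin m

  decV : (m : ℕ) → DecidableEquality (V m)
  decV m = ≡-dec Fin._≟_ Fin._≟_

  enum : (m : ℕ) → List (V m)
  enum m = map inj₁ (allFin k) ++ map inj₂ (allFin m)

  -- position on the path (nothing = off the path)
  pos : {m : ℕ} → V m → Maybe ℕ
  pos (inj₁ y) = if does (y Fin.≟ x) then just 0 else nothing
  pos (inj₂ j) = just (suc (toℕ j))

  orig : {m : ℕ} → V m → Fin k
  orig (inj₁ y) = y
  orig (inj₂ _) = x

  attached : ℕ → ℕ → Fin k → Bool
  attached m a z = ((a ≡ᵇ 0) ∧ inL z) ∨ ((a ≡ᵇ m) ∧ not (inL z))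

  pathEntry : ℕ → ℕ → ℤ
  pathEntry a b = if a ≡ᵇ b then + 2
                  else if (suc a ≡ᵇ b) ∨ (suc b ≡ᵇ a) then -[1+ 0 ] else 0ℤ

  stA : (m : ℕ) → V m → V m → ℤ
  stA m u v with pos u | pos v
  ... | nothing | nothing = A (orig u) (orig v)
  ... | just a  | nothing = if attached m a (orig v) then A x (orig v) else 0ℤ
  ... | nothing | just b  = if attached m b (orig u) then A (orig u) x else 0ℤ
  ... | just a  | just b  = pathEntry a b

  module Φ = RootSys Fin._≟_ (allFin k) A
  module StΦ (m : ℕ) = RootSys (decV m) (enum m) (stA m)

  stRoot : (n : ℕ) → (Fin k → ℤ) → V n → ℤ
  stRoot n α v = α (orig v)

  record Marked : Set where
    constructor mk
    field
      m   : ℕ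
      b   : V m → ℤ
      p   : ℕ
      q   : ℕ
      p≤q : p ℕ.≤ q
      q≤m : q ℕ.≤ m
  open Marked public

  -- value at path vertex x_i (0 if i > m)
  pathVal : {m : ℕ} → (V m → ℤ) → ℕ → ℤ
  pathVal {m} g zero = g (inj₁ x)
  pathVal {m} g (suc i) with i ℕ.<? m
  ... | Relation.Nullary.yes lt = g (inj₂ (fromℕ< lt))
  ... | Relation.Nullary.no _  = 0ℤ

  pathList : {m : ℕ} → (V m → ℤ) → List ℤ
  pathList {m} g = map (pathVal g) (upTo (suc m))

  mkFun : (m : ℕ) → (Fin k → ℤ) → (ℕ → ℤ) → V m → ℤ
  mkFun m off pv (inj₁ y) = if does (y Fin.≟ x) then pv 0 else off y
  mkFun m off pv (inj₂ j) = pv (suc (toℕ j))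

  insertAt : ℕ → ℤ → (ℕ → ℤ) → ℕ → ℤ
  insertAt r v pv i = if i <ᵇ r then pv i else if i ≡ᵇ r then v else pv (i ∸ 1)

  -- reflecting at z: b(z) ↦ Σ_{y adj z} -st_m(A)_{zy} b(y) - b(z)
  -- (non-adjacent y contribute 0 since st_m(A)_{zy} = 0)
  reflectAt : {m : ℕ} → (V m → ℤ) → V m → V m → ℤ
  reflectAt {m} g z v =
    if does (decV m v z)
    then sumℤ (map (λ y → if does (decV m y z) then 0ℤ else - (stA m z y ℤ.* g y)) (enum m)) - g z
    else g v

  SL : Marked → ℤ
  SL c with Marked.p c
  ... | zero  = sumℤ (map (λ y → if does (y Fin.≟ x) ∨ not (inL y) then 0ℤ
                                 else - (A x y ℤ.* Marked.b c (inj₁ y))) (allFin k))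
  ... | suc j = pathVal (Marked.b c) j   -- = -(-1) · b(x_{p-1})

  SR : Marked → ℤ
  SR c = if Marked.q c ≡ᵇ Marked.m c
         then sumℤ (map (λ y → if does (y Fin.≟ x) ∨ inL y then 0ℤ
                                else - (A x y ℤ.* Marked.b c (inj₁ y))) (allFin k))
         else pathVal (Marked.b c) (suc (Marked.q c))   -- = -(-1) · b(x_{q+1})

  IsMarkedV : (c : Marked) → V (Marked.m c) → Set
  IsMarkedV c v = Σ ℕ λ j → pos v ≡ just j × Marked.p c ℕ.≤ j × j ℕ.≤ Marked.q c

  withB : (c : Marked) → (V (Marked.m c) → ℤ) → Marked
  withB (mk m b p q p≤q q≤m) b' = mk m b' p q p≤q q≤m

  data Step : Marked → Marked → Set where
    op1 : ∀ (c : Marked) (z : V (m c)) → ¬ IsMarkedV c z →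
          reflectAt (b c) z z ℤ.< b c z → Step c (withB c (reflectAt (b c) z))
    op2 : ∀ (c : Marked) (z : V (m c)) (j : ℕ) → pos z ≡ just j → p c ℕ.< j → j ℕ.< q c →
          reflectAt (b c) z z ℤ.< b c z → Step c (withB c (reflectAt (b c) z))
    op3L : ∀ (c : Marked) → SL c ℤ.< pathVal (b c) (p c) →
           Step c (mk (suc (m c))
                      (mkFun (suc (m c)) (λ y → b c (inj₁ y)) (insertAt (p c) (SL c) (pathVal (b c))))
                      (p c) (suc (q c)) (m≤n⇒m≤1+n (p≤q c)) (s≤s (q≤m c)))
    op3R : ∀ (c : Marked) → SR c ℤ.< pathVal (b c) (q c) →
           Step c (mk (suc (m c))
                      (mkFun (suc (m c)) (λ y → b c (inj₁ y)) (insertAt (suc (q c)) (SR c) (pathVal (b c))))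
                      (p c) (suc (q c)) (m≤n⇒m≤1+n (p≤q c)) (s≤s (q≤m c)))
    op4L-keep : ∀ (c : Marked) (lt : p c ℕ.< q c) (z : V (m c)) → pos z ≡ just (p c) →
           reflectAt (b c) z z ℤ.< b c z →
           reflectAt (b c) z z ℤ.< pathVal (b c) (suc (p c)) →
           Step c (withB c (reflectAt (b c) z))
    op4L-drop : ∀ (c : Marked) (lt : p c ℕ.< q c) (z : V (m c)) → pos z ≡ just (p c) →
           reflectAt (b c) z z ℤ.< b c z →
           pathVal (b c) (suc (p c)) ℤ.≤ reflectAt (b c) z z →
           Step c (mk (m c) (reflectAt (b c) z) (suc (p c)) (q c) lt (q≤m c))
    op4R-keep : ∀ (c : Marked) (lt : p c ℕ.< q c) (z : V (m c)) → pos z ≡ just (q c) →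
           reflectAt (b c) z z ℤ.< b c z →
           reflectAt (b c) z z ℤ.< pathVal (b c) (q c ∸ 1) →
           Step c (withB c (reflectAt (b c) z))
    op4R-drop : ∀ (c : Marked) (lt : p c ℕ.< q c) (z : V (m c)) → pos z ≡ just (q c) →
           reflectAt (b c) z z ℤ.< b c z →
           pathVal (b c) (q c ∸ 1) ℤ.≤ reflectAt (b c) z z →
           Step c (mk (m c) (reflectAt (b c) z) (p c) (q c ∸ 1)
                      (pred-mono-≤ lt) (≤-trans (m∸n≤m (q c) 1) (q≤m c)))

  NonNeg : Marked → Set
  NonNeg c = ∀ v → 0ℤ ℤ.≤ b c v

  alphaStar : (Fin k → ℤ) → Marked
  alphaStar α = mk 0 (stRoot 0 α) 0 0 z≤n z≤n

  data InP (α : Fin k → ℤ) : Marked → Set where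
    base : InP α (alphaStar α)
    step : ∀ {c c'} → InP α c → Step c c' → NonNeg c' → InP α c'

  InClass : Marked → (n : ℕ) → (V n → ℤ) → Set
  InClass c n g =
    (∀ y → y ≢ x → g (inj₁ y) ≡ b c (inj₁ y)) ×
    Σ (List ℕ) λ cs → All (1 ℕ.≤_) cs × length cs ≡ suc (q c ∸ p c) ×
      pathList g ≡ take (p c) L ++ concat (zipWith replicate cs seg) ++ drop (suc (q c)) L
    where
      L   = pathList (b c)
      seg = take (suc (q c ∸ p c)) (drop (p c) L)

  AllSingleHaveElt : (Fin k → ℤ) → ℕ → Set
  AllSingleHaveElt α N = ∀ c → InP α c → p c ≡ q c → Σ (V N → ℤ) λ g → InClass c N g

  IsN0 : (Fin k → ℤ) → ℕ → Set
  IsN0 α n₀ = AllSingleHaveElt α n₀ × (∀ N → AllSingleHaveElt α N → n₀ ℕ.≤ N)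

{-# OPTIONS --safe #-}
module Submission where

-- Real roots of a generalized Cartan matrix are nonnegative or nonpositive: write w ≈ v u with u in
-- a rank-two subgroup and v taking its two simple roots to nonnegative vectors.  Consequently a
-- reflection between positive roots lowers the depth exactly when it lowers the reflected coordinate,
-- and the ideal below st_n(α) consists of what value-lowering reflections reach from st_n(α) without
-- leaving the nonnegative vectors.
--
-- Reflecting at a path vertex replaces its value by left + right − value.  On an element of a class,
-- a lowering reflection at a path vertex whose value is repeated moves the boundary between two runs
-- (the class does not change) or splits off a new run at an end of the marked segment (operation 3);
-- at a value occurring once it is an operation on the class.  The only remaining case, a single
-- asterisk on a value occurring once, is excluded by n > n₀.  Conversely, a changed value
-- that stays marked is smaller than one of its marked neighbours, so elements repeating it arise from
-- one in which it occurs once by letting it spread over that neighbour.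

open import Defs
open import Data.Nat as ℕ using (ℕ; zero; suc; z≤n; s≤s; _≤_; _<_; _≡ᵇ_; _<ᵇ_; _∸_)
import Data.Nat.Properties as ℕₚ
open import Data.Integer as ℤ using (ℤ; +_; -[1+_]; 0ℤ; 1ℤ; -_)
import Data.Integer.Properties as ℤₚ
open import Data.Integer.Tactic.RingSolver using (solve-∀)
open import Data.Fin as Fin using (Fin; toℕ; fromℕ<)
import Data.Fin.Properties as Finₚ
open import Data.Bool using (Bool; true; false; if_then_else_; not; _∧_; _∨_)
open import Data.Maybe using (Maybe; just; nothing)
open import Data.Maybe.Properties using (just-injective)
open import Data.List using (List; []; _∷_; map; _++_; allFin; length; [_]; reverse; upTo; applyUpTo; take; drop; zipWith; replicate; concat)
open import Data.List.Properties using (length-++; length-map; map-++; ++-assoc; ++-identityʳ; unfold-reverse; length-reverse; take-map; drop-map; map-replicate; map-∘)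
open import Data.List.Membership.Propositional using (_∈_; lose)
open import Data.List.Membership.Propositional.Properties using (∈-allFin; ∈-map⁺; ∈-map⁻; ∈-++⁺ˡ; ∈-++⁺ʳ)
open import Data.List.Relation.Unary.Any using (here; there; any?; satisfied)
open import Data.List.Relation.Unary.All using (All; []; _∷_; all?)
import Data.List.Relation.Unary.All as All
open import Data.List.Relation.Unary.AllPairs using (_∷_)
open import Data.List.Relation.Unary.Unique.Propositional using (Unique)
import Data.List.Relation.Unary.Unique.Propositional.Properties as Uniqueₚ
open import Data.Product using (Σ; _×_; _,_; proj₁; proj₂)
open import Data.Sum using (_⊎_; inj₁; inj₂)
open import Data.Sum.Properties using (inj₁-injective; inj₂-injective)
open import Data.Empty using (⊥; ⊥-elim)
open import Relation.Binary.PropositionalEquality hiding ([_])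
open import Relation.Binary.Definitions using (DecidableEquality; tri<; tri≈; tri>)
open import Relation.Nullary using (¬_; does; yes; no; Dec)
import Relation.Nullary.Decidable as Dec

-- Finite sums

-- Depth is a minimum over words, while an operation on a class only tests whether one coordinate
-- drops; the sign of the roots is what makes the two comparable. Neither the Coxeter group nor its
-- length function is built: words are identified when they act equally on integer vectors, and "a
-- shorter word" replaces "a shorter element". In rank two the action on `v + c α_s + d α_t` is
-- affine, with coefficients linear in the two pairings of `v`, so a braid relation is a finite
-- computation valid for all `v` at once. Run lengths behave badly under reflections. An element of
-- a class is therefore given by an index map from the long path to the path of the class, rising by
-- 0 or 1, by 0 only over marked vertices. A reflection moves one value of this map, splits a run,
-- or leaves the map alone and changes the class. The strict bound on `n` has one source: a single
-- marked value that occurs once makes the index map the identity, hence `m = n`, and no operation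
-- reflects at that vertex; but `n₀` bounds `m` for all such classes.

∑ : {V : Set} → List V → (V → ℤ) → ℤ
∑ vs f = sumℤ (map f vs)

module _ {V : Set} where

  ∑-cong : (vs : List V) {f g : V → ℤ} → f ≗ g → ∑ vs f ≡ ∑ vs g
  ∑-cong [] e = refl
  ∑-cong (v ∷ vs) e = cong₂ ℤ._+_ (e v) (∑-cong vs e)

  ∑-+ : (vs : List V) (f g : V → ℤ) → ∑ vs (λ v → f v ℤ.+ g v) ≡ ∑ vs f ℤ.+ ∑ vs g
  ∑-+ [] f g = refl
  ∑-+ (v ∷ vs) f g = trans (cong (ℤ._+_ (f v ℤ.+ g v)) (∑-+ vs f g)) (swap (f v) (g v) (∑ vs f) (∑ vs g))
    where
    swap : ∀ a b c d → (a ℤ.+ b) ℤ.+ (c ℤ.+ d) ≡ (a ℤ.+ c) ℤ.+ (b ℤ.+ d)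
    swap = solve-∀

  ∑-* : (vs : List V) (c : ℤ) (f : V → ℤ) → ∑ vs (λ v → c ℤ.* f v) ≡ c ℤ.* ∑ vs f
  ∑-* [] c f = sym (ℤₚ.*-zeroʳ c)
  ∑-* (v ∷ vs) c f = trans (cong (ℤ._+_ (c ℤ.* f v)) (∑-* vs c f)) (sym (ℤₚ.*-distribˡ-+ c (f v) (∑ vs f)))

  ∑-0 : (vs : List V) → ∑ vs (λ _ → 0ℤ) ≡ 0ℤ
  ∑-0 [] = refl
  ∑-0 (v ∷ vs) = trans (ℤₚ.+-identityˡ _) (∑-0 vs)

  ∑-++ : (us vs : List V) (f : V → ℤ) → ∑ (us ++ vs) f ≡ ∑ us f ℤ.+ ∑ vs f
  ∑-++ [] vs f = sym (ℤₚ.+-identityˡ _)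
  ∑-++ (u ∷ us) vs f = trans (cong (ℤ._+_ (f u)) (∑-++ us vs f)) (sym (ℤₚ.+-assoc (f u) _ _))

  module _ (_≟_ : DecidableEquality V) where

    only : V → (V → ℤ) → V → ℤ
    only l f j = if does (l ≟ j) then f j else 0ℤ

    ∑-only-∉ : (vs : List V) (f : V → ℤ) (l : V) → All (l ≢_) vs → ∑ vs (only l f) ≡ 0ℤ
    ∑-only-∉ [] f l [] = refl
    ∑-only-∉ (v ∷ vs) f l (l≢v ∷ ps) with l ≟ v
    ... | yes l≡v = ⊥-elim (l≢v l≡v)
    ... | no _    = trans (ℤₚ.+-identityˡ _) (∑-only-∉ vs f l ps)

    ∑-only : (vs : List V) (f : V → ℤ) (l : V) → Unique vs → l ∈ vs → ∑ vs (only l f) ≡ f l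
    ∑-only (v ∷ vs) f .v (v∉ ∷ _) (here refl) with v ≟ v
    ... | yes _ = trans (cong (ℤ._+_ (f v)) (∑-only-∉ vs f v v∉)) (ℤₚ.+-identityʳ _)
    ... | no ¬p = ⊥-elim (¬p refl)
    ∑-only (v ∷ vs) f l (v∉ ∷ u) (there l∈) with l ≟ v
    ... | yes refl = ⊥-elim (All.lookup v∉ l∈ refl)
    ... | no _     = trans (ℤₚ.+-identityˡ _) (∑-only vs f l u l∈)

∑-map : {U V : Set} (us : List U) (h : U → V) (f : V → ℤ) → ∑ (map h us) f ≡ ∑ us (λ u → f (h u))
∑-map [] h f = refl
∑-map (u ∷ us) h f = cong (ℤ._+_ (f (h u))) (∑-map us h f)

pos-*-nonNeg : ∀ {a b} → 0ℤ ℤ.≤ a → 0ℤ ℤ.≤ b → 0ℤ ℤ.≤ a ℤ.* b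
pos-*-nonNeg {+ a} {+ b} _ _ = subst (0ℤ ℤ.≤_) (ℤₚ.pos-* a b) (ℤ.+≤+ z≤n)

-- Rank two

-- Affine action of a word in two reflections s (true) and t (false) on
-- v + c α_s + d α_t, where p and q are the pairings of v with s and t.
module Rank2 (a b : ℤ) where

  step : ℤ → ℤ → Bool → ℤ × ℤ → ℤ × ℤ
  step p q true  (c , d) = (- c ℤ.+ a ℤ.* d ℤ.- p) , d
  step p q false (c , d) = c , (- d ℤ.+ b ℤ.* c ℤ.- q)

  run : ℤ → ℤ → List Bool → ℤ × ℤ → ℤ × ℤ
  run p q []      cd = cd
  run p q (e ∷ u) cd = step p q e (run p q u cd)

  -- The coefficients of p and q in the two components of run p q u (0 , 0).
  Lin : Set
  Lin = (ℤ × ℤ) × (ℤ × ℤ)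

  linStep : Bool → Lin → Lin
  linStep true  ((c₁ , c₂) , (d₁ , d₂)) = ((- c₁ ℤ.+ a ℤ.* d₁ ℤ.- 1ℤ) , (- c₂ ℤ.+ a ℤ.* d₂)) , (d₁ , d₂)
  linStep false ((c₁ , c₂) , (d₁ , d₂)) = (c₁ , c₂) , ((- d₁ ℤ.+ b ℤ.* c₁) , (- d₂ ℤ.+ b ℤ.* c₂ ℤ.- 1ℤ))

  lin : List Bool → Lin
  lin []      = (0ℤ , 0ℤ) , (0ℤ , 0ℤ)
  lin (e ∷ u) = linStep e (lin u)

  eval : ℤ → ℤ → Lin → ℤ × ℤ
  eval p q ((c₁ , c₂) , (d₁ , d₂)) = (c₁ ℤ.* p ℤ.+ c₂ ℤ.* q) , (d₁ ℤ.* p ℤ.+ d₂ ℤ.* q)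

  eval-step : ∀ p q e l → step p q e (eval p q l) ≡ eval p q (linStep e l)
  eval-step p q true ((c₁ , c₂) , (d₁ , d₂)) = cong (_, (d₁ ℤ.* p ℤ.+ d₂ ℤ.* q)) (id₁ a p q c₁ c₂ d₁ d₂)
    where
    id₁ : ∀ a p q c₁ c₂ d₁ d₂ → - (c₁ ℤ.* p ℤ.+ c₂ ℤ.* q) ℤ.+ a ℤ.* (d₁ ℤ.* p ℤ.+ d₂ ℤ.* q) ℤ.- p
          ≡ (- c₁ ℤ.+ a ℤ.* d₁ ℤ.- 1ℤ) ℤ.* p ℤ.+ (- c₂ ℤ.+ a ℤ.* d₂) ℤ.* q
    id₁ = solve-∀
  eval-step p q false ((c₁ , c₂) , (d₁ , d₂)) = cong ((c₁ ℤ.* p ℤ.+ c₂ ℤ.* q) ,_) (id₂ b p q c₁ c₂ d₁ d₂)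
    where
    id₂ : ∀ b p q c₁ c₂ d₁ d₂ → - (d₁ ℤ.* p ℤ.+ d₂ ℤ.* q) ℤ.+ b ℤ.* (c₁ ℤ.* p ℤ.+ c₂ ℤ.* q) ℤ.- q
          ≡ (- d₁ ℤ.+ b ℤ.* c₁) ℤ.* p ℤ.+ (- d₂ ℤ.+ b ℤ.* c₂ ℤ.- 1ℤ) ℤ.* q
    id₂ = solve-∀

  run-lin : ∀ p q u → run p q u (0ℤ , 0ℤ) ≡ eval p q (lin u)
  run-lin p q []      = refl
  run-lin p q (e ∷ u) = trans (cong (step p q e) (run-lin p q u)) (eval-step p q e (lin u))

-- The alternating word of length n whose innermost (rightmost) letter is e.
next : Bool → ℕ → Bool
next e zero    = e
next e (suc n) = not (next e n)

alt : Bool → ℕ → List Bool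
alt e zero    = []
alt e (suc n) = next e n ∷ alt e n

length-alt : ∀ e n → length (alt e n) ≡ n
length-alt e zero    = refl
length-alt e (suc n) = cong suc (length-alt e n)

NonNeg₂ : ℤ × ℤ → Set
NonNeg₂ (c , d) = (0ℤ ℤ.≤ c) × (0ℤ ℤ.≤ d)

-- With `a`, `b` the negatives of the two Cartan entries, either an alternating word whose first
-- acting letter is `t` keeps `α_s` nonnegative, or it is at least as long as a braid relation. The
-- products 0, 1, 2, 3 of `a` and `b` give braids of length 2, 3, 4, 6. As an equality of `lin`, a
-- braid relation is verified by `refl`.
record Dihedral (a b : ℤ) : Set where
  open Rank2 a b
  field
    coef : ∀ n → NonNeg₂ (run 0ℤ 0ℤ (alt false n) (1ℤ , 0ℤ)) ⊎
                 Σ ℕ λ m → Σ ℕ λ r → (n ≡ r ℕ.+ suc m) × (lin (alt false (suc m)) ≡ lin (alt true (suc m)))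

private
  +-nonNeg₂ : ∀ {c d} → NonNeg₂ (+ c , + d)
  +-nonNeg₂ = ℤ.+≤+ z≤n , ℤ.+≤+ z≤n

open Dihedral

dihedral₀₀ : Dihedral 0ℤ 0ℤ
dihedral₀₀ .coef 0 = inj₁ +-nonNeg₂
dihedral₀₀ .coef 1 = inj₁ +-nonNeg₂
dihedral₀₀ .coef (suc (suc n)) = inj₂ (1 , n , ℕₚ.+-comm 2 n , refl)

dihedral₁₁ : Dihedral 1ℤ 1ℤ
dihedral₁₁ .coef 0 = inj₁ +-nonNeg₂
dihedral₁₁ .coef 1 = inj₁ +-nonNeg₂
dihedral₁₁ .coef 2 = inj₁ +-nonNeg₂
dihedral₁₁ .coef (suc (suc (suc n))) = inj₂ (2 , n , ℕₚ.+-comm 3 n , refl)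

dihedral₁₂ : Dihedral 1ℤ (+ 2)
dihedral₁₂ .coef 0 = inj₁ +-nonNeg₂
dihedral₁₂ .coef 1 = inj₁ +-nonNeg₂
dihedral₁₂ .coef 2 = inj₁ +-nonNeg₂
dihedral₁₂ .coef 3 = inj₁ +-nonNeg₂
dihedral₁₂ .coef (suc (suc (suc (suc n)))) = inj₂ (3 , n , ℕₚ.+-comm 4 n , refl)

dihedral₂₁ : Dihedral (+ 2) 1ℤ
dihedral₂₁ .coef 0 = inj₁ +-nonNeg₂
dihedral₂₁ .coef 1 = inj₁ +-nonNeg₂
dihedral₂₁ .coef 2 = inj₁ +-nonNeg₂
dihedral₂₁ .coef 3 = inj₁ +-nonNeg₂
dihedral₂₁ .coef (suc (suc (suc (suc n)))) = inj₂ (3 , n , ℕₚ.+-comm 4 n , refl)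

dihedral₁₃ : Dihedral 1ℤ (+ 3)
dihedral₁₃ .coef 0 = inj₁ +-nonNeg₂
dihedral₁₃ .coef 1 = inj₁ +-nonNeg₂
dihedral₁₃ .coef 2 = inj₁ +-nonNeg₂
dihedral₁₃ .coef 3 = inj₁ +-nonNeg₂
dihedral₁₃ .coef 4 = inj₁ +-nonNeg₂
dihedral₁₃ .coef 5 = inj₁ +-nonNeg₂
dihedral₁₃ .coef (suc (suc (suc (suc (suc (suc n)))))) = inj₂ (5 , n , ℕₚ.+-comm 6 n , refl)

dihedral₃₁ : Dihedral (+ 3) 1ℤ
dihedral₃₁ .coef 0 = inj₁ +-nonNeg₂
dihedral₃₁ .coef 1 = inj₁ +-nonNeg₂
dihedral₃₁ .coef 2 = inj₁ +-nonNeg₂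
dihedral₃₁ .coef 3 = inj₁ +-nonNeg₂
dihedral₃₁ .coef 4 = inj₁ +-nonNeg₂
dihedral₃₁ .coef 5 = inj₁ +-nonNeg₂
dihedral₃₁ .coef (suc (suc (suc (suc (suc (suc n)))))) = inj₂ (5 , n , ℕₚ.+-comm 6 n , refl)

-- For a b ≥ 4 the coefficients never turn negative: with c, d the coefficients before a
-- reflection in s, the invariant 2 c ≤ a d is passed on (with the roles of s, t exchanged).
double-invariant : ∀ a b c d → 4 ≤ a ℕ.* b → (+ 2) ℤ.* c ℤ.≤ (+ a) ℤ.* d → 0ℤ ℤ.≤ c → 0ℤ ℤ.≤ d →
  (0ℤ ℤ.≤ - c ℤ.+ (+ a) ℤ.* d ℤ.- 0ℤ) × ((+ 2) ℤ.* d ℤ.≤ (+ b) ℤ.* (- c ℤ.+ (+ a) ℤ.* d ℤ.- 0ℤ))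
double-invariant a b c d 4≤ab h c≥0 d≥0 = nonNeg , ℤₚ.*-cancelˡ-≤-pos _ _ (+ 2) twice
  where
  A = + a
  B = + b
  e = - c ℤ.+ A ℤ.* d ℤ.- 0ℤ
  e₁ : ∀ A c d → (A ℤ.* d ℤ.- (+ 2) ℤ.* c) ℤ.+ c ≡ - c ℤ.+ A ℤ.* d ℤ.- 0ℤ
  e₁ = solve-∀
  nonNeg : 0ℤ ℤ.≤ e
  nonNeg = subst (0ℤ ℤ.≤_) (e₁ A c d) (ℤₚ.+-mono-≤ (ℤₚ.i≤j⇒0≤j-i h) c≥0)
  e₂ : ∀ A B c d → (+ 2) ℤ.* (B ℤ.* (- c ℤ.+ A ℤ.* d ℤ.- 0ℤ)) ℤ.- (+ 2) ℤ.* ((+ 2) ℤ.* d)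
       ≡ B ℤ.* (A ℤ.* d ℤ.- (+ 2) ℤ.* c) ℤ.+ (A ℤ.* B ℤ.- (+ 4)) ℤ.* d
  e₂ = solve-∀
  4≤AB : (+ 4) ℤ.≤ A ℤ.* B
  4≤AB = subst ((+ 4) ℤ.≤_) (ℤₚ.pos-* a b) (ℤ.+≤+ 4≤ab)
  twice : (+ 2) ℤ.* ((+ 2) ℤ.* d) ℤ.≤ (+ 2) ℤ.* (B ℤ.* e)
  twice = ℤₚ.0≤i-j⇒j≤i (subst (0ℤ ℤ.≤_) (sym (e₂ A B c d))
    (ℤₚ.+-mono-≤ (pos-*-nonNeg {B} (ℤ.+≤+ z≤n) (ℤₚ.i≤j⇒0≤j-i h))
                 (pos-*-nonNeg (ℤₚ.i≤j⇒0≤j-i 4≤AB) d≥0)))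

module _ (a b : ℕ) (4≤ab : 4 ≤ a ℕ.* b) where
  open Rank2 (+ a) (+ b)

  Invariant : Bool → ℤ × ℤ → Set
  Invariant true  (c , d) = (+ 2) ℤ.* c ℤ.≤ (+ a) ℤ.* d
  Invariant false (c , d) = (+ 2) ℤ.* d ℤ.≤ (+ b) ℤ.* c

  step-invariant : ∀ e cd → Invariant e cd → NonNeg₂ cd →
    NonNeg₂ (step 0ℤ 0ℤ e cd) × Invariant (not e) (step 0ℤ 0ℤ e cd)
  step-invariant true (c , d) i (c≥0 , d≥0) with double-invariant a b c d 4≤ab i c≥0 d≥0
  ... | n , j = (n , d≥0) , j
  step-invariant false (c , d) i (c≥0 , d≥0)
    with double-invariant b a d c (subst (4 ≤_) (ℕₚ.*-comm a b) 4≤ab) i d≥0 c≥0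
  ... | n , j = (c≥0 , n) , j

  run-invariant : ∀ n → NonNeg₂ (run 0ℤ 0ℤ (alt false n) (1ℤ , 0ℤ)) ×
                        Invariant (next false n) (run 0ℤ 0ℤ (alt false n) (1ℤ , 0ℤ))
  run-invariant zero = +-nonNeg₂ , subst (0ℤ ℤ.≤_) (sym (ℤₚ.*-identityʳ (+ b))) (ℤ.+≤+ z≤n)
  run-invariant (suc n) with run-invariant n
  ... | nonneg , inv = step-invariant (next false n) _ inv nonneg

  dihedral-large : Dihedral (+ a) (+ b)
  dihedral-large .coef n = inj₁ (proj₁ (run-invariant n))

dihedral : ∀ a b → (a ≡ 0 → b ≡ 0) → (b ≡ 0 → a ≡ 0) → Dihedral (+ a) (+ b)
dihedral zero b h₁ h₂ with h₁ refl
... | refl = dihedral₀₀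
dihedral (suc a) zero h₁ h₂ with h₂ refl
... | ()
dihedral 1 1 _ _ = dihedral₁₁
dihedral 1 2 _ _ = dihedral₁₂
dihedral 1 3 _ _ = dihedral₁₃
dihedral 1 (suc (suc (suc (suc b)))) _ _ = dihedral-large 1 _ (s≤s (s≤s (s≤s (s≤s z≤n))))
dihedral 2 1 _ _ = dihedral₂₁
dihedral 3 1 _ _ = dihedral₃₁
dihedral (suc (suc (suc (suc a)))) 1 _ _ = dihedral-large _ 1 (s≤s (s≤s (s≤s (s≤s z≤n))))
dihedral (suc (suc a)) (suc (suc b)) _ _ =
  dihedral-large (suc (suc a)) (suc (suc b)) (ℕₚ.*-mono-≤ {2} {suc (suc a)} {2} {suc (suc b)} (s≤s (s≤s z≤n)) (s≤s (s≤s z≤n)))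

-- A doubled letter cancels, reflections being involutions, so coefficients have to be analysed for
-- alternating words only.
alternating : (u : List Bool) →
  (Σ Bool λ e → u ≡ alt e (length u)) ⊎
  (Σ (List Bool) λ u₁ → Σ Bool λ e → Σ (List Bool) λ u₂ → u ≡ u₁ ++ e ∷ e ∷ u₂)
alternating [] = inj₁ (true , refl)
alternating (b ∷ u) with alternating u
... | inj₂ (u₁ , e , u₂ , eq) = inj₂ (b ∷ u₁ , e , u₂ , cong (b ∷_) eq)
... | inj₁ (e , eq) = cons b e (length u) eq
  where
  bool-dichotomy : ∀ b c → (b ≡ not c) ⊎ (b ≡ c)
  bool-dichotomy true  true  = inj₂ refl
  bool-dichotomy true  false = inj₁ refl
  bool-dichotomy false true  = inj₁ refl
  bool-dichotomy false false = inj₂ refl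
  cons : ∀ b e n → u ≡ alt e n → (Σ Bool λ e' → b ∷ u ≡ alt e' (suc (length u))) ⊎
    (Σ (List Bool) λ u₁ → Σ Bool λ e' → Σ (List Bool) λ u₂ → b ∷ u ≡ u₁ ++ e' ∷ e' ∷ u₂)
  cons b e zero refl = inj₁ (b , refl)
  cons b e (suc n) refl with bool-dichotomy b (next e n)
  ... | inj₁ h = inj₁ (e , cong₂ _∷_ (trans h (cong (λ l → not (next e l)) (sym (length-alt e n))))
                               (cong (alt e) (sym (cong suc (length-alt e n)))))
  ... | inj₂ refl = inj₂ ([] , next e n , alt e n , refl)

next-not : ∀ e n → not (next e n) ≡ next (not e) n
next-not e zero    = refl
next-not e (suc n) = cong not (next-not e n)

alt-snoc : ∀ e n → alt e (suc n) ≡ alt (not e) n ++ [ e ]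
alt-snoc e zero    = refl
alt-snoc e (suc n) = cong₂ _∷_ (next-not e n) (alt-snoc e n)

-- Isolates the innermost `m` letters: the braid relation is applied there because it has to change
-- the letter that acts first.
alt-split : ∀ e r m → Σ (List Bool) λ u → (alt e (r ℕ.+ m) ≡ u ++ alt e m) × (length u ≡ r)
alt-split e zero    m = [] , refl , refl
alt-split e (suc r) m with alt-split e r m
... | u , eq , l = next e (r ℕ.+ m) ∷ u , cong (_ ∷_) eq , cong suc l

neg-nat : ∀ i → i ℤ.≤ 0ℤ → Σ ℕ λ n → i ≡ - (+ n)
neg-nat (+ zero)  _ = 0 , refl
neg-nat -[1+ n ]  _ = suc n , refl
neg-nat (+ suc n) (ℤ.+≤+ ())

snoc-view : {X : Set} (x : X) (w : List X) → Σ (List X) λ w' → Σ X λ y → x ∷ w ≡ w' ++ [ y ]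
snoc-view x [] = [] , x , refl
snoc-view x (y ∷ w) with snoc-view y w
... | w' , z , eq = x ∷ w' , z , cong (x ∷_) eq

length-snoc : {X : Set} (w : List X) (y : X) → length (w ++ [ y ]) ≡ suc (length w)
length-snoc w y = trans (length-++ w) (ℕₚ.+-comm (length w) 1)

least : {P : ℕ → Set} → (∀ ℓ → Dec (P ℓ)) → ∀ k → P k → Σ ℕ λ ℓ → P ℓ × (∀ ℓ' → P ℓ' → ℓ ≤ ℓ')
least P? k pk with P? 0
... | yes p0 = 0 , p0 , λ _ _ → z≤n
least P? zero    pk | no ¬p0 = ⊥-elim (¬p0 pk)
least {P} P? (suc k) pk | no ¬p0 with least {λ ℓ → P (suc ℓ)} (λ ℓ → P? (suc ℓ)) k pk
... | ℓ , p , min = suc ℓ , p , minimal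
  where
  minimal : ∀ ℓ' → P ℓ' → suc ℓ ≤ ℓ'
  minimal zero     p' = ⊥-elim (¬p0 p')
  minimal (suc ℓ') p' = s≤s (min ℓ' p')

nonNeg-unit : ∀ i j → 0ℤ ℤ.≤ i → i ℤ.* j ≡ 1ℤ → i ≡ 1ℤ
nonNeg-unit (+ n) j _ eq = cong +_ (ℕₚ.m*n≡1⇒m≡1 n ℤ.∣ j ∣ (trans (sym (ℤₚ.abs-* (+ n) j)) (cong ℤ.∣_∣ eq)))

-- Roots of a generalized Cartan matrix

module Coxeter {V : Set} (_≟V_ : DecidableEquality V) (vs : List V) (unique : Unique vs)
  (complete : ∀ v → v ∈ vs) (A : V → V → ℤ) (diag : ∀ i → A i i ≡ + 2)
  (offdiag : ∀ i j → i ≢ j → A i j ℤ.≤ 0ℤ) (zeros : ∀ i j → A i j ≡ 0ℤ → A j i ≡ 0ℤ) where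
  open RootSys _≟V_ vs A public renaming (refl to σ)

  _+[_]_ : Vec' → ℤ → Vec' → Vec'
  (β +[ c ] γ) j = β j ℤ.+ c ℤ.* γ j

  pair-cong : ∀ i {β γ} → β ≗ γ → pair i β ≡ pair i γ
  pair-cong i e = ∑-cong vs (λ j → cong (A i j ℤ.*_) (e j))

  pair-lin : ∀ i β c γ → pair i (β +[ c ] γ) ≡ pair i β ℤ.+ c ℤ.* pair i γ
  pair-lin i β c γ = begin
    pair i (β +[ c ] γ)
      ≡⟨ ∑-cong vs (λ j → distr (A i j) (β j) c (γ j)) ⟩
    ∑ vs (λ j → A i j ℤ.* β j ℤ.+ c ℤ.* (A i j ℤ.* γ j))
      ≡⟨ ∑-+ vs (λ j → A i j ℤ.* β j) (λ j → c ℤ.* (A i j ℤ.* γ j)) ⟩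
    pair i β ℤ.+ ∑ vs (λ j → c ℤ.* (A i j ℤ.* γ j))
      ≡⟨ cong (λ z → pair i β ℤ.+ z) (∑-* vs c (λ j → A i j ℤ.* γ j)) ⟩
    pair i β ℤ.+ c ℤ.* pair i γ ∎
    where
    open ≡-Reasoning
    distr : ∀ a b c g → a ℤ.* (b ℤ.+ c ℤ.* g) ≡ a ℤ.* b ℤ.+ c ℤ.* (a ℤ.* g)
    distr = solve-∀

  pair-simple : ∀ i l → pair i (simple l) ≡ A i l
  pair-simple i l = trans (∑-cong vs pointwise) (∑-only _≟V_ vs (A i) l unique (complete l))
    where
    pointwise : ∀ j → A i j ℤ.* simple l j ≡ only _≟V_ l (A i) j
    pointwise j with does (l ≟V j)
    ... | true  = ℤₚ.*-identityʳ (A i j)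
    ... | false = ℤₚ.*-zeroʳ (A i j)

  simple-self : ∀ i → simple i i ≡ 1ℤ
  simple-self i with i ≟V i
  ... | yes _ = refl
  ... | no ¬p = ⊥-elim (¬p refl)

  simple-other : ∀ {i j} → i ≢ j → simple i j ≡ 0ℤ
  simple-other {i} {j} i≢j with i ≟V j
  ... | yes p = ⊥-elim (i≢j p)
  ... | no _  = refl

  simple-nonNeg : ∀ i j → 0ℤ ℤ.≤ simple i j
  simple-nonNeg i j with does (i ≟V j)
  ... | true  = ℤ.+≤+ z≤n
  ... | false = ℤ.+≤+ z≤n

  σ-other : ∀ i β {j} → i ≢ j → σ i β j ≡ β j
  σ-other i β {j} i≢j rewrite simple-other i≢j = lem (β j) (pair i β)
    where
    lem : ∀ b p → b ℤ.- p ℤ.* 0ℤ ≡ b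
    lem = solve-∀

  σ-self : ∀ i β → σ i β i ≡ β i ℤ.- pair i β
  σ-self i β rewrite simple-self i = cong (λ z → β i ℤ.- z) (ℤₚ.*-identityʳ (pair i β))

  σ-cong : ∀ i {β γ} → β ≗ γ → σ i β ≗ σ i γ
  σ-cong i e j = cong₂ ℤ._-_ (e j) (cong (ℤ._* simple i j) (pair-cong i e))

  σ-lin : ∀ i β c γ → σ i (β +[ c ] γ) ≗ (σ i β +[ c ] σ i γ)
  σ-lin i β c γ j = trans (cong (λ z → β j ℤ.+ c ℤ.* γ j ℤ.- z ℤ.* simple i j) (pair-lin i β c γ))
                          (lem (β j) c (γ j) (pair i β) (pair i γ) (simple i j))
    where
    lem : ∀ b c g p q s → b ℤ.+ c ℤ.* g ℤ.- (p ℤ.+ c ℤ.* q) ℤ.* s ≡ (b ℤ.- p ℤ.* s) ℤ.+ c ℤ.* (g ℤ.- q ℤ.* s)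
    lem = solve-∀

  σ-+[] : ∀ l β → σ l β ≗ (β +[ - pair l β ] simple l)
  σ-+[] l β j = cong (λ z → β j ℤ.+ z) (ℤₚ.neg-distribˡ-* (pair l β) (simple l j))

  pair-σ : ∀ i β → pair i (σ i β) ≡ - pair i β
  pair-σ i β = begin
    pair i (σ i β)                            ≡⟨ pair-cong i (σ-+[] i β) ⟩
    pair i (β +[ - pair i β ] simple i)       ≡⟨ pair-lin i β (- pair i β) (simple i) ⟩
    pair i β ℤ.+ (- pair i β) ℤ.* pair i (simple i)
      ≡⟨ cong (λ z → pair i β ℤ.+ (- pair i β) ℤ.* z) (trans (pair-simple i i) (diag i)) ⟩
    pair i β ℤ.+ (- pair i β) ℤ.* (+ 2)       ≡⟨ lem (pair i β) ⟩
    - pair i β ∎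
    where
    open ≡-Reasoning
    lem : ∀ p → p ℤ.+ (- p) ℤ.* (+ 2) ≡ - p
    lem = solve-∀

  σ-involutive : ∀ i β → σ i (σ i β) ≗ β
  σ-involutive i β j = trans (cong (λ z → σ i β j ℤ.- z ℤ.* simple i j) (pair-σ i β))
                             (lem (β j) (pair i β) (simple i j))
    where
    lem : ∀ b p s → (b ℤ.- p ℤ.* s) ℤ.- (- p) ℤ.* s ≡ b
    lem = solve-∀

  word-cong : ∀ w {β γ} → β ≗ γ → applyWord w β ≗ applyWord w γ
  word-cong []      e = e
  word-cong (i ∷ w) e = σ-cong i (word-cong w e)

  word-lin : ∀ w β c γ → applyWord w (β +[ c ] γ) ≗ (applyWord w β +[ c ] applyWord w γ)
  word-lin []      β c γ j = refl
  word-lin (i ∷ w) β c γ j = trans (σ-cong i (word-lin w β c γ) j) (σ-lin i (applyWord w β) c (applyWord w γ) j)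

  word-++ : ∀ w u β → applyWord (w ++ u) β ≡ applyWord w (applyWord u β)
  word-++ []      u β = refl
  word-++ (i ∷ w) u β = cong (σ i) (word-++ w u β)

  word-cancel : ∀ w i u β → applyWord (w ++ i ∷ i ∷ u) β ≗ applyWord (w ++ u) β
  word-cancel []      i u β = σ-involutive i (applyWord u β)
  word-cancel (k ∷ w) i u β = σ-cong k (word-cancel w i u β)

  reverse-inverseˡ : ∀ w β → applyWord (reverse w) (applyWord w β) ≗ β
  reverse-inverseˡ []      β j = refl
  reverse-inverseˡ (i ∷ w) β j = begin
    applyWord (reverse (i ∷ w)) (σ i (applyWord w β)) j
      ≡⟨ cong (λ z → applyWord z (σ i (applyWord w β)) j) (unfold-reverse i w) ⟩
    applyWord (reverse w ++ [ i ]) (σ i (applyWord w β)) j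
      ≡⟨ cong (λ f → f j) (word-++ (reverse w) [ i ] _) ⟩
    applyWord (reverse w) (σ i (σ i (applyWord w β))) j
      ≡⟨ word-cong (reverse w) (σ-involutive i (applyWord w β)) j ⟩
    applyWord (reverse w) (applyWord w β) j
      ≡⟨ reverse-inverseˡ w β j ⟩
    β j ∎
    where open ≡-Reasoning

  infix 4 _≈_
  -- Equality in the Coxeter group is replaced by equal action on all integer vectors. The record
  -- wrapper keeps `w` and `u` inferable, which the bare function type would not.
  record _≈_ (w u : List V) : Set where
    constructor equiv
    field apply-≗ : ∀ β → applyWord w β ≗ applyWord u β
  open _≈_

  ≈-trans : ∀ {w u v} → w ≈ u → u ≈ v → w ≈ v
  ≈-trans p q = equiv λ β j → trans (apply-≗ p β j) (apply-≗ q β j)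

  ≡⇒≈ : ∀ {w u} → w ≡ u → w ≈ u
  ≡⇒≈ refl = equiv λ β j → refl

  ≈-refl : ∀ {w} → w ≈ w
  ≈-refl = ≡⇒≈ refl

  ++-≈ : ∀ {w w' u u'} → w ≈ w' → u ≈ u' → w ++ u ≈ w' ++ u'
  ++-≈ {w} {w'} {u} {u'} p q = equiv λ β j → begin
    applyWord (w ++ u) β j           ≡⟨ cong (λ f → f j) (word-++ w u β) ⟩
    applyWord w (applyWord u β) j    ≡⟨ apply-≗ p (applyWord u β) j ⟩
    applyWord w' (applyWord u β) j   ≡⟨ word-cong w' (apply-≗ q β) j ⟩
    applyWord w' (applyWord u' β) j  ≡⟨ cong (λ f → f j) (sym (word-++ w' u' β)) ⟩
    applyWord (w' ++ u') β j ∎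
    where open ≡-Reasoning

  NonNegVec : Vec' → Set
  NonNegVec β = ∀ j → 0ℤ ℤ.≤ β j

  -- Stands in for the dichotomy between `w α_s > 0` and `ℓ(w s) < ℓ(w)`. The word `w` need not be
  -- reduced, and the second case supplies an actual word, on which induction on length can
  -- continue.
  Descent : List V → V → Set
  Descent w s = NonNegVec (applyWord w (simple s)) ⊎
                (Σ (List V) λ w' → length w' < length w × w ++ [ s ] ≈ w')

  -- Words in two reflections.

  module Rank2Words (s t : V) (s≢t : s ≢ t) where

    letter : Bool → V
    letter e = if e then s else t

    word : List Bool → List V
    word = map letter

    a⁻ b⁻ : Σ ℕ _
    a⁻ = neg-nat (A s t) (offdiag s t s≢t)
    b⁻ = neg-nat (A t s) (offdiag t s (λ e → s≢t (sym e)))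

    a b : ℕ
    a = proj₁ a⁻
    b = proj₁ b⁻

    zero-sym : ∀ {i j m n} → A i j ≡ - (+ m) → A j i ≡ - (+ n) → m ≡ 0 → n ≡ 0
    zero-sym {i} {j} {n = n} p q refl = ℤₚ.+-injective (trans (sym (ℤₚ.neg-involutive (+ n)))
      (cong -_ (trans (sym q) (zeros i j p))))

    open Rank2 (+ a) (+ b)

    at : Vec' → ℤ × ℤ → Vec'
    at v (c , d) = (v +[ c ] simple s) +[ d ] simple t

    pair-at : ∀ i v c d → pair i (at v (c , d)) ≡ (pair i v ℤ.+ c ℤ.* A i s) ℤ.+ d ℤ.* A i t
    pair-at i v c d = trans (pair-lin i _ d (simple t))
      (cong₂ ℤ._+_ (trans (pair-lin i v c (simple s)) (cong (λ z → pair i v ℤ.+ c ℤ.* z) (pair-simple i s)))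
                   (cong (d ℤ.*_) (pair-simple i t)))

    at-step : ∀ v e cd → σ (letter e) (at v cd) ≗ at v (step (pair s v) (pair t v) e cd)
    at-step v true (c , d) j =
      trans (cong (λ z → at v (c , d) j ℤ.- z ℤ.* simple s j)
              (trans (pair-at s v c d) (cong₂ (λ x y → (pair s v ℤ.+ c ℤ.* x) ℤ.+ d ℤ.* y) (diag s) (proj₂ a⁻))))
            (lem (v j) c d (pair s v) (+ a) (simple s j) (simple t j))
      where
      lem : ∀ v c d p a S T → ((v ℤ.+ c ℤ.* S) ℤ.+ d ℤ.* T) ℤ.- ((p ℤ.+ c ℤ.* (+ 2)) ℤ.+ d ℤ.* (- a)) ℤ.* S
            ≡ (v ℤ.+ (- c ℤ.+ a ℤ.* d ℤ.- p) ℤ.* S) ℤ.+ d ℤ.* T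
      lem = solve-∀
    at-step v false (c , d) j =
      trans (cong (λ z → at v (c , d) j ℤ.- z ℤ.* simple t j)
              (trans (pair-at t v c d) (cong₂ (λ x y → (pair t v ℤ.+ c ℤ.* x) ℤ.+ d ℤ.* y) (proj₂ b⁻) (diag t))))
            (lem (v j) c d (pair t v) (+ b) (simple s j) (simple t j))
      where
      lem : ∀ v c d q b S T → ((v ℤ.+ c ℤ.* S) ℤ.+ d ℤ.* T) ℤ.- ((q ℤ.+ c ℤ.* (- b)) ℤ.+ d ℤ.* (+ 2)) ℤ.* T
            ≡ (v ℤ.+ c ℤ.* S) ℤ.+ (- d ℤ.+ b ℤ.* c ℤ.- q) ℤ.* T
      lem = solve-∀

    at-run : ∀ v u cd → applyWord (word u) (at v cd) ≗ at v (run (pair s v) (pair t v) u cd)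
    at-run v []      cd j = refl
    at-run v (e ∷ u) cd j = trans (σ-cong (letter e) (at-run v u cd) j) (at-step v e _ j)

    at-0 : ∀ v → v ≗ at v (0ℤ , 0ℤ)
    at-0 v j = lem (v j) (simple s j) (simple t j)
      where
      lem : ∀ v S T → v ≡ (v ℤ.+ 0ℤ ℤ.* S) ℤ.+ 0ℤ ℤ.* T
      lem = solve-∀

    -- The displacement of `v` by a word in `s` and `t` depends on `v` only through its two
    -- pairings, and linearly; `lin` records the coefficients, which belong to the word alone.
    lin⇒≈ : ∀ u u' → lin u ≡ lin u' → word u ≈ word u'
    lin⇒≈ u u' eq = equiv λ v j → begin
      applyWord (word u) v j                                 ≡⟨ expand u v j ⟩
      at v (eval (pair s v) (pair t v) (lin u)) j
        ≡⟨ cong (λ l → at v (eval (pair s v) (pair t v) l) j) eq ⟩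
      at v (eval (pair s v) (pair t v) (lin u')) j           ≡⟨ sym (expand u' v j) ⟩
      applyWord (word u') v j ∎
      where
      open ≡-Reasoning
      expand : ∀ u v j → applyWord (word u) v j ≡ at v (eval (pair s v) (pair t v) (lin u)) j
      expand u v j = trans (word-cong (word u) (at-0 v) j)
        (trans (at-run v u _ j) (cong (λ cd → at v cd j) (run-lin (pair s v) (pair t v) u)))

    0v : Vec'
    0v _ = 0ℤ

    pair-0v : ∀ i → pair i 0v ≡ 0ℤ
    pair-0v i = trans (∑-cong vs (λ j → ℤₚ.*-zeroʳ (A i j))) (∑-0 vs)

    -- Reads `α_s` as the zero vector plus `1 α_s + 0 α_t`. The zero vector has zero pairings, which
    -- is why `Dihedral` runs with `p = q = 0` from `(1 , 0)`.
    simple-run : ∀ u → applyWord (word u) (simple s) ≗ at 0v (run 0ℤ 0ℤ u (1ℤ , 0ℤ))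
    simple-run u j = trans (word-cong (word u) (λ i → lem (simple s i) (simple t i)) j)
      (trans (at-run 0v u (1ℤ , 0ℤ) j) (cong₂ (λ p q → at 0v (run p q u (1ℤ , 0ℤ)) j) (pair-0v s) (pair-0v t)))
      where
      lem : ∀ S T → S ≡ (0ℤ ℤ.+ 1ℤ ℤ.* S) ℤ.+ 0ℤ ℤ.* T
      lem = solve-∀

    snoc-cancel : ∀ u → word (u ++ [ true ]) ++ [ s ] ≈ word u
    snoc-cancel u = equiv λ β j → trans (cong (λ z → applyWord z β j) eq)
      (trans (word-cancel (word u) s [] β j) (cong (λ z → applyWord z β j) (++-identityʳ (word u))))
      where
      eq : word (u ++ [ true ]) ++ [ s ] ≡ word u ++ s ∷ s ∷ []
      eq = trans (cong (_++ [ s ]) (map-++ letter u [ true ])) (++-assoc (word u) [ s ] [ s ])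

    DihedralDescent : List Bool → Set
    DihedralDescent u = (Σ (ℤ × ℤ) λ cd → NonNeg₂ cd × applyWord (word u) (simple s) ≗ at 0v cd) ⊎
      (Σ (List Bool) λ u' → length u' < length u × word u ++ [ s ] ≈ word u')

    -- A word ending in `s` cancels against the appended `s`. A word ending in `t` either has
    -- nonnegative coefficients or contains a braid at its inner end, and rewriting the braid makes
    -- it end in `s`.
    descent-alt : ∀ e n → DihedralDescent (alt e n)
    descent-alt e zero = inj₁ ((1ℤ , 0ℤ) , (ℤ.+≤+ z≤n , ℤ.+≤+ z≤n) , simple-run [])
    descent-alt true (suc n) = inj₂ (alt false n , subst (length (alt false n) <_) (sym (length-alt true (suc n)))
        (s≤s (ℕₚ.≤-reflexive (length-alt false n))) ,
      ≈-trans (≡⇒≈ (cong (λ u → word u ++ [ s ]) (alt-snoc true n))) (snoc-cancel (alt false n)))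
    descent-alt false (suc n)
      with Dihedral.coef (dihedral a b (zero-sym {s} {t} (proj₂ a⁻) (proj₂ b⁻)) (zero-sym {t} {s} (proj₂ b⁻) (proj₂ a⁻))) (suc n)
    ... | inj₁ nonneg = inj₁ (_ , nonneg , simple-run (alt false (suc n)))
    ... | inj₂ (m , r , n≡ , braid) with alt-split false r (suc m)
    ...   | u₀ , split , len = inj₂ (u₀ ++ alt false m , shorter , equal)
      where
      shorter : length (u₀ ++ alt false m) < length (alt false (suc n))
      shorter = ℕₚ.≤-reflexive (begin
        suc (length (u₀ ++ alt false m))        ≡⟨ cong suc (length-++ u₀) ⟩
        suc (length u₀ ℕ.+ length (alt false m)) ≡⟨ cong suc (cong₂ ℕ._+_ len (length-alt false m)) ⟩
        suc (r ℕ.+ m)                           ≡⟨ sym (ℕₚ.+-suc r m) ⟩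
        r ℕ.+ suc m                             ≡⟨ sym n≡ ⟩
        suc n                                   ≡⟨ sym (length-alt false (suc n)) ⟩
        length (alt false (suc n)) ∎)
        where open ≡-Reasoning
      rewritten : word (alt false (suc n)) ≈ word ((u₀ ++ alt false m) ++ [ true ])
      rewritten = ≈-trans (≡⇒≈ (trans (cong (λ k → word (alt false k)) n≡) (trans (cong word split) (map-++ letter u₀ _))))
        (≈-trans (++-≈ {word u₀} {word u₀} ≈-refl (lin⇒≈ (alt false (suc m)) (alt true (suc m)) braid))
                 (≡⇒≈ (trans (sym (map-++ letter u₀ _))
                   (cong word (trans (cong (u₀ ++_) (alt-snoc true m)) (sym (++-assoc u₀ (alt false m) [ true ])))))))
      equal : word (alt false (suc n)) ++ [ s ] ≈ word (u₀ ++ alt false m)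
      equal = ≈-trans (++-≈ {u = [ s ]} rewritten ≈-refl) (snoc-cancel (u₀ ++ alt false m))

    dihedral-descent : ∀ u → DihedralDescent u
    dihedral-descent u with alternating u
    ... | inj₁ (e , eq) = subst DihedralDescent (sym eq) (descent-alt e (length u))
    -- Deleting the pair `e e` saves two letters and the appended `s` costs one, so the result is
    -- still shorter by one.
    ... | inj₂ (u₁ , e , u₂ , refl) = inj₂ ((u₁ ++ u₂) ++ [ true ] , shorter , equal)
      where
      shorter : length ((u₁ ++ u₂) ++ [ true ]) < length (u₁ ++ e ∷ e ∷ u₂)
      shorter = ℕₚ.≤-reflexive (begin
        suc (length ((u₁ ++ u₂) ++ [ true ]))    ≡⟨ cong suc (length-snoc (u₁ ++ u₂) true) ⟩
        2 ℕ.+ length (u₁ ++ u₂)                  ≡⟨ cong (2 ℕ.+_) (length-++ u₁) ⟩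
        2 ℕ.+ (length u₁ ℕ.+ length u₂)          ≡⟨ cong suc (sym (ℕₚ.+-suc (length u₁) (length u₂))) ⟩
        suc (length u₁ ℕ.+ suc (length u₂))      ≡⟨ sym (ℕₚ.+-suc (length u₁) _) ⟩
        length u₁ ℕ.+ (2 ℕ.+ length u₂)          ≡⟨ sym (length-++ u₁) ⟩
        length (u₁ ++ e ∷ e ∷ u₂) ∎)
        where open ≡-Reasoning
      equal : word (u₁ ++ e ∷ e ∷ u₂) ++ [ s ] ≈ word ((u₁ ++ u₂) ++ [ true ])
      equal = equiv λ β j → begin
        applyWord (word (u₁ ++ e ∷ e ∷ u₂) ++ [ s ]) β j  ≡⟨ cong (λ f → f j) (word-++ (word (u₁ ++ e ∷ e ∷ u₂)) [ s ] β) ⟩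
        applyWord (word (u₁ ++ e ∷ e ∷ u₂)) (σ s β) j
          ≡⟨ cong (λ z → applyWord z (σ s β) j) (map-++ letter u₁ (e ∷ e ∷ u₂)) ⟩
        applyWord (word u₁ ++ letter e ∷ letter e ∷ word u₂) (σ s β) j ≡⟨ word-cancel (word u₁) (letter e) (word u₂) _ j ⟩
        applyWord (word u₁ ++ word u₂) (σ s β) j  ≡⟨ cong (λ z → applyWord z (σ s β) j) (sym (map-++ letter u₁ u₂)) ⟩
        applyWord (word (u₁ ++ u₂)) (σ s β) j     ≡⟨ cong (λ f → f j) (sym (word-++ (word (u₁ ++ u₂)) [ s ] β)) ⟩
        applyWord (word (u₁ ++ u₂) ++ [ s ]) β j  ≡⟨ cong (λ z → applyWord z β j) (sym (map-++ letter (u₁ ++ u₂) [ true ])) ⟩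
        applyWord (word ((u₁ ++ u₂) ++ [ true ])) β j ∎
        where open ≡-Reasoning

    -- Given w ≈ v u with u in the dihedral group of s and t, move letters from v to u until v
    -- sends both α_s and α_t to nonnegative vectors; then u decides.
    factor : ∀ N w → (∀ v i → length v ≤ N → Descent v i) →
      ∀ M v u → length v ≤ M → length v ≤ N → length v ℕ.+ length u ≤ length w → w ≈ v ++ word u → Descent w s
    absorb : ∀ N w → (∀ v i → length v ≤ N → Descent v i) →
      ∀ M v u → length v ≤ M → length v ≤ N → length v ℕ.+ length u ≤ length w → w ≈ v ++ word u →
      ∀ e v' → length v' < length v → v ++ [ letter e ] ≈ v' → Descent w s

    factor N w ih M v u v≤M v≤N len eq with ih v s v≤N
    ... | inj₂ (v' , short , eq') = absorb N w ih M v u v≤M v≤N len eq true v' short eq'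
    ... | inj₁ v-s with ih v t v≤N
    ...   | inj₂ (v' , short , eq') = absorb N w ih M v u v≤M v≤N len eq false v' short eq'
    ...   | inj₁ v-t with dihedral-descent u
    ...     | inj₂ (u' , short , eq') = inj₂ (v ++ word u' , shorter , equal)
      where
      shorter : length (v ++ word u') < length w
      shorter = begin-strict
        length (v ++ word u')          ≡⟨ length-++ v ⟩
        length v ℕ.+ length (word u')  ≡⟨ cong (length v ℕ.+_) (length-map letter u') ⟩
        length v ℕ.+ length u'         <⟨ ℕₚ.+-monoʳ-< (length v) short ⟩
        length v ℕ.+ length u          ≤⟨ len ⟩
        length w ∎
        where open ℕₚ.≤-Reasoning
      equal : w ++ [ s ] ≈ v ++ word u'
      equal = ≈-trans (++-≈ {u = [ s ]} eq ≈-refl)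
        (≈-trans (≡⇒≈ (++-assoc v (word u) [ s ])) (++-≈ {v} {v} ≈-refl eq'))
    ...     | inj₁ ((c , d) , (c≥0 , d≥0) , eq') = inj₁ nonneg
      where
      expand : ∀ j → applyWord w (simple s) j ≡
        (applyWord v 0v j ℤ.+ c ℤ.* applyWord v (simple s) j) ℤ.+ d ℤ.* applyWord v (simple t) j
      expand j = begin
        applyWord w (simple s) j                    ≡⟨ apply-≗ eq (simple s) j ⟩
        applyWord (v ++ word u) (simple s) j        ≡⟨ cong (λ f → f j) (word-++ v (word u) (simple s)) ⟩
        applyWord v (applyWord (word u) (simple s)) j ≡⟨ word-cong v eq' j ⟩
        applyWord v (at 0v (c , d)) j               ≡⟨ word-lin v (0v +[ c ] simple s) d (simple t) j ⟩
        applyWord v (0v +[ c ] simple s) j ℤ.+ d ℤ.* applyWord v (simple t) j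
          ≡⟨ cong (λ z → z ℤ.+ d ℤ.* applyWord v (simple t) j) (word-lin v 0v c (simple s) j) ⟩
        (applyWord v 0v j ℤ.+ c ℤ.* applyWord v (simple s) j) ℤ.+ d ℤ.* applyWord v (simple t) j ∎
        where open ≡-Reasoning
      word-0v : ∀ v j → applyWord v 0v j ≡ 0ℤ
      word-0v []      j = refl
      word-0v (i ∷ v) j = trans (σ-cong i (word-0v v) j) (cong (λ z → 0ℤ ℤ.- z ℤ.* simple i j) (pair-0v i))
      nonneg : NonNegVec (applyWord w (simple s))
      nonneg j = subst (0ℤ ℤ.≤_) (sym (expand j))
        (ℤₚ.+-mono-≤ (ℤₚ.+-mono-≤ (ℤₚ.≤-reflexive (sym (word-0v v j))) (pos-*-nonNeg c≥0 (v-s j)))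
                     (pos-*-nonNeg d≥0 (v-t j)))

    absorb N w ih zero    v u v≤M v≤N len eq e v' short eq' with ℕₚ.<-≤-trans short v≤M
    ... | ()
    -- `M` falls with the length of `v`. The bound on the total length survives, since `v` loses at
    -- least one letter while `u` gains exactly one.
    absorb N w ih (suc M) v u v≤M v≤N len eq e v' short eq' =
      factor N w ih M v' (e ∷ u) (ℕₚ.≤-pred (ℕₚ.<-≤-trans short v≤M)) (ℕₚ.≤-trans (ℕₚ.<⇒≤ short) v≤N)
        (ℕₚ.≤-trans (ℕₚ.≤-reflexive (ℕₚ.+-suc (length v') (length u))) (ℕₚ.≤-trans (ℕₚ.+-monoˡ-≤ (length u) short) len))
        (≈-trans eq (≈-trans insert (++-≈ {u = letter e ∷ word u} eq' ≈-refl)))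
      where
      -- A letter written twice: one copy is swallowed by `v'`, the other becomes the head of the
      -- new dihedral word.
      insert : v ++ word u ≈ (v ++ [ letter e ]) ++ letter e ∷ word u
      insert = equiv λ β j → sym (trans (cong (λ z → applyWord z β j) (++-assoc v [ letter e ] (letter e ∷ word u)))
                              (word-cancel v (letter e) (word u) β j))

  descent≤ : ∀ N w s → length w ≤ N → Descent w s
  descent≤ N [] s _ = inj₁ (simple-nonNeg s)
  descent≤ (suc N) (x ∷ w) s len with snoc-view x w
  ... | v , t , eq with s ≟V t
  ...   | yes refl = inj₂ (v , shorter , equal)
    where
    shorter : length v < length (x ∷ w)
    shorter = ℕₚ.≤-reflexive (trans (sym (length-snoc v t)) (cong length (sym eq)))
    equal : (x ∷ w) ++ [ s ] ≈ v
    equal = equiv λ β j → trans (cong (λ z → applyWord z β j) (trans (cong (_++ [ s ]) eq) (++-assoc v [ s ] [ s ])))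
      (trans (word-cancel v s [] β j) (cong (λ f → f j) (word-++ v [] β)))
  -- The last letter `t`, coded `false`, starts the dihedral part; this makes `v` strictly shorter
  -- than the whole word, so the induction on `N` covers it.
  ...   | no s≢t = Rank2Words.factor s t s≢t N (x ∷ w) (descent≤ N) (length v) v (false ∷ []) ℕₚ.≤-refl v≤N
                     (ℕₚ.≤-reflexive (trans (ℕₚ.+-comm (length v) 1) (sym len-v))) (≡⇒≈ eq)
    where
    len-v : length (x ∷ w) ≡ suc (length v)
    len-v = trans (cong length eq) (length-snoc v t)
    v≤N : length v ≤ N
    v≤N = ℕₚ.≤-pred (subst (_≤ suc N) len-v len)

  descent : ∀ w s → Descent w s
  descent w s = descent≤ (length w) w s ℕₚ.≤-refl


  -- Signs of roots.

  NonPosVec : Vec' → Set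
  NonPosVec β = ∀ j → β j ℤ.≤ 0ℤ

  word-scale : ∀ w c β → applyWord w (λ j → c ℤ.* β j) ≗ (λ j → c ℤ.* applyWord w β j)
  word-scale w c β j = trans (word-cong w (λ i → sym (lem c (β i))) j)
    (trans (word-lin w β (c ℤ.- 1ℤ) β j) (lem c (applyWord w β j)))
    where
    lem : ∀ c b → b ℤ.+ (c ℤ.- 1ℤ) ℤ.* b ≡ c ℤ.* b
    lem = solve-∀

  σ-simple : ∀ s → σ s (simple s) ≗ (λ j → ℤ.-1ℤ ℤ.* simple s j)
  σ-simple s j = trans (cong (λ z → simple s j ℤ.- z ℤ.* simple s j) (trans (pair-simple s s) (diag s)))
    (lem (simple s j))
    where
    lem : ∀ S → S ℤ.- (+ 2) ℤ.* S ≡ ℤ.-1ℤ ℤ.* S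
    lem = solve-∀

  -1*-antitone⁻ : ∀ {i} → 0ℤ ℤ.≤ i → ℤ.-1ℤ ℤ.* i ℤ.≤ 0ℤ
  -1*-antitone⁻ {i} p = subst (ℤ._≤ 0ℤ) (sym (ℤₚ.-1*i≡-i i)) (ℤₚ.neg-mono-≤ p)

  -1*-antitone⁺ : ∀ {i} → i ℤ.≤ 0ℤ → 0ℤ ℤ.≤ ℤ.-1ℤ ℤ.* i
  -1*-antitone⁺ {i} p = subst (0ℤ ℤ.≤_) (sym (ℤₚ.-1*i≡-i i)) (ℤₚ.neg-mono-≤ p)

  -- If `w s` equals a shorter word `w'`, then `w α_s = - w s α_s = - w' α_s`, because `s` negates
  -- `α_s`; the sign of the shorter word is flipped.
  sign≤ : ∀ N w s → length w ≤ N → NonNegVec (applyWord w (simple s)) ⊎ NonPosVec (applyWord w (simple s))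
  sign≤ N w s len with descent w s
  ... | inj₁ nonneg = inj₁ nonneg
  sign≤ zero w s len | inj₂ (w' , short , eq) with ℕₚ.<-≤-trans short len
  ... | ()
  sign≤ (suc N) w s len | inj₂ (w' , short , eq) = flip (sign≤ N w' s (ℕₚ.≤-pred (ℕₚ.<-≤-trans short len)))
    where
    negated : ∀ j → applyWord w (simple s) j ≡ ℤ.-1ℤ ℤ.* applyWord w' (simple s) j
    negated j = begin
      applyWord w (simple s) j                        ≡⟨ word-cong w (λ i → sym (σ-involutive s (simple s) i)) j ⟩
      applyWord w (σ s (σ s (simple s))) j            ≡⟨ cong (λ f → f j) (sym (word-++ w [ s ] _)) ⟩
      applyWord (w ++ [ s ]) (σ s (simple s)) j       ≡⟨ apply-≗ eq _ j ⟩
      applyWord w' (σ s (simple s)) j                 ≡⟨ word-cong w' (σ-simple s) j ⟩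
      applyWord w' (λ i → ℤ.-1ℤ ℤ.* simple s i) j     ≡⟨ word-scale w' ℤ.-1ℤ (simple s) j ⟩
      ℤ.-1ℤ ℤ.* applyWord w' (simple s) j ∎
      where open ≡-Reasoning
    flip : NonNegVec (applyWord w' (simple s)) ⊎ NonPosVec (applyWord w' (simple s)) →
           NonNegVec (applyWord w (simple s)) ⊎ NonPosVec (applyWord w (simple s))
    flip (inj₁ p) = inj₂ (λ j → subst (ℤ._≤ 0ℤ) (sym (negated j)) (-1*-antitone⁻ (p j)))
    flip (inj₂ p) = inj₁ (λ j → subst (0ℤ ℤ.≤_) (sym (negated j)) (-1*-antitone⁺ (p j)))

  Reach-resp : ∀ {ℓ β γ} → β ≗ γ → Reach ℓ β → Reach ℓ γ
  Reach-resp e (y , w , len , eq) = y , w , len , λ j → trans (eq j) (e j)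

  Reach-σ : ∀ {ℓ β} i → Reach ℓ β → Reach (suc ℓ) (σ i β)
  Reach-σ i (y , w , len , eq) = y , i ∷ w , cong suc len , σ-cong i eq

  IsRoot-word : ∀ w {β} → IsRoot β → IsRoot (applyWord w β)
  IsRoot-word []      r = r
  IsRoot-word (i ∷ w) r with IsRoot-word w r
  ... | ℓ , reach = suc ℓ , Reach-σ i reach

  IsRoot-resp : ∀ {β γ} → β ≗ γ → IsRoot β → IsRoot γ
  IsRoot-resp e (ℓ , r) = ℓ , Reach-resp e r

  root-sign : ∀ {β} → IsRoot β → NonNegVec β ⊎ NonPosVec β
  root-sign (ℓ , y , w , len , eq) with sign≤ (length w) w y ℕₚ.≤-refl
  ... | inj₁ p = inj₁ (λ j → subst (0ℤ ℤ.≤_) (eq j) (p j))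
  ... | inj₂ p = inj₂ (λ j → subst (ℤ._≤ 0ℤ) (eq j) (p j))

  -- A root c α_y is w α_z for some w, so c divides the entry 1 of α_z = w⁻¹ (c α_y).
  root-multiple : ∀ {β} y → IsRoot β → NonNegVec β → (∀ j → y ≢ j → β j ≡ 0ℤ) → β ≗ simple y
  root-multiple {β} y (ℓ , z , w , len , eq) nonneg support j =
    trans (multiple j) (trans (cong (ℤ._* simple y j) unit) (ℤₚ.*-identityˡ (simple y j)))
    where
    multiple : β ≗ (λ j → β y ℤ.* simple y j)
    multiple j with y ≟V j
    ... | yes refl = sym (ℤₚ.*-identityʳ (β y))
    ... | no y≢j   = trans (support j y≢j) (sym (ℤₚ.*-zeroʳ (β y)))
    unit : β y ≡ 1ℤ
    unit = nonNeg-unit (β y) (applyWord (reverse w) (simple y) z) (nonneg y) (begin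
      β y ℤ.* applyWord (reverse w) (simple y) z     ≡⟨ sym (word-scale (reverse w) (β y) (simple y) z) ⟩
      applyWord (reverse w) (λ j → β y ℤ.* simple y j) z ≡⟨ word-cong (reverse w) (λ i → sym (multiple i)) z ⟩
      applyWord (reverse w) β z                      ≡⟨ word-cong (reverse w) (λ i → sym (eq i)) z ⟩
      applyWord (reverse w) (applyWord w (simple z)) z ≡⟨ reverse-inverseˡ w (simple z) z ⟩
      simple z z                                     ≡⟨ simple-self z ⟩
      1ℤ ∎)
      where open ≡-Reasoning

  -- The zero vector is supported at every single vertex, so as a root it would be the simple root
  -- there.
  root-nonzero : ∀ {β} → IsRoot β → NonNegVec β → NonPosVec β → ⊥
  root-nonzero {β} root@(ℓ , z , w , len , eq) p q = 0≢1 (trans (sym β≡0) (trans (β≡z z) (simple-self z)))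
    where
    β≡z : β ≗ simple z
    β≡z = root-multiple z root p (λ j _ → ℤₚ.≤-antisym (q j) (p j))
    β≡0 : β z ≡ 0ℤ
    β≡0 = ℤₚ.≤-antisym (q z) (p z)
    0≢1 : 0ℤ ≢ 1ℤ
    0≢1 ()

  -- Some letter `i` of `u` turns a nonnegative vector into a nonpositive one. It changes only the
  -- coordinate at `i`, so the vector before it is supported at `i` and equals `α_i`. Undoing the
  -- letters that acted earlier writes `δ` with fewer letters than `u` has.
  made-negative : ∀ u {δ} → IsRoot δ → NonNegVec δ → NonPosVec (applyWord u δ) →
                  Σ ℕ λ ℓ → ℓ < length u × Reach ℓ δ
  made-negative [] root p q = ⊥-elim (root-nonzero root p q)
  made-negative (i ∷ u) {δ} root p q with root-sign (IsRoot-word u root)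
  ... | inj₂ q' with made-negative u root p q'
  ...   | ℓ , ℓ< , r = ℓ , ℕₚ.m≤n⇒m≤1+n ℓ< , r
  made-negative (i ∷ u) {δ} root p q | inj₁ p' =
    length u , ℕₚ.≤-refl , i , reverse u , length-reverse u ,
    λ j → trans (word-cong (reverse u) (λ k → sym (is-simple k)) j) (reverse-inverseˡ u δ j)
    where
    is-simple : applyWord u δ ≗ simple i
    is-simple = root-multiple i (IsRoot-word u root) p'
      (λ j i≢j → ℤₚ.≤-antisym (subst (ℤ._≤ 0ℤ) (σ-other i (applyWord u δ) i≢j) (q j)) (p' j))

  word-injective : ∀ w {β γ} → applyWord w β ≗ applyWord w γ → β ≗ γ
  word-injective w {β} {γ} e j = trans (sym (reverse-inverseˡ w β j))
    (trans (word-cong (reverse w) e j) (reverse-inverseˡ w γ j))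

  -- Let u = w⁻¹, so u β = α_y.  Either u s has a shorter expression, or u α_s ≥ 0; then the root
  -- u (σ s β) = α_y − c (u α_s) is not nonnegative, so u passes from σ s β through a simple root.
  reflected-reach : ∀ s β k → Reach k β → NonNegVec β → 0ℤ ℤ.< pair s β → NonNegVec (σ s β) →
                    Σ ℕ λ ℓ → ℓ < k × Reach ℓ (σ s β)
  reflected-reach s β k (y , w , refl , eq) p c>0 p' with descent (reverse w) s
  ... | inj₂ (u' , short , eq') = length u' , subst (length u' <_) (length-reverse w) short ,
      y , reverse u' , length-reverse u' ,
      λ j → trans (word-cong (reverse u') (λ i → sym (image i)) j) (reverse-inverseˡ u' (σ s β) j)
    where
    image : applyWord u' (σ s β) ≗ simple y
    image i = begin
      applyWord u' (σ s β) i                     ≡⟨ sym (apply-≗ eq' (σ s β) i) ⟩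
      applyWord (reverse w ++ [ s ]) (σ s β) i   ≡⟨ cong (λ f → f i) (word-++ (reverse w) [ s ] (σ s β)) ⟩
      applyWord (reverse w) (σ s (σ s β)) i      ≡⟨ word-cong (reverse w) (σ-involutive s β) i ⟩
      applyWord (reverse w) β i                  ≡⟨ word-cong (reverse w) (λ k → sym (eq k)) i ⟩
      applyWord (reverse w) (applyWord w (simple y)) i ≡⟨ reverse-inverseˡ w (simple y) i ⟩
      simple y i ∎
      where open ≡-Reasoning
  ... | inj₁ nonneg with root-sign (IsRoot-word (reverse w ++ [ s ]) (k , y , w , refl , eq))
  ...   | inj₂ neg with made-negative (reverse w) (suc k , Reach-σ s (y , w , refl , eq)) p'
                          (λ j → subst (ℤ._≤ 0ℤ) (cong (λ f → f j) (word-++ (reverse w) [ s ] β)) (neg j))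
  ...     | ℓ , ℓ< , r = ℓ , subst (ℓ <_) (length-reverse w) ℓ< , r
  -- Suppose `α_y − c (u α_s)` were nonnegative. As `c > 0` and `u α_s ≥ 0`, the root `u α_s`
  -- vanishes off `y`, so it is `α_y = u β`. Then `β = α_s`, whose reflection is negative at `s`.
  reflected-reach s β k (y , w , refl , eq) p c>0 p' | inj₁ nonneg | inj₁ pos = ⊥-elim (contra (p' s))
    where
    u = reverse w
    c = pair s β
    back : applyWord u β ≗ simple y
    back i = trans (word-cong u (λ k → sym (eq k)) i) (reverse-inverseˡ w (simple y) i)
    image : ∀ j → applyWord (u ++ [ s ]) β j ≡ simple y j ℤ.+ (- c) ℤ.* applyWord u (simple s) j
    image j = begin
      applyWord (u ++ [ s ]) β j                          ≡⟨ cong (λ f → f j) (word-++ u [ s ] β) ⟩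
      applyWord u (σ s β) j                               ≡⟨ word-cong u (σ-+[] s β) j ⟩
      applyWord u (β +[ - c ] simple s) j                 ≡⟨ word-lin u β (- c) (simple s) j ⟩
      applyWord u β j ℤ.+ (- c) ℤ.* applyWord u (simple s) j
        ≡⟨ cong (λ z → z ℤ.+ (- c) ℤ.* applyWord u (simple s) j) (back j) ⟩
      simple y j ℤ.+ (- c) ℤ.* applyWord u (simple s) j ∎
      where open ≡-Reasoning
    vanish : ∀ c z → 0ℤ ℤ.< c → 0ℤ ℤ.≤ z → 0ℤ ℤ.≤ 0ℤ ℤ.+ (- c) ℤ.* z → z ≡ 0ℤ
    vanish (+ suc m) (+ zero) (ℤ.+<+ _) _ _ = refl
    vanish (+ suc m) (+ suc n) (ℤ.+<+ _) _ ()
    support : ∀ j → y ≢ j → applyWord u (simple s) j ≡ 0ℤ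
    support j y≢j = vanish c _ c>0 (nonneg j)
      (subst (0ℤ ℤ.≤_) (trans (image j) (cong (λ z → z ℤ.+ (- c) ℤ.* applyWord u (simple s) j) (simple-other y≢j))) (pos j))
    s-to-y : applyWord u (simple s) ≗ simple y
    s-to-y = root-multiple y (IsRoot-word u (0 , s , [] , refl , λ j → refl)) nonneg support
    β≗s : β ≗ simple s
    β≗s = word-injective u (λ j → trans (back j) (sym (s-to-y j)))
    contra : 0ℤ ℤ.≤ σ s β s → ⊥
    contra q with subst (0ℤ ℤ.≤_) (trans (σ-cong s β≗s s) (trans (σ-simple s s) (cong (ℤ.-1ℤ ℤ.*_) (simple-self s)))) q
    ... | ()

  -- Decidable reach, and depth along a reflection.

  ≗-dec : (β γ : Vec') → Dec (β ≗ γ)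
  ≗-dec β γ = Dec.map′ (λ all j → All.lookup all (complete j)) (λ e → All.tabulate (λ {j} _ → e j))
                       (all? (λ j → β j ℤ.≟ γ j) vs)

  V-any? : {P : V → Set} → (∀ v → Dec (P v)) → Dec (Σ V P)
  V-any? P? = Dec.map′ satisfied (λ (v , p) → lose (complete v) p) (any? P? vs)

  -- There are finitely many words of each length, so the search terminates. Decidability is what
  -- yields a least length, hence a depth, for every positive root.
  Reach? : ∀ ℓ β → Dec (Reach ℓ β)
  Reach? zero β = Dec.map′ (λ (y , e) → y , [] , refl , e) from (V-any? (λ y → ≗-dec (simple y) β))
    where
    from : Reach 0 β → Σ V λ y → simple y ≗ β
    from (y , [] , _ , e) = y , e
  Reach? (suc ℓ) β = Dec.map′ to from (V-any? (λ i → Reach? ℓ (σ i β)))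
    where
    to : (Σ V λ i → Reach ℓ (σ i β)) → Reach (suc ℓ) β
    to (i , r) = Reach-resp (σ-involutive i β) (Reach-σ i r)
    from : Reach (suc ℓ) β → Σ V λ i → Reach ℓ (σ i β)
    from (y , i ∷ w , refl , e) = i , y , w , refl ,
      λ j → trans (sym (σ-involutive i (applyWord w (simple y)) j)) (σ-cong i e j)

  IsPosRoot-resp : ∀ {β γ} → β ≗ γ → IsPosRoot β → IsPosRoot γ
  IsPosRoot-resp e (r , p) = IsRoot-resp e r , λ j → subst (0ℤ ℤ.≤_) (e j) (p j)

  HasDepth-resp : ∀ {β γ d} → β ≗ γ → HasDepth β d → HasDepth γ d
  HasDepth-resp e (r , ℓ , d≡ , reach , min) = IsPosRoot-resp e r , ℓ , d≡ , Reach-resp e reach ,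
    λ ℓ' r' → min ℓ' (Reach-resp (λ j → sym (e j)) r')

  ≤R-trans : ∀ {β γ δ} → β ≤R γ → γ ≤R δ → β ≤R δ
  ≤R-trans (≤R-refl e) (≤R-refl e') = ≤R-refl (λ j → trans (e j) (e' j))
  ≤R-trans (≤R-step i d p h h' e) (≤R-refl e') = ≤R-step i d p h h' (λ j → trans (e j) (e' j))
  ≤R-trans p (≤R-step i d q h h' e) = ≤R-step i d (≤R-trans p q) h h' e

  σ-lower : ∀ s β → σ s β s ℤ.< β s → 0ℤ ℤ.< pair s β
  σ-lower s β lower = subst (0ℤ ℤ.<_) (trans (cong (λ z → β s ℤ.- z) (σ-self s β)) (lem (β s) (pair s β)))
                         (subst (ℤ._< β s ℤ.- σ s β s) (ℤₚ.+-inverseʳ (σ s β s)) (ℤₚ.+-monoˡ-< (- (σ s β s)) lower))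
    where
    lem : ∀ b p → b ℤ.- (b ℤ.- p) ≡ p
    lem = solve-∀

  -- The depth changes by exactly one: `reflected-reach` makes it drop, and reflecting back with one
  -- more letter shows that it drops by no more than one.
  lower⇒≤R : ∀ s {β} → IsPosRoot β → σ s β s ℤ.< β s → NonNegVec (σ s β) → IsPosRoot (σ s β) × σ s β ≤R β
  lower⇒≤R s {β} r@((k , reach) , p) lower p' =
    r' , ≤R-step s (suc ℓ') (≤R-refl (λ j → refl)) (r' , ℓ' , refl , reach' , min')
           (HasDepth-resp (λ j → sym (σ-involutive s β j)) (r , ℓ , d≡ , reach₀ , min)) (σ-involutive s β)
    where
    r' : IsPosRoot (σ s β)
    r' = (suc k , Reach-σ s reach) , p'
    least-β = least (λ ℓ → Reach? ℓ β) k reach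
    ℓ = proj₁ least-β
    reach₀ = proj₁ (proj₂ least-β)
    min = proj₂ (proj₂ least-β)
    shorter = reflected-reach s β ℓ reach₀ p (σ-lower s β lower) p'
    least-σ = least (λ ℓ → Reach? ℓ (σ s β)) (proj₁ shorter) (proj₂ (proj₂ shorter))
    ℓ' = proj₁ least-σ
    reach' = proj₁ (proj₂ least-σ)
    min' = proj₂ (proj₂ least-σ)
    d≡ : suc (suc ℓ') ≡ suc ℓ
    d≡ = cong suc (ℕₚ.≤-antisym
      (ℕₚ.≤-<-trans (min' (proj₁ shorter) (proj₂ (proj₂ shorter))) (proj₁ (proj₂ shorter)))
      (min (suc ℓ') (Reach-resp (σ-involutive s β) (Reach-σ s reach'))))

  -- The sign of the pairing decides. Pairing zero fixes the vector and so its depth; a positive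
  -- pairing would lower the depth by `reflected-reach`; only a negative one is left, and it raises
  -- the coordinate.
  depth-lower : ∀ i {γ d} → HasDepth γ d → HasDepth (σ i γ) (suc d) → γ i ℤ.< σ i γ i
  depth-lower i {γ} ((_ , p) , ℓ , refl , reach , min) ((_ , p') , ℓ' , refl , reach' , min')
    with ℤₚ.<-cmp (pair i γ) 0ℤ
  ... | tri< neg _ _ = subst₂ ℤ._<_ (ℤₚ.+-identityʳ (γ i)) (sym (σ-self i γ))
                         (ℤₚ.+-monoʳ-< (γ i) (ℤₚ.neg-mono-< neg))
  ... | tri≈ _ pair≡0 _ = ⊥-elim (ℕₚ.1+n≰n (min' ℓ (Reach-resp (λ j → sym (fixed j)) reach)))
    where
    fixed : σ i γ ≗ γ
    fixed j = trans (cong (λ z → γ j ℤ.- z ℤ.* simple i j) pair≡0) (ℤₚ.+-identityʳ (γ j))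
  ... | tri> _ _ pos with reflected-reach i γ ℓ reach p pos p'
  ...   | ℓ'' , ℓ''<ℓ , r = ⊥-elim (ℕₚ.<-asym ℓ''<ℓ (min' ℓ'' r))

-- Kronecker deltas and Boolean comparisons.

δ : ℕ → ℕ → ℤ
δ c b = if c ≡ᵇ b then 1ℤ else 0ℤ

≡ᵇ-refl : ∀ n → (n ≡ᵇ n) ≡ true
≡ᵇ-refl zero    = refl
≡ᵇ-refl (suc n) = ≡ᵇ-refl n

≡ᵇ-false : ∀ {m n} → m ≢ n → (m ≡ᵇ n) ≡ false
≡ᵇ-false {zero}  {zero}  m≢n = ⊥-elim (m≢n refl)
≡ᵇ-false {zero}  {suc n} _   = refl
≡ᵇ-false {suc m} {zero}  _   = refl
≡ᵇ-false {suc m} {suc n} m≢n = ≡ᵇ-false (λ e → m≢n (cong suc e))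

≡ᵇ-sym : ∀ m n → (m ≡ᵇ n) ≡ (n ≡ᵇ m)
≡ᵇ-sym zero    zero    = refl
≡ᵇ-sym zero    (suc n) = refl
≡ᵇ-sym (suc m) zero    = refl
≡ᵇ-sym (suc m) (suc n) = ≡ᵇ-sym m n

<ᵇ-true : ∀ {i t} → i < t → (i <ᵇ t) ≡ true
<ᵇ-true {zero}  {suc t} _         = refl
<ᵇ-true {suc i} {suc t} (s≤s i<t) = <ᵇ-true i<t

<ᵇ-false : ∀ {i t} → t ≤ i → (i <ᵇ t) ≡ false
<ᵇ-false {i}     {zero}  _         = refl
<ᵇ-false {suc i} {suc t} (s≤s t≤i) = <ᵇ-false t≤i

-- Index maps between paths

-- Intervals by start and length, so that `take` and `drop` follow the recursion; the accumulating
-- function of `applyUpTo` hides this structure.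
range : ℕ → ℕ → List ℕ
range a zero    = []
range a (suc l) = a ∷ range (suc a) l

applyUpTo-range : ∀ (f : ℕ → ℕ) a l → (∀ i → f i ≡ a ℕ.+ i) → applyUpTo f l ≡ range a l
applyUpTo-range f a zero    e = refl
applyUpTo-range f a (suc l) e = cong₂ _∷_ (trans (e 0) (ℕₚ.+-identityʳ a))
  (applyUpTo-range (λ i → f (suc i)) (suc a) l (λ i → trans (e (suc i)) (ℕₚ.+-suc a i)))

upTo-range : ∀ l → upTo l ≡ range 0 l
upTo-range l = applyUpTo-range (λ i → i) 0 l (λ _ → refl)

take-range : ∀ a p l → take p (range a (p ℕ.+ l)) ≡ range a p
take-range a zero    l = refl
take-range a (suc p) l = cong (a ∷_) (take-range (suc a) p l)

drop-range : ∀ a p l → drop p (range a (p ℕ.+ l)) ≡ range (p ℕ.+ a) l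
drop-range a zero    l = refl
drop-range a (suc p) l = trans (drop-range (suc a) p l) (cong (λ b → range b l) (ℕₚ.+-suc p a))

length-range : ∀ a l → length (range a l) ≡ l
length-range a zero    = refl
length-range a (suc l) = cong suc (length-range (suc a) l)

map-range-cong : ∀ {X : Set} {f g : ℕ → X} a l → (∀ i → a ≤ i → i < a ℕ.+ l → f i ≡ g i) →
                 map f (range a l) ≡ map g (range a l)
map-range-cong a zero    e = refl
map-range-cong a (suc l) e = cong₂ _∷_ (e a ℕₚ.≤-refl (ℕₚ.m<m+n a (s≤s z≤n)))
  (map-range-cong (suc a) l (λ i a<i i< → e i (ℕₚ.<⇒≤ a<i) (subst (i <_) (sym (ℕₚ.+-suc a l)) i<)))

nth : {X : Set} → X → List X → ℕ → X
nth d []       i       = d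
nth d (y ∷ ys) zero    = y
nth d (y ∷ ys) (suc i) = nth d ys i

nth-map : ∀ {X Y : Set} (f : X → Y) d d' xs i → i < length xs → nth d' (map f xs) i ≡ f (nth d xs i)
nth-map f d d' (y ∷ ys) zero    _        = refl
nth-map f d d' (y ∷ ys) (suc i) (s≤s i<) = nth-map f d d' ys i i<

nth-range : ∀ a l i → i < l → nth 0 (range a l) i ≡ a ℕ.+ i
nth-range a (suc l) zero    _        = sym (ℕₚ.+-identityʳ a)
nth-range a (suc l) (suc i) (s≤s i<) = trans (nth-range (suc a) l i i<) (sym (ℕₚ.+-suc a i))

runs : {X : Set} → List ℕ → List X → List X
runs cs xs = concat (zipWith replicate cs xs)

map-runs : ∀ {X Y : Set} (f : X → Y) cs xs → map f (runs cs xs) ≡ runs cs (map f xs)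
map-runs f []       xs       = refl
map-runs f (c ∷ cs) []       = refl
map-runs f (c ∷ cs) (y ∷ ys) = trans (map-++ f (replicate c y) (runs cs ys)) (cong₂ _++_ (map-replicate f c y) (map-runs f cs ys))

-- The list form of an index map, ascending from the third to the fourth argument and pausing only
-- between `p` and `q`. It mediates between the run lengths of `InClass` and index maps as
-- functions.
data Walk (p q : ℕ) : ℕ → ℕ → List ℕ → Set where
  stop : ∀ {a} → Walk p q a a (a ∷ [])
  advance : ∀ {a z xs} → Walk p q (suc a) z xs → Walk p q a z (a ∷ xs)
  stay : ∀ {a z xs} → p ≤ a → a ≤ q → Walk p q a z xs → Walk p q a z (a ∷ xs)

StepRel : ℕ → ℕ → ℕ → ℕ → Set
StepRel p q a a' = (a' ≡ suc a) ⊎ ((a' ≡ a) × p ≤ a × a ≤ q)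

-- φ is the index map of an element: position i on the long path carries the value b (x_{φ i}).
record Fold (p q m n : ℕ) (φ : ℕ → ℕ) : Set where
  field
    starts : φ 0 ≡ 0
    ends   : φ n ≡ m
    steps  : ∀ i → i < n → StepRel p q (φ i) (φ (suc i))
open Fold

module _ {p q : ℕ} where

  walk-resp : ∀ {a a' z z' xs} → a ≡ a' → z ≡ z' → Walk p q a z xs → Walk p q a' z' xs
  walk-resp refl refl w = w

  walk-range : ∀ a t → Walk p q a (a ℕ.+ t) (a ∷ range (suc a) t)
  walk-range a zero    = walk-resp refl (sym (ℕₚ.+-identityʳ a)) stop
  walk-range a (suc t) = advance (walk-resp refl (sym (ℕₚ.+-suc a t)) (walk-range (suc a) t))

  walk-replicate : ∀ c {a z ys} → p ≤ a → a ≤ q → Walk p q a z (a ∷ ys) → Walk p q a z (replicate (suc c) a ++ ys)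
  walk-replicate zero    p≤a a≤q w = w
  walk-replicate (suc c) p≤a a≤q w = stay p≤a a≤q (walk-replicate c p≤a a≤q w)

  walk-runs : ∀ cs a r t → All (1 ≤_) cs → length cs ≡ suc r → p ≤ a → a ℕ.+ r ≡ q →
    Walk p q a (q ℕ.+ t) (runs cs (range a (suc r)) ++ range (suc q) t)
  walk-runs (suc c ∷ []) a zero t (s≤s _ ∷ []) refl p≤a eq with trans (sym (ℕₚ.+-identityʳ a)) eq
  ... | refl = subst (Walk p q a (a ℕ.+ t)) (sym (++-assoc (replicate (suc c) a) [] _))
      (walk-replicate c p≤a ℕₚ.≤-refl (walk-range a t))
  walk-runs (suc c ∷ d ∷ cs) a (suc r) t (s≤s _ ∷ ps) len p≤a eq =
    subst (Walk p q a (q ℕ.+ t)) (sym (++-assoc (replicate (suc c) a) _ _))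
      (walk-replicate c p≤a (subst (a ≤_) eq (ℕₚ.m≤m+n a (suc r)))
        (advance (walk-runs (d ∷ cs) (suc a) r t ps (ℕₚ.suc-injective len) (ℕₚ.m≤n⇒m≤1+n p≤a) (trans (sym (ℕₚ.+-suc a r)) eq))))

  walk-prefix : ∀ l a {z xs} → Walk p q (l ℕ.+ a) z xs → Walk p q a z (range a l ++ xs)
  walk-prefix zero    a w = w
  walk-prefix (suc l) a w = advance (walk-prefix l (suc a) (walk-resp (sym (ℕₚ.+-suc l a)) refl w))

  walk-suffix : ∀ {a z xs} → Walk p q a z xs → q < a → Σ ℕ λ t → z ≡ a ℕ.+ t × xs ≡ a ∷ range (suc a) t
  walk-suffix {a} stop _ = 0 , sym (ℕₚ.+-identityʳ a) , refl
  walk-suffix {a} (advance w) q<a with walk-suffix w (ℕₚ.m≤n⇒m≤1+n q<a)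
  ... | t , z≡ , refl = suc t , trans z≡ (sym (ℕₚ.+-suc a t)) , refl
  walk-suffix (stay _ a≤q _) q<a = ⊥-elim (ℕₚ.<⇒≱ q<a a≤q)

  -- The first run has the form `suc c`, so that a `stay` step can lengthen it, while an `advance`
  -- step puts a run of length one in front.
  walk-split-runs : ∀ {a z xs} r → Walk p q a z xs → a ℕ.+ r ≡ q → q ≤ z →
    Σ ℕ λ c → Σ (List ℕ) λ cs → All (1 ≤_) cs × length cs ≡ r × (Σ ℕ λ t → z ≡ q ℕ.+ t ×
      xs ≡ runs (suc c ∷ cs) (range a (suc r)) ++ range (suc q) t)
  walk-split-runs {a} zero stop refl q≤z = 0 , [] , [] , refl , 0 ,
    trans (sym (ℕₚ.+-identityʳ a)) (sym (ℕₚ.+-identityʳ (a ℕ.+ 0))) , refl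
  walk-split-runs {a} (suc r) stop refl q≤z = ⊥-elim (ℕₚ.<⇒≱ (ℕₚ.m<m+n a (s≤s z≤n)) q≤z)
  walk-split-runs {a} zero (advance w) eq q≤z with trans (sym (ℕₚ.+-identityʳ a)) eq
  ... | refl with walk-suffix w ℕₚ.≤-refl
  ...   | t , z≡ , refl = 0 , [] , [] , refl , suc t , trans z≡ (sym (ℕₚ.+-suc a t)) , refl
  walk-split-runs {a} (suc r) (advance w) eq q≤z with walk-split-runs r w (trans (sym (ℕₚ.+-suc a r)) eq) q≤z
  ... | c , cs , ps , len , t , z≡ , refl = 0 , suc c ∷ cs , s≤s z≤n ∷ ps , cong suc len , t , z≡ , refl
  walk-split-runs r (stay _ _ w) eq q≤z with walk-split-runs r w eq q≤z
  ... | c , cs , ps , len , t , z≡ , refl = suc c , cs , ps , len , t , z≡ , refl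

  walk-split : ∀ {a z xs} l r → Walk p q a z xs → l ℕ.+ a ≡ p → p ℕ.+ r ≡ q → q ≤ z →
    Σ (List ℕ) λ cs → All (1 ≤_) cs × length cs ≡ suc r × (Σ ℕ λ t → z ≡ q ℕ.+ t ×
      xs ≡ range a l ++ runs cs (range p (suc r)) ++ range (suc q) t)
  walk-split zero r w refl eq q≤z with walk-split-runs r w eq q≤z
  ... | c , cs , ps , len , rest = suc c ∷ cs , s≤s z≤n ∷ ps , cong suc len , rest
  walk-split {a} (suc l) r stop refl refl q≤z = ⊥-elim (ℕₚ.<⇒≱ (s≤s (ℕₚ.m≤n+m a l)) (ℕₚ.≤-trans (ℕₚ.m≤m+n _ r) q≤z))
  walk-split {a} (suc l) r (advance w) e eq q≤z with walk-split l r w (trans (ℕₚ.+-suc l a) e) eq q≤z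
  ... | cs , ps , len , t , z≡ , refl = cs , ps , len , t , z≡ , refl
  walk-split {a} (suc l) r (stay p≤a _ _) refl eq q≤z = ⊥-elim (ℕₚ.<⇒≱ (s≤s (ℕₚ.m≤n+m a l)) p≤a)

  walk-length : ∀ {a z xs} → Walk p q a z xs → Σ ℕ λ n → length xs ≡ suc n
  walk-length stop = 0 , refl
  walk-length (advance w) with walk-length w
  ... | n , e = suc n , cong suc e
  walk-length (stay _ _ w) with walk-length w
  ... | n , e = suc n , cong suc e

  walk-head : ∀ {a z xs} → Walk p q a z xs → nth 0 xs 0 ≡ a
  walk-head stop         = refl
  walk-head (advance _)  = refl
  walk-head (stay _ _ _) = refl

  walk-last : ∀ {a z xs} n → Walk p q a z xs → length xs ≡ suc n → nth 0 xs n ≡ z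
  walk-last zero    stop         _   = refl
  walk-last (suc n) (advance w)  len = walk-last n w (ℕₚ.suc-injective len)
  walk-last (suc n) (stay _ _ w) len = walk-last n w (ℕₚ.suc-injective len)
  walk-last zero (advance w) len with walk-length w
  ... | n , e with trans (sym e) (ℕₚ.suc-injective len)
  ...   | ()
  walk-last zero (stay _ _ w) len with walk-length w
  ... | n , e with trans (sym e) (ℕₚ.suc-injective len)
  ...   | ()

  walk-steps : ∀ {a z xs} → Walk p q a z xs → ∀ i → suc i < length xs → StepRel p q (nth 0 xs i) (nth 0 xs (suc i))
  walk-steps stop i (s≤s ())
  walk-steps (advance w) zero _ = inj₁ (walk-head w)
  walk-steps (advance w) (suc i) (s≤s i<) = walk-steps w i i<
  walk-steps (stay p≤a a≤q w) zero _ = inj₂ (walk-head w , p≤a , a≤q)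
  walk-steps (stay _ _ w) (suc i) (s≤s i<) = walk-steps w i i<

  walk⇒fold : ∀ {m n xs} → Walk p q 0 m xs → length xs ≡ suc n → Fold p q m n (nth 0 xs)
  walk⇒fold {n = n} w len .starts = walk-head w
  walk⇒fold {n = n} w len .ends = walk-last n w len
  walk⇒fold {n = n} w len .steps i i<n = walk-steps w i (subst (suc i <_) (sym len) (s≤s i<n))

  steps⇒walk : ∀ φ a l → (∀ i → a ≤ i → i < a ℕ.+ l → StepRel p q (φ i) (φ (suc i))) →
    Walk p q (φ a) (φ (a ℕ.+ l)) (map φ (range a (suc l)))
  steps⇒walk φ a zero h = walk-resp refl (cong φ (sym (ℕₚ.+-identityʳ a))) stop
  steps⇒walk φ a (suc l) h with h a ℕₚ.≤-refl (ℕₚ.m<m+n a (s≤s z≤n))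
                              | walk-resp refl (cong φ (sym (ℕₚ.+-suc a l)))
                                  (steps⇒walk φ (suc a) l (λ i a<i i< → h i (ℕₚ.<⇒≤ a<i) (subst (i <_) (sym (ℕₚ.+-suc a l)) i<)))
  ... | inj₁ e | w = advance (walk-resp e refl w)
  ... | inj₂ (e , p≤ , ≤q) | w = stay p≤ ≤q (walk-resp e refl w)

  fold⇒walk : ∀ {m n φ} → Fold p q m n φ → Walk p q 0 m (map φ (range 0 (suc n)))
  fold⇒walk {n = n} {φ} f = subst₂ (λ a z → Walk p q a z (map φ (range 0 (suc n)))) (starts f) (ends f)
    (steps⇒walk φ 0 n (λ i _ i<n → steps f i i<n))

-- Runs of an index map: their ends, and changes at one position.

FreshL : (ℕ → ℕ) → ℕ → Set
FreshL φ i = ∀ i' → i ≡ suc i' → φ i ≡ suc (φ i')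

-- The position ends its run. The condition is empty at `n`, just as `FreshL` is empty at 0: there
-- the neighbours off the path take over.
FreshR : (ℕ → ℕ) → ℕ → ℕ → Set
FreshR φ n i = i < n → φ (suc i) ≡ suc (φ i)

Unique-at : (ℕ → ℕ) → ℕ → ℕ → Set
Unique-at φ n i = ∀ k → k ≤ n → φ k ≡ φ i → k ≡ i

upd : (ℕ → ℕ) → ℕ → ℕ → ℕ → ℕ
upd φ i v k = if k ≡ᵇ i then v else φ k

upd-same : ∀ φ i v → upd φ i v i ≡ v
upd-same φ i v rewrite ≡ᵇ-refl i = refl

upd-other : ∀ φ i v {k} → k ≢ i → upd φ i v k ≡ φ k
upd-other φ i v k≢i rewrite ≡ᵇ-false k≢i = refl

module FoldLemmas {p q m n : ℕ} {φ : ℕ → ℕ} (F : Fold p q m n φ) where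

  mono-suc : ∀ i → i < n → φ i ≤ φ (suc i)
  mono-suc i i<n with steps F i i<n
  ... | inj₁ e       = subst (φ i ≤_) (sym e) (ℕₚ.n≤1+n (φ i))
  ... | inj₂ (e , _) = ℕₚ.≤-reflexive (sym e)

  mono : ∀ {i} j → i ≤ j → j ≤ n → φ i ≤ φ j
  mono {zero} zero _ _ = ℕₚ.≤-refl
  mono {i} (suc j) i≤j j<n with i ℕ.≟ suc j
  ... | yes refl = ℕₚ.≤-refl
  ... | no i≢j   = ℕₚ.≤-trans (mono j (ℕₚ.≤-pred (ℕₚ.≤∧≢⇒< i≤j i≢j)) (ℕₚ.<⇒≤ j<n)) (mono-suc j j<n)

  φ≤m : ∀ {i} → i ≤ n → φ i ≤ m
  φ≤m {i} i≤n = subst (φ i ≤_) (ends F) (mono n i≤n ℕₚ.≤-refl)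

  φ≤id : ∀ i → i ≤ n → φ i ≤ i
  φ≤id zero    _   = ℕₚ.≤-reflexive (starts F)
  φ≤id (suc i) i<n with steps F i i<n
  ... | inj₁ e       = subst (_≤ suc i) (sym e) (s≤s (φ≤id i (ℕₚ.<⇒≤ i<n)))
  ... | inj₂ (e , _) = subst (_≤ suc i) (sym e) (ℕₚ.m≤n⇒m≤1+n (φ≤id i (ℕₚ.<⇒≤ i<n)))

  m≤n : m ≤ n
  m≤n = subst (_≤ n) (ends F) (φ≤id n ℕₚ.≤-refl)

  left-cases : ∀ i → i ≤ n → FreshL φ i ⊎ (Σ ℕ λ i' → i ≡ suc i' × φ i ≡ φ i' × p ≤ φ i × φ i ≤ q)
  left-cases zero    _ = inj₁ λ _ ()
  left-cases (suc i) i<n with steps F i i<n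
  ... | inj₁ e = inj₁ λ { _ refl → e }
  ... | inj₂ (e , p≤ , ≤q) = inj₂ (i , refl , e , subst (p ≤_) (sym e) p≤ , subst (_≤ q) (sym e) ≤q)

  right-cases : ∀ i → FreshR φ n i ⊎ (i < n × φ (suc i) ≡ φ i × p ≤ φ i × φ i ≤ q)
  right-cases i with i ℕ.<? n
  ... | no i≮n = inj₁ λ i<n → ⊥-elim (i≮n i<n)
  ... | yes i<n with steps F i i<n
  ...   | inj₁ e = inj₁ λ _ → e
  ...   | inj₂ r = inj₂ (i<n , r)

  below : ∀ {i} → FreshL φ i → i ≤ n → ∀ {k} → k < i → φ k < φ i
  below {suc i} fl i<n {k} (s≤s k≤i) = subst (φ k <_) (sym (fl i refl)) (s≤s (mono i k≤i (ℕₚ.<⇒≤ i<n)))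

  above : ∀ {i} → FreshR φ n i → ∀ {k} → i < k → k ≤ n → φ i < φ k
  above {i} fr {k} i<k k≤n = ℕₚ.≤-trans (ℕₚ.≤-reflexive (sym (fr (ℕₚ.<-≤-trans i<k k≤n)))) (mono k i<k k≤n)

  fresh⇒unique : ∀ {i} → FreshL φ i → FreshR φ n i → i ≤ n → Unique-at φ n i
  fresh⇒unique {i} fl fr i≤n k k≤n e with ℕₚ.<-cmp k i
  ... | tri< k<i _ _ = ⊥-elim (ℕₚ.<⇒≢ (below fl i≤n k<i) e)
  ... | tri≈ _ k≡i _ = k≡i
  ... | tri> _ _ i<k = ⊥-elim (ℕₚ.<⇒≢ (above fr i<k k≤n) (sym e))

  unique⇒freshL : ∀ {i} → i ≤ n → Unique-at φ n i → FreshL φ i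
  unique⇒freshL {i} i≤n u with left-cases i i≤n
  ... | inj₁ fl = fl
  ... | inj₂ (i' , refl , e , _) = ⊥-elim (ℕₚ.1+n≢n (sym (u i' (ℕₚ.<⇒≤ i≤n) (sym e))))

  unique⇒freshR : ∀ {i} → Unique-at φ n i → FreshR φ n i
  unique⇒freshR {i} u with right-cases i
  ... | inj₁ fr = fr
  ... | inj₂ (i<n , e , _) = ⊥-elim (ℕₚ.1+n≢n (u (suc i) i<n e))

  unmarked-unique : ∀ {i} → i ≤ n → ¬ (p ≤ φ i × φ i ≤ q) → Unique-at φ n i
  unmarked-unique {i} i≤n ¬marked with left-cases i i≤n | right-cases i
  ... | inj₁ fl | inj₁ fr = fresh⇒unique fl fr i≤n
  ... | inj₂ (_ , _ , _ , r) | _ = ⊥-elim (¬marked r)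
  ... | inj₁ _ | inj₂ (_ , _ , r) = ⊥-elim (¬marked r)

  fold-upd : ∀ i v → i ≤ n → (i ≡ 0 → v ≡ 0) → (i ≡ n → v ≡ m) →
    (∀ i' → i ≡ suc i' → StepRel p q (φ i') v) → (i < n → StepRel p q v (φ (suc i))) → Fold p q m n (upd φ i v)
  fold-upd i v i≤n at-0 at-n before after .starts with 0 ℕ.≟ i
  ... | yes refl = at-0 refl
  ... | no 0≢i   = trans (upd-other φ i v 0≢i) (starts F)
  fold-upd i v i≤n at-0 at-n before after .ends with n ℕ.≟ i
  ... | yes refl = trans (upd-same φ i v) (at-n refl)
  ... | no n≢i   = trans (upd-other φ i v n≢i) (ends F)
  fold-upd i v i≤n at-0 at-n before after .steps k k<n with k ℕ.≟ i | suc k ℕ.≟ i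
  ... | yes refl | yes e    = ⊥-elim (ℕₚ.1+n≢n e)
  ... | yes refl | no k+≢i  = subst₂ (StepRel p q) (sym (upd-same φ i v)) (sym (upd-other φ i v k+≢i)) (after k<n)
  ... | no k≢i   | yes refl = subst₂ (StepRel p q) (sym (upd-other φ i v k≢i)) (sym (upd-same φ i v)) (before k refl)
  ... | no k≢i   | no k+≢i  = subst₂ (StepRel p q) (sym (upd-other φ i v k≢i)) (sym (upd-other φ i v k+≢i)) (steps F k k<n)

  -- A discrete intermediate value theorem: the map starts at 0 and rises by at most one, so it
  -- skips no value; the first index with a value begins its run.
  first-index : ∀ N → N ≤ n → ∀ j → j ≤ φ N → Σ ℕ λ s → s ≤ N × φ s ≡ j × FreshL φ s
  first-index zero _ j j≤ with ℕₚ.≤-antisym (subst (j ≤_) (starts F) j≤) z≤n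
  ... | refl = 0 , z≤n , starts F , λ _ ()
  first-index (suc N) N<n j j≤ with j ℕ.≤? φ N
  ... | yes j≤' with first-index N (ℕₚ.<⇒≤ N<n) j j≤'
  ...   | s , s≤N , e , fl = s , ℕₚ.m≤n⇒m≤1+n s≤N , e , fl
  first-index (suc N) N<n j j≤ | no j≰ with steps F N N<n
  ... | inj₁ e = suc N , ℕₚ.≤-refl , trans e (ℕₚ.≤-antisym (ℕₚ.≰⇒> j≰) (subst (j ≤_) e j≤)) , λ { _ refl → e }
  ... | inj₂ (e , _) = ⊥-elim (j≰ (subst (j ≤_) e j≤))

  last-index : ∀ d s → s ℕ.+ d ≡ n → Σ ℕ λ t → s ℕ.+ t ≤ n × φ (s ℕ.+ t) ≡ φ s × FreshR φ n (s ℕ.+ t)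
  last-index zero s refl = 0 , ℕₚ.≤-refl , cong φ (ℕₚ.+-identityʳ s) , λ lt → ⊥-elim (ℕₚ.<-irrefl refl lt)
  last-index (suc d) s eq with steps F s (subst (s <_) eq (ℕₚ.m<m+n s (s≤s z≤n)))
  ... | inj₁ e = 0 , subst (s ℕ.+ 0 ≤_) eq (ℕₚ.+-monoʳ-≤ s z≤n) , cong φ (ℕₚ.+-identityʳ s) ,
      λ _ → subst (λ s' → φ (suc s') ≡ suc (φ s')) (sym (ℕₚ.+-identityʳ s)) e
  ... | inj₂ (e , _) with last-index d (suc s) (trans (sym (ℕₚ.+-suc s d)) eq)
  ...   | t , le , e' , fr = suc t , subst (_≤ n) (sym (ℕₚ.+-suc s t)) le ,
      trans (cong φ (ℕₚ.+-suc s t)) (trans e' e) , subst (FreshR φ n) (sym (ℕₚ.+-suc s t)) fr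

fold-weaken : ∀ {p q p' q' m n φ} → p' ≤ p → q ≤ q' → Fold p q m n φ → Fold p' q' m n φ
fold-weaken p'≤p q≤q' F .starts = starts F
fold-weaken p'≤p q≤q' F .ends = ends F
fold-weaken p'≤p q≤q' F .steps i i<n with steps F i i<n
... | inj₁ e = inj₁ e
... | inj₂ (e , p≤ , ≤q) = inj₂ (e , ℕₚ.≤-trans p'≤p p≤ , ℕₚ.≤-trans ≤q q≤q')

-- A value taken at one position only is never repeated, so its mark may be withdrawn. This is how
-- an asterisk is dropped in operation 4.
fold-restrict : ∀ {p q p' q' m n φ} → (∀ j → p ≤ j → j ≤ q → (p' ≤ j × j ≤ q') ⊎ (Σ ℕ λ i → φ i ≡ j × i ≤ n × Unique-at φ n i)) →
  Fold p q m n φ → Fold p' q' m n φ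
fold-restrict h F .starts = starts F
fold-restrict h F .ends = ends F
fold-restrict {φ = φ} h F .steps i i<n with steps F i i<n
... | inj₁ e = inj₁ e
... | inj₂ (e , p≤ , ≤q) with h (φ i) p≤ ≤q
...   | inj₁ r = inj₂ (e , r)
...   | inj₂ (i₀ , e₀ , _ , u) = ⊥-elim (ℕₚ.1+n≢n (trans (u (suc i) i<n (trans e (sym e₀))) (sym (u i (ℕₚ.<⇒≤ i<n) (sym e₀)))))

-- The index map after splitting one class vertex, repeated at positions s − 1 and s, into two.
shiftFrom : ℕ → (ℕ → ℕ) → ℕ → ℕ
shiftFrom s φ k = if k <ᵇ s then φ k else suc (φ k)

shiftFrom-< : ∀ {s} φ {k} → k < s → shiftFrom s φ k ≡ φ k
shiftFrom-< φ k<s rewrite <ᵇ-true k<s = refl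

shiftFrom-≥ : ∀ {s} φ {k} → s ≤ k → shiftFrom s φ k ≡ suc (φ k)
shiftFrom-≥ φ s≤k rewrite <ᵇ-false s≤k = refl

-- A run is cut between `s` and `suc s`. Repetition occurs only over marked vertices, so both pieces
-- are marked, and `q` and `m` grow together.
fold-shift : ∀ {p q m n φ} s → s < n → φ (suc s) ≡ φ s → Fold p q m n φ → Fold p (suc q) (suc m) n (shiftFrom (suc s) φ)
fold-shift {φ = φ} s s<n rep F .starts = trans (shiftFrom-< {suc s} φ {0} (s≤s z≤n)) (starts F)
fold-shift {φ = φ} s s<n rep F .ends = trans (shiftFrom-≥ φ s<n) (cong suc (ends F))
fold-shift {p} {q} {φ = φ} s s<n rep F .steps k k<n with ℕₚ.<-cmp k s
... | tri< k<s _ _ = subst₂ (StepRel p (suc q)) (sym (shiftFrom-< φ (ℕₚ.m≤n⇒m≤1+n k<s))) (sym (shiftFrom-< φ (s≤s k<s))) (widen (steps F k k<n))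
  where
  widen : StepRel p q (φ k) (φ (suc k)) → StepRel p (suc q) (φ k) (φ (suc k))
  widen (inj₁ e) = inj₁ e
  widen (inj₂ (e , p≤ , ≤q)) = inj₂ (e , p≤ , ℕₚ.m≤n⇒m≤1+n ≤q)
... | tri≈ _ refl _ = inj₁ (trans (shiftFrom-≥ φ ℕₚ.≤-refl) (cong suc (trans rep (sym (shiftFrom-< φ (ℕₚ.n<1+n k))))))
... | tri> _ _ s<k = subst₂ (StepRel p (suc q)) (sym (shiftFrom-≥ φ s<k)) (sym (shiftFrom-≥ φ (ℕₚ.m≤n⇒m≤1+n s<k))) (raise (steps F k k<n))
  where
  raise : StepRel p q (φ k) (φ (suc k)) → StepRel p (suc q) (suc (φ k)) (suc (φ (suc k)))
  raise (inj₁ e) = inj₁ (cong suc e)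
  raise (inj₂ (e , p≤ , ≤q)) = inj₂ (cong suc e , ℕₚ.m≤n⇒m≤1+n p≤ , s≤s ≤q)

unshiftFrom : ℕ → (ℕ → ℕ) → ℕ → ℕ
unshiftFrom s φ k = if k <ᵇ s then φ k else ℕ.pred (φ k)

unshiftFrom-< : ∀ s φ {k} → k < s → unshiftFrom s φ k ≡ φ k
unshiftFrom-< s φ k<s rewrite <ᵇ-true k<s = refl

unshiftFrom-≥ : ∀ s φ {k a} → s ≤ k → φ k ≡ suc a → unshiftFrom s φ k ≡ a
unshiftFrom-≥ s φ s≤k e rewrite <ᵇ-false s≤k = cong ℕ.pred e

pred-of : ∀ {a i} → a < i → Σ ℕ λ i' → i ≡ suc i' × a ≤ i'
pred-of {i = suc i} (s≤s a≤i) = i , refl , a≤i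

-- Undoes an insertion by operation 3: the runs over `φ s` and its successor are merged, and the
-- bounds on `φ s` place the merged run in the marked segment.
fold-unshift : ∀ {p q m n φ} s → s < n → φ (suc s) ≡ suc (φ s) → p ≤ φ s → φ s ≤ q →
  Fold p (suc q) (suc m) n φ → Fold p q m n (unshiftFrom (suc s) φ)
fold-unshift {φ = φ} s s<n fresh p≤ ≤q F .starts = trans (unshiftFrom-< (suc s) φ (s≤s z≤n)) (starts F)
fold-unshift {φ = φ} s s<n fresh p≤ ≤q F .ends = unshiftFrom-≥ (suc s) φ s<n (ends F)
fold-unshift {p} {q} {n = n} {φ} s s<n fresh p≤ ≤q F .steps k k<n with ℕₚ.<-cmp k s
... | tri< k<s _ _ = subst₂ (StepRel p q) (sym (unshiftFrom-< (suc s) φ (ℕₚ.m≤n⇒m≤1+n k<s))) (sym (unshiftFrom-< (suc s) φ (s≤s k<s)))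
    (narrow (steps F k k<n))
  where
  narrow : StepRel p (suc q) (φ k) (φ (suc k)) → StepRel p q (φ k) (φ (suc k))
  narrow (inj₁ e) = inj₁ e
  narrow (inj₂ (e , p≤' , _)) = inj₂ (e , p≤' , ℕₚ.≤-trans (FoldLemmas.mono F s (ℕₚ.<⇒≤ k<s) (ℕₚ.<⇒≤ s<n)) ≤q)
... | tri≈ _ refl _ = subst₂ (StepRel p q) (sym (unshiftFrom-< (suc s) φ ℕₚ.≤-refl)) (sym (unshiftFrom-≥ (suc s) φ ℕₚ.≤-refl fresh))
    (inj₂ (refl , p≤ , ≤q))
... | tri> _ _ s<k with pred-of (ℕₚ.≤-trans (ℕₚ.≤-reflexive (sym fresh)) (FoldLemmas.mono F k s<k (ℕₚ.<⇒≤ k<n)))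
...   | a , φk≡ , φs≤a = go (steps F k k<n)
  where
  at-k : unshiftFrom (suc s) φ k ≡ a
  at-k = unshiftFrom-≥ (suc s) φ s<k φk≡
  go : StepRel p (suc q) (φ k) (φ (suc k)) → StepRel p q (unshiftFrom (suc s) φ k) (unshiftFrom (suc s) φ (suc k))
  go (inj₁ e) = subst₂ (StepRel p q) (sym at-k) (sym (unshiftFrom-≥ (suc s) φ (ℕₚ.m≤n⇒m≤1+n s<k) (trans e (cong suc φk≡)))) (inj₁ refl)
  go (inj₂ (e , _ , ≤q')) = subst₂ (StepRel p q) (sym at-k) (sym (unshiftFrom-≥ (suc s) φ (ℕₚ.m≤n⇒m≤1+n s<k) (trans e φk≡)))
    (inj₂ (refl , ℕₚ.≤-trans p≤ φs≤a , ℕₚ.≤-pred (subst (_≤ suc q) φk≡ ≤q')))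

-- Stretched diagrams

module Stretched {k : ℕ} (A : Fin k → Fin k → ℤ) (gcm : IsGCM A) (x : Fin k) (inL : Fin k → Bool) where
  open Stretch A x inL

  at : ∀ {n} i → i ≤ n → V n
  at zero    _  = inj₁ x
  at (suc i) lt = inj₂ (fromℕ< lt)

  pos-x : ∀ {n} → pos {n} (inj₁ x) ≡ just 0
  pos-x with x Fin.≟ x
  ... | yes _ = refl
  ... | no ¬p = ⊥-elim (¬p refl)

  pos-off : ∀ {n y} → y ≢ x → pos {n} (inj₁ y) ≡ nothing
  pos-off {y = y} y≢x with y Fin.≟ x
  ... | yes p = ⊥-elim (y≢x p)
  ... | no _  = refl

  pos-at : ∀ {n} i (i≤n : i ≤ n) → pos (at i i≤n) ≡ just i
  pos-at {n} zero    _  = pos-x {n}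
  pos-at     (suc i) lt = cong (λ j → just (suc j)) (Finₚ.toℕ-fromℕ< lt)

  pathVal-at : ∀ {n} (g : V n → ℤ) i (i≤n : i ≤ n) → pathVal g i ≡ g (at i i≤n)
  pathVal-at g zero _ = refl
  pathVal-at {n} g (suc i) lt with i ℕ.<? n
  ... | yes _ = refl
  ... | no i≮n = ⊥-elim (i≮n lt)

  pathVal-beyond : ∀ {n} (g : V n → ℤ) i → n < i → pathVal g i ≡ 0ℤ
  pathVal-beyond {n} g (suc i) (s≤s n≤i) with i ℕ.<? n
  ... | yes i<n = ⊥-elim (ℕₚ.<⇒≱ i<n n≤i)
  ... | no _    = refl

  -- The sum type does not separate the path from the rest, because `inj₁ x` is the path vertex
  -- `x_0`; this view does.
  data View {n : ℕ} : V n → Set where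
    off : ∀ y → y ≢ x → View (inj₁ y)
    on  : ∀ i (i≤n : i ≤ n) → View (at i i≤n)

  view : ∀ {n} (v : V n) → View v
  view (inj₁ y) with y Fin.≟ x
  ... | yes refl = on 0 z≤n
  ... | no y≢x   = off y y≢x
  view (inj₂ j) = subst (λ i → View (inj₂ i)) (Finₚ.fromℕ<-toℕ j _) (on (suc (toℕ j)) (Finₚ.toℕ<n j))

  pos⇒at : ∀ {n} (v : V n) {i} → pos v ≡ just i → Σ (i ≤ n) λ i≤n → v ≡ at i i≤n
  pos⇒at {n} v eq with view v
  pos⇒at {n} .(inj₁ y) eq | off y y≢x with trans (sym (pos-off {n} y≢x)) eq
  ... | ()
  pos⇒at .(at i i≤n) eq | on i i≤n with just-injective (trans (sym (pos-at i i≤n)) eq)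
  ... | refl = i≤n , refl

  ext : ∀ {n} {g h : V n → ℤ} → (∀ y → y ≢ x → g (inj₁ y) ≡ h (inj₁ y)) →
        (∀ i → i ≤ n → pathVal g i ≡ pathVal h i) → g ≗ h
  ext {n} {g} {h} offs paths v with view v
  ... | off y y≢x  = offs y y≢x
  ... | on i i≤n = trans (sym (pathVal-at g i i≤n)) (trans (paths i i≤n) (pathVal-at h i i≤n))

  pathVal-cong : ∀ {n} {g h : V n → ℤ} → g ≗ h → ∀ i → pathVal g i ≡ pathVal h i
  pathVal-cong e zero = e (inj₁ x)
  pathVal-cong {n} e (suc i) with i ℕ.<? n
  ... | yes lt = e (inj₂ (fromℕ< lt))
  ... | no _   = refl

  -- Pairings with the stretched Cartan matrix.

  sumL sumR : (Fin k → ℤ) → ℤ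
  sumL f = ∑ (allFin k) (λ y → if does (y Fin.≟ x) ∨ not (inL y) then 0ℤ else - (A x y ℤ.* f y))
  sumR f = ∑ (allFin k) (λ y → if does (y Fin.≟ x) ∨ inL y then 0ℤ else - (A x y ℤ.* f y))

  -- At an end of the path the missing path neighbour is replaced by the weighted sum over `L_x` or
  -- `R_x`. Every reflection at a path vertex then has the same form, also for `n = 0`, where both
  -- ends coincide.
  leftVal rightVal : ∀ {n} → (V n → ℤ) → ℕ → ℤ
  leftVal g zero    = sumL (λ y → g (inj₁ y))
  leftVal g (suc i) = pathVal g i
  rightVal {n} g i = if i ≡ᵇ n then sumR (λ y → g (inj₁ y)) else pathVal g (suc i)

  offPair : Fin k → (Fin k → ℤ) → ℤ → ℤ
  offPair y f v = ∑ (allFin k) (λ z → if does (z Fin.≟ x) then 0ℤ else A y z ℤ.* f z) ℤ.+ A y x ℤ.* v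

  -- The matrix `stA` branches by `with` on positions; here they are explicit arguments, so a known
  -- position can be substituted by congruence.
  entry : ℕ → Maybe ℕ → Fin k → Maybe ℕ → Fin k → ℤ
  entry m nothing  y nothing  z = A y z
  entry m (just a) y nothing  z = if attached m a z then A x z else 0ℤ
  entry m nothing  y (just b) z = if attached m b y then A y x else 0ℤ
  entry m (just a) y (just b) z = pathEntry a b

  stA-entry : ∀ m u v → stA m u v ≡ entry m (pos u) (orig u) (pos v) (orig v)
  stA-entry m u v with pos u | pos v
  ... | nothing | nothing = refl
  ... | just a  | nothing = refl
  ... | nothing | just b  = refl
  ... | just a  | just b  = refl

  stA-on-on : ∀ {m} {u v : V m} {a b} → pos u ≡ just a → pos v ≡ just b → stA m u v ≡ pathEntry a b
  stA-on-on {m} {u} {v} p q = trans (stA-entry m u v) (cong₂ (λ a b → entry m a (orig u) b (orig v)) p q)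

  stA-on-off : ∀ {m} {u : V m} {a y} → pos u ≡ just a → y ≢ x →
               stA m u (inj₁ y) ≡ (if attached m a y then A x y else 0ℤ)
  stA-on-off {m} {u} {y = y} p y≢x = trans (stA-entry m u (inj₁ y)) (cong₂ (λ a b → entry m a (orig u) b y) p (pos-off {m} y≢x))

  stA-off-on : ∀ {m} {v : V m} {b y} → y ≢ x → pos v ≡ just b →
               stA m (inj₁ y) v ≡ (if attached m b y then A y x else 0ℤ)
  stA-off-on {m} {v} {y = y} y≢x p = trans (stA-entry m (inj₁ y) v) (cong₂ (λ a b → entry m a y b (orig v)) (pos-off {m} y≢x) p)

  stA-off-off : ∀ {m y z} → y ≢ x → z ≢ x → stA m (inj₁ y) (inj₁ z) ≡ A y z
  stA-off-off {m} {y} {z} y≢x z≢x = trans (stA-entry m (inj₁ y) (inj₁ z))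
    (cong₂ (λ a b → entry m a y b z) (pos-off {m} y≢x) (pos-off {m} z≢x))

  ∑-allFin-only : ∀ n (f : Fin n → ℤ) l → ∑ (allFin n) (only Fin._≟_ l f) ≡ f l
  ∑-allFin-only n f l = ∑-only Fin._≟_ (allFin n) f l (Uniqueₚ.allFin⁺ n) (∈-allFin l)

  enum-unique : ∀ n → Unique (enum n)
  enum-unique n = Uniqueₚ.++⁺ (Uniqueₚ.map⁺ inj₁-injective (Uniqueₚ.allFin⁺ k)) (Uniqueₚ.map⁺ inj₂-injective (Uniqueₚ.allFin⁺ n)) disjoint
    where
    disjoint : ∀ {v} → v ∈ map inj₁ (allFin k) × v ∈ map inj₂ (allFin n) → ⊥
    disjoint (p , q) with ∈-map⁻ inj₁ p | ∈-map⁻ inj₂ q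
    ... | _ , _ , refl | _ , _ , ()

  enum-complete : ∀ n v → v ∈ enum n
  enum-complete n (inj₁ y) = ∈-++⁺ˡ (∈-map⁺ inj₁ (∈-allFin y))
  enum-complete n (inj₂ j) = ∈-++⁺ʳ _ (∈-map⁺ inj₂ (∈-allFin j))

  ∑-enum : ∀ n (f : V n → ℤ) → ∑ (enum n) f ≡ ∑ (allFin k) (λ y → f (inj₁ y)) ℤ.+ ∑ (allFin n) (λ j → f (inj₂ j))
  ∑-enum n f = trans (∑-++ (map inj₁ (allFin k)) (map inj₂ (allFin n)) f)
    (cong₂ ℤ._+_ (∑-map (allFin k) inj₁ f) (∑-map (allFin n) inj₂ f))

  -- The Cartan matrix of type A as a combination of deltas, which turns the path part of a pairing
  -- into evaluations of `pathVal`.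
  pathEntry-δ : ∀ a b → pathEntry a b ≡ ((+ 2) ℤ.* δ a b ℤ.- δ (suc a) b) ℤ.- δ a (suc b)
  pathEntry-δ zero          zero          = refl
  pathEntry-δ zero          (suc zero)    = refl
  pathEntry-δ zero          (suc (suc b)) = refl
  pathEntry-δ (suc zero)    zero          = refl
  pathEntry-δ (suc (suc a)) zero          = refl
  pathEntry-δ (suc a)       (suc b)       = pathEntry-δ a b

  pathSum : ∀ {n} → (V n → ℤ) → (ℕ → ℤ) → ℤ
  pathSum {n} g c = c 0 ℤ.* g (inj₁ x) ℤ.+ ∑ (allFin n) (λ j → c (suc (toℕ j)) ℤ.* g (inj₂ j))

  pathSum-cong : ∀ {n} (g : V n → ℤ) {c d} → c ≗ d → pathSum g c ≡ pathSum g d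
  pathSum-cong {n} g e = cong₂ ℤ._+_ (cong (ℤ._* g (inj₁ x)) (e 0)) (∑-cong (allFin n) (λ j → cong (ℤ._* g (inj₂ j)) (e (suc (toℕ j)))))

  pathSum-lin : ∀ {n} (g : V n → ℤ) u c d → pathSum g (λ i → u ℤ.* c i ℤ.+ d i) ≡ u ℤ.* pathSum g c ℤ.+ pathSum g d
  pathSum-lin {n} g u c d = trans
    (cong (λ z → (u ℤ.* c 0 ℤ.+ d 0) ℤ.* g (inj₁ x) ℤ.+ z)
      (trans (∑-cong (allFin n) (λ j → distr u (c (suc (toℕ j))) (d (suc (toℕ j))) (g (inj₂ j))))
        (trans (∑-+ (allFin n) _ _) (cong (λ z → z ℤ.+ ∑ (allFin n) (λ j → d (suc (toℕ j)) ℤ.* g (inj₂ j))) (∑-* (allFin n) u _)))))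
    (collect u (c 0) (d 0) (g (inj₁ x)) _ _)
    where
    distr : ∀ u c d g → (u ℤ.* c ℤ.+ d) ℤ.* g ≡ u ℤ.* (c ℤ.* g) ℤ.+ d ℤ.* g
    distr = solve-∀
    collect : ∀ u c d g s t → (u ℤ.* c ℤ.+ d) ℤ.* g ℤ.+ (u ℤ.* s ℤ.+ t) ≡ u ℤ.* (c ℤ.* g ℤ.+ s) ℤ.+ (d ℤ.* g ℤ.+ t)
    collect = solve-∀

  pathSum-δ : ∀ {n} (g : V n → ℤ) c → pathSum g (δ c) ≡ pathVal g c
  pathSum-δ {n} g zero = trans (cong₂ ℤ._+_ (ℤₚ.*-identityˡ (g (inj₁ x))) (trans (∑-cong (allFin n) (λ j → ℤₚ.*-zeroˡ (g (inj₂ j)))) (∑-0 (allFin n))))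
    (ℤₚ.+-identityʳ _)
  pathSum-δ {n} g (suc c) = trans (cong₂ ℤ._+_ (ℤₚ.*-zeroˡ (g (inj₁ x))) (inner c)) (ℤₚ.+-identityˡ _)
    where
    inner : ∀ c → ∑ (allFin n) (λ j → δ c (toℕ j) ℤ.* g (inj₂ j)) ≡ pathVal g (suc c)
    inner c with c ℕ.<? n
    ... | yes lt = trans (∑-cong (allFin n) pointwise) (∑-allFin-only n (λ j → g (inj₂ j)) (fromℕ< lt))
      where
      pointwise : ∀ j → δ c (toℕ j) ℤ.* g (inj₂ j) ≡ only Fin._≟_ (fromℕ< lt) (λ j → g (inj₂ j)) j
      pointwise j with fromℕ< lt Fin.≟ j
      ... | yes refl rewrite Finₚ.toℕ-fromℕ< lt | ≡ᵇ-refl c = ℤₚ.*-identityˡ _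
      ... | no ne rewrite ≡ᵇ-false {c} {toℕ j} (λ e → ne (trans (Finₚ.fromℕ<-cong c (toℕ j) e lt (Finₚ.toℕ<n j)) (Finₚ.fromℕ<-toℕ j _))) = refl
    -- Beyond the end of the path no index matches, in agreement with the default value 0 of
    -- `pathVal`.
    ... | no c≮n = trans (∑-cong (allFin n) pointwise) (∑-0 (allFin n))
      where
      pointwise : ∀ j → δ c (toℕ j) ℤ.* g (inj₂ j) ≡ 0ℤ
      pointwise j rewrite ≡ᵇ-false {c} {toℕ j} (λ e → c≮n (subst (_< n) (sym e) (Finₚ.toℕ<n j))) = refl

  pathSum-0 : ∀ {n} (g : V n → ℤ) → pathSum g (λ _ → 0ℤ) ≡ 0ℤ
  pathSum-0 {n} g = trans (pathSum-cong g {d = λ i → ℤ.-1ℤ ℤ.* δ 0 i ℤ.+ δ 0 i} (λ i → sym (lem (δ 0 i))))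
    (trans (pathSum-lin g ℤ.-1ℤ (δ 0) (δ 0)) (lem (pathSum g (δ 0))))
    where
    lem : ∀ z → ℤ.-1ℤ ℤ.* z ℤ.+ z ≡ 0ℤ
    lem = solve-∀

  pathSum-δ-suc : ∀ {n} (g : V n → ℤ) i → i ≤ n → pathSum g (λ b → δ i (suc b)) ≡ (if i ≡ᵇ 0 then 0ℤ else pathVal g (i ∸ 1))
  pathSum-δ-suc g zero    _ = pathSum-0 g
  pathSum-δ-suc g (suc i) _ = pathSum-δ g i

  -- The entry is passed as `s` together with its value in either case, so that deciding `y = x`
  -- does not interfere with the branching inside `stA`. The deltas record at which ends position
  -- `i` lies.
  onOff : ∀ {n} (g : V n → ℤ) (i : ℕ) y s → (y ≡ x → s ≡ pathEntry i 0) →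
    (y ≢ x → s ≡ (if attached n i y then A x y else 0ℤ)) →
    s ℤ.* g (inj₁ y) ≡
      (only Fin._≟_ x (λ _ → pathEntry i 0 ℤ.* g (inj₁ x)) y
        ℤ.+ (- δ i 0) ℤ.* (if does (y Fin.≟ x) ∨ not (inL y) then 0ℤ else - (A x y ℤ.* g (inj₁ y))))
        ℤ.+ (- δ i n) ℤ.* (if does (y Fin.≟ x) ∨ inL y then 0ℤ else - (A x y ℤ.* g (inj₁ y)))
  onOff {n} g i y s s-on s-off with y Fin.≟ x | x Fin.≟ y
  ... | yes refl | no ¬q = ⊥-elim (¬q refl)
  ... | no ¬q | yes refl = ⊥-elim (¬q refl)
  ... | yes refl | yes _ = trans (cong (ℤ._* g (inj₁ y)) (s-on refl)) (lem (pathEntry i 0 ℤ.* g (inj₁ y)) (- δ i 0) (- δ i n))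
    where
    lem : ∀ p a b → p ≡ (p ℤ.+ a ℤ.* 0ℤ) ℤ.+ b ℤ.* 0ℤ
    lem = solve-∀
  ... | no y≢x | no _ = trans (cong (ℤ._* g (inj₁ y)) (s-off y≢x)) (cases (inL y) (i ≡ᵇ 0) (i ≡ᵇ n))
    where
    e : ℤ
    e = A x y
    h : ℤ
    h = g (inj₁ y)
    lem₁ : ∀ e h → e ℤ.* h ≡ (0ℤ ℤ.+ (- 1ℤ) ℤ.* (- (e ℤ.* h))) ℤ.+ (- 1ℤ) ℤ.* 0ℤ
    lem₁ = solve-∀
    lem₂ : ∀ e h → e ℤ.* h ≡ (0ℤ ℤ.+ (- 1ℤ) ℤ.* (- (e ℤ.* h))) ℤ.+ (- 0ℤ) ℤ.* 0ℤ
    lem₂ = solve-∀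
    lem₃ : ∀ e h (u : ℤ) → 0ℤ ℤ.* h ≡ (0ℤ ℤ.+ (- 0ℤ) ℤ.* (- (e ℤ.* h))) ℤ.+ (- u) ℤ.* 0ℤ
    lem₃ = solve-∀
    lem₄ : ∀ e h (u : ℤ) → e ℤ.* h ≡ (0ℤ ℤ.+ (- u) ℤ.* 0ℤ) ℤ.+ (- 1ℤ) ℤ.* (- (e ℤ.* h))
    lem₄ = solve-∀
    lem₅ : ∀ e h (u : ℤ) → 0ℤ ℤ.* h ≡ (0ℤ ℤ.+ (- u) ℤ.* 0ℤ) ℤ.+ (- 0ℤ) ℤ.* (- (e ℤ.* h))
    lem₅ = solve-∀
    cases : ∀ l b₀ bₙ → (if (b₀ ∧ l) ∨ (bₙ ∧ not l) then e else 0ℤ) ℤ.* h ≡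
      (0ℤ ℤ.+ (- (if b₀ then 1ℤ else 0ℤ)) ℤ.* (if not l then 0ℤ else - (e ℤ.* h)))
        ℤ.+ (- (if bₙ then 1ℤ else 0ℤ)) ℤ.* (if l then 0ℤ else - (e ℤ.* h))
    cases true  true  true  = lem₁ e h
    cases true  true  false = lem₂ e h
    cases true  false true  = lem₃ e h 1ℤ
    cases true  false false = lem₃ e h 0ℤ
    cases false true  true  = lem₄ e h 1ℤ
    cases false false true  = lem₄ e h 0ℤ
    cases false true  false = lem₅ e h 1ℤ
    cases false false false = lem₅ e h 0ℤ

  pair-on : ∀ {n} (g : V n → ℤ) i → (i≤n : i ≤ n) →
    StΦ.pair n (at i i≤n) g ≡ (+ 2) ℤ.* pathVal g i ℤ.- leftVal g i ℤ.- rightVal g i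
  pair-on {n} g i i≤n = begin
    StΦ.pair n u g
      ≡⟨ ∑-enum n (λ v → stA n u v ℤ.* g v) ⟩
    ∑ (allFin k) (λ y → stA n u (inj₁ y) ℤ.* g (inj₁ y)) ℤ.+ ∑ (allFin n) (λ j → stA n u (inj₂ j) ℤ.* g (inj₂ j))
      ≡⟨ cong₂ ℤ._+_ offPart (∑-cong (allFin n) (λ j → cong (ℤ._* g (inj₂ j)) (stA-on-on {n} {u} {inj₂ j} pu refl))) ⟩
    ((pathEntry i 0 ℤ.* g (inj₁ x) ℤ.+ (- δ i 0) ℤ.* sumL f) ℤ.+ (- δ i n) ℤ.* sumR f) ℤ.+
      ∑ (allFin n) (λ j → pathEntry i (suc (toℕ j)) ℤ.* g (inj₂ j))
      ≡⟨ reorder (pathEntry i 0 ℤ.* g (inj₁ x)) ((- δ i 0) ℤ.* sumL f) ((- δ i n) ℤ.* sumR f) _ ⟩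
    pathSum g (pathEntry i) ℤ.+ ((- δ i 0) ℤ.* sumL f ℤ.+ (- δ i n) ℤ.* sumR f)
      ≡⟨ cong (λ z → z ℤ.+ ((- δ i 0) ℤ.* sumL f ℤ.+ (- δ i n) ℤ.* sumR f)) pathPart ⟩
    (((+ 2) ℤ.* pathVal g i ℤ.- pathVal g (suc i)) ℤ.- (if i ≡ᵇ 0 then 0ℤ else pathVal g (i ∸ 1)))
      ℤ.+ ((- δ i 0) ℤ.* sumL f ℤ.+ (- δ i n) ℤ.* sumR f)
      ≡⟨ boundary i refl ⟩
    (+ 2) ℤ.* pathVal g i ℤ.- leftVal g i ℤ.- rightVal g i ∎
    where
    open ≡-Reasoning
    u = at i i≤n
    pu = pos-at i i≤n
    f : Fin k → ℤ
    f y = g (inj₁ y)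
    reorder : ∀ a b c d → ((a ℤ.+ b) ℤ.+ c) ℤ.+ d ≡ (a ℤ.+ d) ℤ.+ (b ℤ.+ c)
    reorder = solve-∀
    offPart : ∑ (allFin k) (λ y → stA n u (inj₁ y) ℤ.* g (inj₁ y)) ≡
              (pathEntry i 0 ℤ.* g (inj₁ x) ℤ.+ (- δ i 0) ℤ.* sumL f) ℤ.+ (- δ i n) ℤ.* sumR f
    offPart = trans (∑-cong (allFin k) (λ y → onOff g i y (stA n u (inj₁ y))
        (λ { refl → stA-on-on {n} {u} {inj₁ y} pu (pos-x {n}) }) (stA-on-off {n} {u} pu)))
      (trans (∑-+ (allFin k) _ _) (cong₂ ℤ._+_
        (trans (∑-+ (allFin k) _ _) (cong₂ ℤ._+_ (∑-allFin-only k (λ _ → pathEntry i 0 ℤ.* g (inj₁ x)) x) (∑-* (allFin k) (- δ i 0) _)))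
        (∑-* (allFin k) (- δ i n) _)))
    pathPart : pathSum g (pathEntry i) ≡
      ((+ 2) ℤ.* pathVal g i ℤ.- pathVal g (suc i)) ℤ.- (if i ≡ᵇ 0 then 0ℤ else pathVal g (i ∸ 1))
    pathPart = begin
      pathSum g (pathEntry i)
        ≡⟨ pathSum-cong g (λ b → trans (pathEntry-δ i b) (lem₁ (δ i b) (δ (suc i) b) (δ i (suc b)))) ⟩
      pathSum g (λ b → (+ 2) ℤ.* δ i b ℤ.+ (ℤ.-1ℤ ℤ.* δ (suc i) b ℤ.+ (ℤ.-1ℤ ℤ.* δ i (suc b) ℤ.+ 0ℤ)))
        ≡⟨ pathSum-lin g (+ 2) (δ i) d₁ ⟩
      (+ 2) ℤ.* pathSum g (δ i) ℤ.+ pathSum g (λ b → ℤ.-1ℤ ℤ.* δ (suc i) b ℤ.+ (ℤ.-1ℤ ℤ.* δ i (suc b) ℤ.+ 0ℤ))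
        ≡⟨ cong₂ (λ y z → (+ 2) ℤ.* y ℤ.+ z) (pathSum-δ g i) (trans (pathSum-lin g ℤ.-1ℤ (δ (suc i)) d₂)
             (cong₂ (λ y z → ℤ.-1ℤ ℤ.* y ℤ.+ z) (pathSum-δ g (suc i)) (trans (pathSum-lin g ℤ.-1ℤ (λ b → δ i (suc b)) (λ _ → 0ℤ))
               (cong₂ (λ y z → ℤ.-1ℤ ℤ.* y ℤ.+ z) (pathSum-δ-suc g i i≤n) (pathSum-0 g))))) ⟩
      (+ 2) ℤ.* pathVal g i ℤ.+ (ℤ.-1ℤ ℤ.* pathVal g (suc i) ℤ.+ (ℤ.-1ℤ ℤ.* (if i ≡ᵇ 0 then 0ℤ else pathVal g (i ∸ 1)) ℤ.+ 0ℤ))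
        ≡⟨ lem₂ (pathVal g i) (pathVal g (suc i)) _ ⟩
      ((+ 2) ℤ.* pathVal g i ℤ.- pathVal g (suc i)) ℤ.- (if i ≡ᵇ 0 then 0ℤ else pathVal g (i ∸ 1)) ∎
      where
      d₁ d₂ : ℕ → ℤ
      d₁ b = ℤ.-1ℤ ℤ.* δ (suc i) b ℤ.+ d₂ b
      d₂ b = ℤ.-1ℤ ℤ.* δ i (suc b) ℤ.+ 0ℤ
      lem₁ : ∀ a b c → ((+ 2) ℤ.* a ℤ.- b) ℤ.- c ≡ (+ 2) ℤ.* a ℤ.+ (ℤ.-1ℤ ℤ.* b ℤ.+ (ℤ.-1ℤ ℤ.* c ℤ.+ 0ℤ))
      lem₁ = solve-∀
      lem₂ : ∀ a b c → (+ 2) ℤ.* a ℤ.+ (ℤ.-1ℤ ℤ.* b ℤ.+ (ℤ.-1ℤ ℤ.* c ℤ.+ 0ℤ)) ≡ ((+ 2) ℤ.* a ℤ.- b) ℤ.- c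
      lem₂ = solve-∀
    -- At `i = n` the default value 0 past the end removes the path term; elsewhere the delta
    -- removes the sum over `R_x`.
    right : ∀ i → pathVal g (suc i) ℤ.+ δ i n ℤ.* sumR f ≡ rightVal g i
    right i with i ℕ.≟ n
    ... | yes refl rewrite ≡ᵇ-refl n | pathVal-beyond g (suc n) ℕₚ.≤-refl = trans (ℤₚ.+-identityˡ _) (ℤₚ.*-identityˡ _)
    ... | no i≢n rewrite ≡ᵇ-false i≢n = trans (cong (λ z → pathVal g (suc i) ℤ.+ z) (ℤₚ.*-zeroˡ (sumR f))) (ℤₚ.+-identityʳ _)
    boundary : ∀ i' → i' ≡ i → (((+ 2) ℤ.* pathVal g i' ℤ.- pathVal g (suc i')) ℤ.- (if i' ≡ᵇ 0 then 0ℤ else pathVal g (i' ∸ 1)))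
      ℤ.+ ((- δ i' 0) ℤ.* sumL f ℤ.+ (- δ i' n) ℤ.* sumR f) ≡ (+ 2) ℤ.* pathVal g i' ℤ.- leftVal g i' ℤ.- rightVal g i'
    boundary zero    _ = trans (lem (pathVal g 0) (pathVal g 1) (sumL f) (δ 0 n) (sumR f)) (cong (λ z → (+ 2) ℤ.* pathVal g 0 ℤ.- sumL f ℤ.- z) (right 0))
      where
      lem : ∀ p q l d r → (((+ 2) ℤ.* p ℤ.- q) ℤ.- 0ℤ) ℤ.+ ((- 1ℤ) ℤ.* l ℤ.+ (- d) ℤ.* r) ≡ (+ 2) ℤ.* p ℤ.- l ℤ.- (q ℤ.+ d ℤ.* r)
      lem = solve-∀
    boundary (suc i') _ = trans (lem (pathVal g (suc i')) (pathVal g (suc (suc i'))) (pathVal g i') (sumL f) (δ (suc i') n) (sumR f))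
        (cong (λ z → (+ 2) ℤ.* pathVal g (suc i') ℤ.- pathVal g i' ℤ.- z) (right (suc i')))
      where
      lem : ∀ p q o l d r → (((+ 2) ℤ.* p ℤ.- q) ℤ.- o) ℤ.+ ((- 0ℤ) ℤ.* l ℤ.+ (- d) ℤ.* r) ≡ (+ 2) ℤ.* p ℤ.- o ℤ.- (q ℤ.+ d ℤ.* r)
      lem = solve-∀

  -- The end of the path that carries `y`. For a non-neighbour of `x` the choice is harmless, the
  -- weight `A y x` being 0.
  endOf : ℕ → Fin k → ℕ
  endOf n y = if inL y then 0 else n

  attached-δ : ∀ n b y (e : ℤ) → (if attached n b y then e else 0ℤ) ≡ e ℤ.* δ (endOf n y) b
  attached-δ n b y e with inL y
  ... | true rewrite ≡ᵇ-sym b 0 = cases (0 ≡ᵇ b) (b ≡ᵇ n)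
    where
    cases : ∀ c d → (if (c ∧ true) ∨ (d ∧ false) then e else 0ℤ) ≡ e ℤ.* (if c then 1ℤ else 0ℤ)
    cases true  d     = sym (ℤₚ.*-identityʳ e)
    cases false true  = sym (ℤₚ.*-zeroʳ e)
    cases false false = sym (ℤₚ.*-zeroʳ e)
  ... | false rewrite ≡ᵇ-sym n b = cases (b ≡ᵇ 0) (b ≡ᵇ n)
    where
    cases : ∀ c d → (if (c ∧ false) ∨ (d ∧ true) then e else 0ℤ) ≡ e ℤ.* (if d then 1ℤ else 0ℤ)
    cases true  true  = sym (ℤₚ.*-identityʳ e)
    cases false true  = sym (ℤₚ.*-identityʳ e)
    cases true  false = sym (ℤₚ.*-zeroʳ e)
    cases false false = sym (ℤₚ.*-zeroʳ e)

  pair-off : ∀ {n} (g : V n → ℤ) y → y ≢ x →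
    StΦ.pair n (inj₁ y) g ≡ offPair y (λ z → g (inj₁ z)) (pathVal g (endOf n y))
  pair-off {n} g y y≢x = begin
    StΦ.pair n u g
      ≡⟨ ∑-enum n (λ v → stA n u v ℤ.* g v) ⟩
    ∑ (allFin k) (λ z → stA n u (inj₁ z) ℤ.* g (inj₁ z)) ℤ.+ ∑ (allFin n) (λ j → stA n u (inj₂ j) ℤ.* g (inj₂ j))
      ≡⟨ cong₂ ℤ._+_ (trans (∑-cong (allFin k) (λ z → pointwise z (stA n u (inj₁ z))
             (λ { refl → stA-off-on {n} {inj₁ z} y≢x (pos-x {n}) }) (stA-off-off {n} y≢x))) (∑-+ (allFin k) _ _))
           (∑-cong (allFin n) (λ j → cong (ℤ._* g (inj₂ j)) (stA-off-on {n} {inj₂ j} y≢x refl))) ⟩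
    (∑ (allFin k) (only Fin._≟_ x (λ _ → c 0 ℤ.* g (inj₁ x))) ℤ.+ rest) ℤ.+ ∑ (allFin n) (λ j → c (suc (toℕ j)) ℤ.* g (inj₂ j))
      ≡⟨ cong (λ z → (z ℤ.+ rest) ℤ.+ ∑ (allFin n) (λ j → c (suc (toℕ j)) ℤ.* g (inj₂ j))) (∑-allFin-only k (λ _ → c 0 ℤ.* g (inj₁ x)) x) ⟩
    (c 0 ℤ.* g (inj₁ x) ℤ.+ rest) ℤ.+ ∑ (allFin n) (λ j → c (suc (toℕ j)) ℤ.* g (inj₂ j))
      ≡⟨ reorder (c 0 ℤ.* g (inj₁ x)) rest _ ⟩
    rest ℤ.+ pathSum g c
      ≡⟨ cong (λ z → rest ℤ.+ z) pathPart ⟩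
    rest ℤ.+ A y x ℤ.* pathVal g (endOf n y) ∎
    where
    open ≡-Reasoning
    u : V n
    u = inj₁ y
    c : ℕ → ℤ
    c b = if attached n b y then A y x else 0ℤ
    rest : ℤ
    rest = ∑ (allFin k) (λ z → if does (z Fin.≟ x) then 0ℤ else A y z ℤ.* g (inj₁ z))
    reorder : ∀ a b c → (a ℤ.+ b) ℤ.+ c ≡ b ℤ.+ (a ℤ.+ c)
    reorder = solve-∀
    pointwise : ∀ z s → (z ≡ x → s ≡ c 0) → (z ≢ x → s ≡ A y z) → s ℤ.* g (inj₁ z) ≡
      only Fin._≟_ x (λ _ → c 0 ℤ.* g (inj₁ x)) z ℤ.+ (if does (z Fin.≟ x) then 0ℤ else A y z ℤ.* g (inj₁ z))
    pointwise z s s-on s-off with z Fin.≟ x | x Fin.≟ z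
    ... | yes refl | no ¬q = ⊥-elim (¬q refl)
    ... | no ¬q | yes refl = ⊥-elim (¬q refl)
    ... | yes refl | yes _ = trans (cong (ℤ._* g (inj₁ z)) (s-on refl)) (sym (ℤₚ.+-identityʳ _))
    ... | no z≢x | no _ = trans (cong (ℤ._* g (inj₁ z)) (s-off z≢x)) (sym (ℤₚ.+-identityˡ _))
    pathPart : pathSum g c ≡ A y x ℤ.* pathVal g (endOf n y)
    pathPart = trans (pathSum-cong g {d = λ b → A y x ℤ.* δ (endOf n y) b ℤ.+ 0ℤ} (λ b → trans (attached-δ n b y (A y x)) (sym (ℤₚ.+-identityʳ _))))
      (trans (pathSum-lin g (A y x) (δ (endOf n y)) (λ _ → 0ℤ))
        (trans (cong₂ (λ p q → A y x ℤ.* p ℤ.+ q) (pathSum-δ g (endOf n y)) (pathSum-0 g)) (ℤₚ.+-identityʳ _)))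

  -- The stretched matrix is a generalized Cartan matrix.

  diagonal : ∀ n (v : V n) → stA n v v ≡ + 2
  diagonal n v with view v
  ... | off y y≢x = trans (stA-off-off {n} y≢x y≢x) (proj₁ gcm y)
  ... | on i i≤n = trans (stA-on-on {n} {at i i≤n} (pos-at i i≤n) (pos-at i i≤n)) (self i)

    where
    self : ∀ i → pathEntry i i ≡ + 2
    self zero    = refl
    self (suc i) = self i

  if-nonPos : ∀ (b : Bool) {i} → i ℤ.≤ 0ℤ → (if b then i else 0ℤ) ℤ.≤ 0ℤ
  if-nonPos true  p = p
  if-nonPos false p = ℤₚ.≤-refl

  if-zero : ∀ (b : Bool) {i j} → (i ≡ 0ℤ → j ≡ 0ℤ) → (if b then i else 0ℤ) ≡ 0ℤ → (if b then j else 0ℤ) ≡ 0ℤ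
  if-zero true  h = h
  if-zero false h _ = refl

  offdiagonal : ∀ n (u v : V n) → u ≢ v → stA n u v ℤ.≤ 0ℤ
  offdiagonal n u v u≢v with view u | view v
  ... | off y y≢x | off z z≢x = subst (ℤ._≤ 0ℤ) (sym (stA-off-off {n} y≢x z≢x)) (proj₁ (proj₂ gcm) y z (λ e → u≢v (cong inj₁ e)))
  ... | off y y≢x | on i i≤n = subst (ℤ._≤ 0ℤ) (sym (stA-off-on {n} {at i i≤n} y≢x (pos-at i i≤n))) (if-nonPos (attached n i y) (proj₁ (proj₂ gcm) y x y≢x))
  ... | on i i≤n | off z z≢x = subst (ℤ._≤ 0ℤ) (sym (stA-on-off {n} {at i i≤n} (pos-at i i≤n) z≢x)) (if-nonPos (attached n i z) (proj₁ (proj₂ gcm) x z (λ e → z≢x (sym e))))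
  ... | on i i≤n | on j j≤n = subst (ℤ._≤ 0ℤ) (sym (stA-on-on {n} {at i i≤n} {at j j≤n} (pos-at i i≤n) (pos-at j j≤n))) (nonPos (λ e → u≢v (same e)))
    where
    same : i ≡ j → at i i≤n ≡ at j j≤n
    same refl = cong (at i) (ℕₚ.≤-irrelevant i≤n j≤n)
    nonPos : i ≢ j → pathEntry i j ℤ.≤ 0ℤ
    nonPos i≢j rewrite ≡ᵇ-false i≢j with (suc i ≡ᵇ j) ∨ (suc j ≡ᵇ i)
    ... | true  = ℤ.-≤+
    ... | false = ℤₚ.≤-refl

  zeros-symmetric : ∀ n (u v : V n) → stA n u v ≡ 0ℤ → stA n v u ≡ 0ℤ
  zeros-symmetric n u v eq with view u | view v
  ... | off y y≢x | off z z≢x = trans (stA-off-off {n} z≢x y≢x) (proj₂ (proj₂ gcm) y z (trans (sym (stA-off-off {n} y≢x z≢x)) eq))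
  ... | off y y≢x | on i i≤n = trans (stA-on-off {n} {at i i≤n} (pos-at i i≤n) y≢x)
      (if-zero (attached n i y) (proj₂ (proj₂ gcm) y x) (trans (sym (stA-off-on {n} {at i i≤n} y≢x (pos-at i i≤n))) eq))
  ... | on i i≤n | off z z≢x = trans (stA-off-on {n} {at i i≤n} z≢x (pos-at i i≤n))
      (if-zero (attached n i z) (proj₂ (proj₂ gcm) x z) (trans (sym (stA-on-off {n} {at i i≤n} (pos-at i i≤n) z≢x)) eq))
  ... | on i i≤n | on j j≤n = trans (stA-on-on {n} {at j j≤n} {at i i≤n} (pos-at j j≤n) (pos-at i i≤n))
      (trans (symmetric j i) (trans (sym (stA-on-on {n} {at i i≤n} {at j j≤n} (pos-at i i≤n) (pos-at j j≤n))) eq))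
    where
    symmetric : ∀ a b → pathEntry a b ≡ pathEntry b a
    symmetric zero          zero          = refl
    symmetric zero          (suc zero)    = refl
    symmetric zero          (suc (suc b)) = refl
    symmetric (suc zero)    zero          = refl
    symmetric (suc (suc a)) zero          = refl
    symmetric (suc a)       (suc b)       = symmetric a b

  module C (n : ℕ) = Coxeter (decV n) (enum n) (enum-unique n) (enum-complete n) (stA n) (diagonal n) (offdiagonal n) (zeros-symmetric n)


  module CΦ = Coxeter Fin._≟_ (allFin k) (Uniqueₚ.allFin⁺ k) ∈-allFin A (proj₁ gcm) (proj₁ (proj₂ gcm)) (proj₂ (proj₂ gcm))

  -- Reflections in coordinates on and off the path.

  at-injective : ∀ {n i j} {p : i ≤ n} {q : j ≤ n} → at i p ≡ at j q → i ≡ j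
  at-injective {i = i} {j} {p} {q} e = just-injective (trans (sym (pos-at i p)) (trans (cong pos e) (pos-at j q)))

  off≢at : ∀ {n y i} {p : i ≤ n} → y ≢ x → inj₁ y ≢ at i p
  off≢at {n} {y} {i} {p} y≢x e with trans (sym (pos-off {n} y≢x)) (trans (cong pos e) (pos-at i p))
  ... | ()

  pathVal-mkFun : ∀ {n} f pv i → i ≤ n → pathVal (mkFun n f pv) i ≡ pv i
  pathVal-mkFun f pv zero _ with x Fin.≟ x
  ... | yes _ = refl
  ... | no ¬p = ⊥-elim (¬p refl)
  pathVal-mkFun {n} f pv (suc i) lt = trans (pathVal-at (mkFun n f pv) (suc i) lt) (cong (λ j → pv (suc j)) (Finₚ.toℕ-fromℕ< lt))

  mkFun-off : ∀ {n} f pv {y} → y ≢ x → mkFun n f pv (inj₁ y) ≡ f y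
  mkFun-off f pv {y} y≢x with y Fin.≟ x
  ... | yes p = ⊥-elim (y≢x p)
  ... | no _  = refl

  sumL-cong : ∀ {f g : Fin k → ℤ} → (∀ y → y ≢ x → f y ≡ g y) → sumL f ≡ sumL g
  sumL-cong {f} {g} e = ∑-cong (allFin k) pointwise
    where
    pointwise : ∀ y → (if does (y Fin.≟ x) ∨ not (inL y) then 0ℤ else - (A x y ℤ.* f y)) ≡
                      (if does (y Fin.≟ x) ∨ not (inL y) then 0ℤ else - (A x y ℤ.* g y))
    pointwise y with y Fin.≟ x
    ... | yes _  = refl
    ... | no y≢x = cong (λ z → if not (inL y) then 0ℤ else - (A x y ℤ.* z)) (e y y≢x)

  sumR-cong : ∀ {f g : Fin k → ℤ} → (∀ y → y ≢ x → f y ≡ g y) → sumR f ≡ sumR g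
  sumR-cong {f} {g} e = ∑-cong (allFin k) pointwise
    where
    pointwise : ∀ y → (if does (y Fin.≟ x) ∨ inL y then 0ℤ else - (A x y ℤ.* f y)) ≡
                      (if does (y Fin.≟ x) ∨ inL y then 0ℤ else - (A x y ℤ.* g y))
    pointwise y with y Fin.≟ x
    ... | yes _  = refl
    ... | no y≢x = cong (λ z → if inL y then 0ℤ else - (A x y ℤ.* z)) (e y y≢x)

  offPair-cong : ∀ y {f g : Fin k → ℤ} {u v} → (∀ z → z ≢ x → f z ≡ g z) → u ≡ v → offPair y f u ≡ offPair y g v
  offPair-cong y {f} {g} e e' = cong₂ (λ p q → p ℤ.+ A y x ℤ.* q) (∑-cong (allFin k) pointwise) e'
    where
    pointwise : ∀ z → (if does (z Fin.≟ x) then 0ℤ else A y z ℤ.* f z) ≡ (if does (z Fin.≟ x) then 0ℤ else A y z ℤ.* g z)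
    pointwise z with z Fin.≟ x
    ... | yes _  = refl
    ... | no z≢x = cong (A y z ℤ.*_) (e z z≢x)

  newVal : ∀ {n} → (V n → ℤ) → ℕ → ℤ
  newVal g i = leftVal g i ℤ.+ rightVal g i ℤ.- pathVal g i

  newOff : ∀ {n} → (V n → ℤ) → Fin k → ℤ
  newOff {n} g y = g (inj₁ y) ℤ.- offPair y (λ z → g (inj₁ z)) (pathVal g (endOf n y))

  reflect-at : ∀ {n} (g : V n → ℤ) i (i≤n : i ≤ n) → StΦ.refl n (at i i≤n) g (at i i≤n) ≡ newVal g i
  reflect-at {n} g i i≤n = trans (C.σ-self n (at i i≤n) g)
    (trans (cong₂ ℤ._-_ (sym (pathVal-at g i i≤n)) (pair-on g i i≤n)) (lem (pathVal g i) (leftVal g i) (rightVal g i)))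
    where
    lem : ∀ p l r → p ℤ.- ((+ 2) ℤ.* p ℤ.- l ℤ.- r) ≡ l ℤ.+ r ℤ.- p
    lem = solve-∀

  reflect-off : ∀ {n} (g : V n → ℤ) {y} → y ≢ x → StΦ.refl n (inj₁ y) g (inj₁ y) ≡ newOff g y
  reflect-off {n} g {y} y≢x = trans (C.σ-self n (inj₁ y) g) (cong (λ z → g (inj₁ y) ℤ.- z) (pair-off g y y≢x))

  reflect-at-≗ : ∀ {n} (g h : V n → ℤ) i (i≤n : i ≤ n) → (∀ y → y ≢ x → h (inj₁ y) ≡ g (inj₁ y)) →
    (∀ j → j ≤ n → j ≢ i → pathVal h j ≡ pathVal g j) → pathVal h i ≡ newVal g i → StΦ.refl n (at i i≤n) g ≗ h
  reflect-at-≗ {n} g h i i≤n offs paths new = ext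
    (λ y y≢x → trans (C.σ-other n (at i i≤n) g (λ e → off≢at y≢x (sym e))) (sym (offs y y≢x)))
    on-path
    where
    on-path : ∀ j → j ≤ n → pathVal (StΦ.refl n (at i i≤n) g) j ≡ pathVal h j
    on-path j j≤n with j ℕ.≟ i
    ... | yes refl = trans (pathVal-at _ j i≤n) (trans (reflect-at g j i≤n) (sym new))
    ... | no j≢i = trans (pathVal-at _ j j≤n) (trans (C.σ-other n (at i i≤n) g (λ e → j≢i (sym (at-injective e))))
                     (trans (sym (pathVal-at g j j≤n)) (sym (paths j j≤n j≢i))))

  reflect-off-≗ : ∀ {n} (g h : V n → ℤ) {y} → y ≢ x → (∀ z → z ≢ x → z ≢ y → h (inj₁ z) ≡ g (inj₁ z)) →
    (∀ j → j ≤ n → pathVal h j ≡ pathVal g j) → h (inj₁ y) ≡ newOff g y → StΦ.refl n (inj₁ y) g ≗ h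
  reflect-off-≗ {n} g h {y} y≢x offs paths new = ext off-path
    (λ j j≤n → trans (pathVal-at _ j j≤n) (trans (C.σ-other n (inj₁ y) g (off≢at y≢x))
                 (trans (sym (pathVal-at g j j≤n)) (sym (paths j j≤n)))))
    where
    off-path : ∀ z → z ≢ x → StΦ.refl n (inj₁ y) g (inj₁ z) ≡ h (inj₁ z)
    off-path z z≢x with z Fin.≟ y
    ... | yes refl = trans (reflect-off g y≢x) (sym new)
    ... | no z≢y   = trans (C.σ-other n (inj₁ y) g (λ e → z≢y (sym (inj₁-injective e)))) (sym (offs z z≢x z≢y))

  -- The two descriptions of a reflection differ by the diagonal entry 2: omitting the vertex itself
  -- from the sum leaves twice its value minus the pairing.
  reflectAt-≗ : ∀ {n} (g : V n → ℤ) z → reflectAt g z ≗ StΦ.refl n z g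
  reflectAt-≗ {n} g z v with decV n v z
  ... | no v≢z = sym (C.σ-other n z g (λ e → v≢z (sym e)))
  ... | yes refl = trans (cong (λ s → s ℤ.- g v) others) (trans (lem (StΦ.pair n v g) (g v)) (sym (C.σ-self n v g)))
    where
    rest : ℤ
    rest = ∑ (enum n) (λ y → if does (decV n y v) then 0ℤ else - (stA n v y ℤ.* g y))
    lem : ∀ p h → ((+ 2) ℤ.* h ℤ.- p) ℤ.- h ≡ h ℤ.- p
    lem = solve-∀
    pointwise : ∀ y → only (decV n) v (λ y → stA n v y ℤ.* g y) y ≡
                stA n v y ℤ.* g y ℤ.+ (if does (decV n y v) then 0ℤ else - (stA n v y ℤ.* g y))
    pointwise y with decV n v y | decV n y v
    ... | yes _    | yes _    = sym (ℤₚ.+-identityʳ _)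
    ... | no _     | no _     = sym (ℤₚ.+-inverseʳ (stA n v y ℤ.* g y))
    ... | yes refl | no ¬q    = ⊥-elim (¬q refl)
    ... | no ¬q    | yes refl = ⊥-elim (¬q refl)
    total : (+ 2) ℤ.* g v ≡ StΦ.pair n v g ℤ.+ rest
    total = trans (cong (ℤ._* g v) (sym (diagonal n v)))
      (trans (sym (∑-only (decV n) (enum n) (λ y → stA n v y ℤ.* g y) v (enum-unique n) (enum-complete n v)))
        (trans (∑-cong (enum n) pointwise) (∑-+ (enum n) _ _)))
    others : rest ≡ (+ 2) ℤ.* g v ℤ.- StΦ.pair n v g
    others = trans (lem' (StΦ.pair n v g) rest) (cong (λ z → z ℤ.- StΦ.pair n v g) (sym total))
      where
      lem' : ∀ p r → r ≡ (p ℤ.+ r) ℤ.- p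
      lem' = solve-∀

  rightVal-inner : ∀ {n} (g : V n → ℤ) {i} → i < n → rightVal g i ≡ pathVal g (suc i)
  rightVal-inner g i<n rewrite ≡ᵇ-false (ℕₚ.<⇒≢ i<n) = refl

  rightVal-end : ∀ {n} (g : V n → ℤ) → rightVal g n ≡ sumR (λ y → g (inj₁ y))
  rightVal-end {n} g rewrite ≡ᵇ-refl n = refl

  -- Stretched roots are roots.

  threshold : ℕ → ℤ → ℤ → ℕ → ℤ
  threshold t a b i = if i <ᵇ t then a else b

  module Sweep (n : ℕ) (f : Fin k → ℤ) (b : ℤ) where

    a : ℤ
    a = sumL f

    front : ℕ → V n → ℤ
    front t = mkFun n f (threshold t a b)

    front-below : ∀ {t i} → i ≤ n → i < t → pathVal (front t) i ≡ a
    front-below {t} {i} i≤n i<t = trans (pathVal-mkFun f _ i i≤n) (cong (λ c → if c then a else b) (<ᵇ-true i<t))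

    front-above : ∀ {t i} → i ≤ n → t ≤ i → pathVal (front t) i ≡ b
    front-above {t} {i} i≤n t≤i = trans (pathVal-mkFun f _ i i≤n) (cong (λ c → if c then a else b) (<ᵇ-false t≤i))

    front-off : ∀ t {y} → y ≢ x → front t (inj₁ y) ≡ f y
    front-off t = mkFun-off {n} f (threshold t a b)

    front-left : ∀ t → t ≤ n → leftVal (front t) t ≡ a
    front-left zero    _   = sumL-cong (λ y y≢x → front-off 0 y≢x)
    front-left (suc t) t<n = front-below (ℕₚ.<⇒≤ t<n) ℕₚ.≤-refl

    -- The vertex at the front has left value `a` and right value `b`, so `b` turns into
    -- `a + b − b = a`. For `t = 0` the left value is the weighted left sum, which is why `a` is
    -- chosen to be `sumL f`.
    push : ∀ t (t<n : t < n) → StΦ.refl n (at t (ℕₚ.<⇒≤ t<n)) (front t) ≗ front (suc t)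
    push t t<n = reflect-at-≗ (front t) (front (suc t)) t (ℕₚ.<⇒≤ t<n)
      (λ y y≢x → trans (front-off (suc t) y≢x) (sym (front-off t y≢x)))
      same
      (trans (front-below (ℕₚ.<⇒≤ t<n) ℕₚ.≤-refl) (trans (lem a b) (sym (cong₂ ℤ._-_
        (cong₂ ℤ._+_ (front-left t (ℕₚ.<⇒≤ t<n)) (trans (rightVal-inner (front t) t<n) (front-above t<n (ℕₚ.n≤1+n t))))
        (front-above (ℕₚ.<⇒≤ t<n) ℕₚ.≤-refl)))))
      where
      lem : ∀ a b → a ≡ a ℤ.+ b ℤ.- b
      lem = solve-∀
      same : ∀ j → j ≤ n → j ≢ t → pathVal (front (suc t)) j ≡ pathVal (front t) j
      same j j≤n j≢t with ℕₚ.<-cmp j t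
      ... | tri< j<t _ _ = trans (front-below j≤n (ℕₚ.m≤n⇒m≤1+n j<t)) (sym (front-below j≤n j<t))
      ... | tri≈ _ j≡t _ = ⊥-elim (j≢t j≡t)
      ... | tri> _ _ t<j = trans (front-above j≤n t<j) (sym (front-above j≤n (ℕₚ.<⇒≤ t<j)))

    up : ∀ t → t ≤ n → StΦ.IsRoot n (front 0) → StΦ.IsRoot n (front t)
    up zero    _   r = r
    up (suc t) t<n r = C.IsRoot-resp n (push t t<n) (C.IsRoot-word n (at t (ℕₚ.<⇒≤ t<n) ∷ []) (up t (ℕₚ.<⇒≤ t<n) r))

    down : ∀ t → t ≤ n → StΦ.IsRoot n (front t) → StΦ.IsRoot n (front 0)
    down zero    _   r = r
    down (suc t) t<n r = down t (ℕₚ.<⇒≤ t<n) (C.IsRoot-resp n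
      (λ v → trans (C.σ-cong n z (λ w → sym (push t t<n w)) v) (C.σ-involutive n z (front t) v))
      (C.IsRoot-word n (z ∷ []) r))
      where
      z = at t (ℕₚ.<⇒≤ t<n)

  pathVal-stRoot : ∀ n f i → i ≤ n → pathVal (stRoot n f) i ≡ f x
  pathVal-stRoot n f zero    _  = refl
  pathVal-stRoot n f (suc i) lt = pathVal-at (stRoot n f) (suc i) lt

  stRoot-front : ∀ n f → stRoot n f ≗ Sweep.front n f (f x) 0
  stRoot-front n f = ext (λ y y≢x → sym (Sweep.front-off n f (f x) 0 y≢x))
    (λ i i≤n → trans (pathVal-stRoot n f i i≤n) (sym (Sweep.front-above n f (f x) {0} i≤n z≤n)))

  Φ-pair-off : ∀ y f → Φ.pair y f ≡ offPair y f (f x)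
  Φ-pair-off y f = trans (∑-cong (allFin k) pointwise) (trans (∑-+ (allFin k) _ _)
    (trans (cong (λ z → z ℤ.+ ∑ (allFin k) (λ z → if does (z Fin.≟ x) then 0ℤ else A y z ℤ.* f z)) (∑-allFin-only k (λ _ → A y x ℤ.* f x) x)) (ℤₚ.+-comm (A y x ℤ.* f x) _)))
    where
    pointwise : ∀ z → A y z ℤ.* f z ≡ only Fin._≟_ x (λ _ → A y x ℤ.* f x) z ℤ.+ (if does (z Fin.≟ x) then 0ℤ else A y z ℤ.* f z)
    pointwise z with z Fin.≟ x | x Fin.≟ z
    ... | yes refl | no ¬q    = ⊥-elim (¬q refl)
    ... | no ¬q    | yes refl = ⊥-elim (¬q refl)
    ... | yes refl | yes _    = sym (ℤₚ.+-identityʳ _)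
    ... | no _     | no _     = sym (ℤₚ.+-identityˡ _)

  Φ-pair-x : ∀ f → Φ.pair x f ≡ (+ 2) ℤ.* f x ℤ.- sumL f ℤ.- sumR f
  Φ-pair-x f = trans (∑-cong (allFin k) pointwise) (trans (∑-+ (allFin k) _ _)
    (trans (cong₂ ℤ._+_ (trans (∑-+ (allFin k) _ _) (cong₂ ℤ._+_ (∑-allFin-only k (λ _ → (+ 2) ℤ.* f x) x) (∑-* (allFin k) ℤ.-1ℤ _))) (∑-* (allFin k) ℤ.-1ℤ _))
      (lem ((+ 2) ℤ.* f x) (sumL f) (sumR f))))
    where
    lem : ∀ p l r → (p ℤ.+ ℤ.-1ℤ ℤ.* l) ℤ.+ ℤ.-1ℤ ℤ.* r ≡ p ℤ.- l ℤ.- r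
    lem = solve-∀
    lem₁ : ∀ p → p ≡ 0ℤ ℤ.+ ℤ.-1ℤ ℤ.* (- p) ℤ.+ 0ℤ
    lem₁ = solve-∀
    lem₂ : ∀ p → p ≡ 0ℤ ℤ.+ 0ℤ ℤ.+ ℤ.-1ℤ ℤ.* (- p)
    lem₂ = solve-∀
    pointwise : ∀ y → A x y ℤ.* f y ≡
      (only Fin._≟_ x (λ _ → (+ 2) ℤ.* f x) y ℤ.+ ℤ.-1ℤ ℤ.* (if does (y Fin.≟ x) ∨ not (inL y) then 0ℤ else - (A x y ℤ.* f y)))
        ℤ.+ ℤ.-1ℤ ℤ.* (if does (y Fin.≟ x) ∨ inL y then 0ℤ else - (A x y ℤ.* f y))
    pointwise y with y Fin.≟ x | x Fin.≟ y
    ... | yes refl | no ¬q    = ⊥-elim (¬q refl)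
    ... | no ¬q    | yes refl = ⊥-elim (¬q refl)
    ... | yes refl | yes _    = trans (cong (ℤ._* f y) (proj₁ gcm y)) (sym (trans (ℤₚ.+-identityʳ _) (ℤₚ.+-identityʳ _)))
    ... | no _     | no _ with inL y
    ...   | true  = lem₁ (A x y ℤ.* f y)
    ...   | false = lem₂ (A x y ℤ.* f y)

  -- The reflection in α_{x_0} + … + α_{x_n} carries out s_x on stretched roots; it is performed
  -- by sweeping along the path to x_n, reflecting there, and sweeping back.
  stRoot-reflect : ∀ n i f → StΦ.IsRoot n (stRoot n f) → StΦ.IsRoot n (stRoot n (Φ.refl i f))
  stRoot-reflect n i f r with i Fin.≟ x
  ... | no i≢x = C.IsRoot-resp n (reflect-off-≗ (stRoot n f) (stRoot n (Φ.refl i f)) i≢x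
      (λ z z≢x z≢i → CΦ.σ-other i f (λ e → z≢i (sym e)))
      (λ j j≤n → trans (pathVal-stRoot n (Φ.refl i f) j j≤n) (trans (CΦ.σ-other i f i≢x) (sym (pathVal-stRoot n f j j≤n))))
      (trans (CΦ.σ-self i f) (cong (λ z → f i ℤ.- z) (trans (Φ-pair-off i f)
        (cong (offPair i f) (sym (pathVal-stRoot n f (endOf n i) end≤n)))))))
      (C.IsRoot-word n (inj₁ i ∷ []) r)
    where
    end≤n : endOf n i ≤ n
    end≤n with inL i
    ... | true  = z≤n
    ... | false = ℕₚ.≤-refl
  ... | yes refl = C.IsRoot-resp n (λ v → sym (trans (stRoot-front n (Φ.refl i f) v) (fronts v)))
      (Back.down n ℕₚ.≤-refl (C.IsRoot-resp n turn (C.IsRoot-word n (at n ℕₚ.≤-refl ∷ [])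
        (There.up n ℕₚ.≤-refl (C.IsRoot-resp n (stRoot-front n f) r)))))
    where
    b' : ℤ
    b' = Φ.refl x f x
    module There = Sweep n f (f x)
    module Back = Sweep n f b'
    fronts : Sweep.front n (Φ.refl x f) b' 0 ≗ Back.front 0
    fronts = ext (λ y y≢x → trans (Sweep.front-off n (Φ.refl x f) b' 0 y≢x) (trans (CΦ.σ-other x f (λ e → y≢x (sym e))) (sym (Back.front-off 0 y≢x))))
      (λ j j≤n → trans (Sweep.front-above n (Φ.refl x f) b' {0} j≤n z≤n) (sym (Back.front-above {0} j≤n z≤n)))
    b'≡ : b' ≡ sumL f ℤ.+ sumR f ℤ.- f x
    b'≡ = trans (CΦ.σ-self x f) (trans (cong (λ z → f x ℤ.- z) (Φ-pair-x f)) (lem (f x) (sumL f) (sumR f)))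
      where
      lem : ∀ v l r → v ℤ.- ((+ 2) ℤ.* v ℤ.- l ℤ.- r) ≡ l ℤ.+ r ℤ.- v
      lem = solve-∀
    -- At `x_n` the neighbours contribute `sumL f` and `sumR f`, so the new value is the
    -- `x`-coordinate of `s_x f`; sweeping back spreads it over the whole path.
    turn : StΦ.refl n (at n ℕₚ.≤-refl) (There.front n) ≗ Back.front n
    turn = reflect-at-≗ (There.front n) (Back.front n) n ℕₚ.≤-refl
      (λ y y≢x → trans (Back.front-off n y≢x) (sym (There.front-off n y≢x)))
      (λ j j≤n j≢n → trans (Back.front-below j≤n (ℕₚ.≤∧≢⇒< j≤n j≢n)) (sym (There.front-below j≤n (ℕₚ.≤∧≢⇒< j≤n j≢n))))
      (trans (Back.front-above ℕₚ.≤-refl ℕₚ.≤-refl) (trans b'≡ (sym (cong₂ ℤ._-_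
        (cong₂ ℤ._+_ (There.front-left n ℕₚ.≤-refl)
          (trans (rightVal-end (There.front n)) (sumR-cong (λ y y≢x → There.front-off n y≢x))))
        (There.front-above ℕₚ.≤-refl ℕₚ.≤-refl)))))

  stRoot-simple : ∀ n y → StΦ.IsRoot n (stRoot n (Φ.simple y))
  stRoot-simple n y with y Fin.≟ x
  ... | no y≢x = 0 , inj₁ y , [] , refl , ext
      (λ z z≢x → on-G z (z Fin.≟ y))
      (λ j j≤n → trans (pathVal-at _ j j≤n) (trans (C.simple-other n (off≢at {n} {i = j} {j≤n} y≢x)) (sym (trans (pathVal-stRoot n (Φ.simple y) j j≤n) (CΦ.simple-other y≢x)))))
    where
    on-G : ∀ z → Dec (z ≡ y) → StΦ.simple n (inj₁ y) (inj₁ z) ≡ Φ.simple y z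
    on-G z (yes refl) = trans (C.simple-self n (inj₁ z)) (sym (CΦ.simple-self z))
    on-G z (no z≢y)   = trans (C.simple-other n (λ e → z≢y (sym (inj₁-injective e)))) (sym (CΦ.simple-other (λ e → z≢y (sym e))))
  ... | yes refl = C.IsRoot-resp n (λ v → sym (fronts v)) (S.down n ℕₚ.≤-refl
      (0 , at n ℕₚ.≤-refl , [] , refl , end))
    where
    -- With `f = 0` the swept value `a` is 0: `front n` is the simple root at `x_n`, and `front 0`
    -- is 1 along the whole path, the stretch of `α_x`.
    f : Fin k → ℤ
    f _ = 0ℤ
    module S = Sweep n f 1ℤ
    a≡0 : S.a ≡ 0ℤ
    a≡0 = trans (∑-cong (allFin k) (λ y → pointwise y (does (y Fin.≟ x) ∨ not (inL y)))) (∑-0 (allFin k))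
      where
      pointwise : ∀ y (c : Bool) → (if c then 0ℤ else - (A x y ℤ.* 0ℤ)) ≡ 0ℤ
      pointwise y true  = refl
      pointwise y false = cong -_ (ℤₚ.*-zeroʳ (A x y))
    fronts : stRoot n (Φ.simple y) ≗ S.front 0
    fronts = ext (λ z z≢x → trans (CΦ.simple-other (λ e → z≢x (sym e))) (sym (S.front-off 0 z≢x)))
      (λ j j≤n → trans (pathVal-stRoot n (Φ.simple y) j j≤n) (trans (CΦ.simple-self y) (sym (S.front-above {0} j≤n z≤n))))
    end : StΦ.simple n (at n ℕₚ.≤-refl) ≗ S.front n
    end = ext (λ z z≢x → trans (C.simple-other n (λ e → off≢at {n} {i = n} {ℕₚ.≤-refl} z≢x (sym e))) (sym (S.front-off n z≢x))) on-path
      where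
      on-path : ∀ j → j ≤ n → pathVal (StΦ.simple n (at n ℕₚ.≤-refl)) j ≡ pathVal (S.front n) j
      on-path j j≤n with j ℕ.≟ n
      ... | yes refl = trans (pathVal-at _ j ℕₚ.≤-refl) (trans (C.simple-self n (at j ℕₚ.≤-refl)) (sym (S.front-above ℕₚ.≤-refl ℕₚ.≤-refl)))
      ... | no j≢n = trans (pathVal-at _ j j≤n) (trans (C.simple-other n (λ e → j≢n (sym (at-injective e))))
                      (sym (trans (S.front-below j≤n (ℕₚ.≤∧≢⇒< j≤n j≢n)) a≡0)))

  stRoot-isRoot : ∀ n {α} → Φ.IsRoot α → StΦ.IsRoot n (stRoot n α)
  stRoot-isRoot n (ℓ , y , w , len , eq) = C.IsRoot-resp n (λ v → eq (orig v)) (words w)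
    where
    words : ∀ w → StΦ.IsRoot n (stRoot n (Φ.applyWord w (Φ.simple y)))
    words []      = stRoot-simple n y
    words (i ∷ w) = stRoot-reflect n i (Φ.applyWord w (Φ.simple y)) (words w)

  -- Elements of a class by index maps.

  record Elt (c : Marked) (n : ℕ) (g : V n → ℤ) : Set where
    constructor elt
    field
      φ    : ℕ → ℕ
      fold : Fold (p c) (q c) (m c) n φ
      offs : ∀ y → y ≢ x → g (inj₁ y) ≡ b c (inj₁ y)
      vals : ∀ i → i ≤ n → pathVal g i ≡ pathVal (b c) (φ i)

  pathList-range : ∀ {n} (g : V n → ℤ) → pathList g ≡ map (pathVal g) (range 0 (suc n))
  pathList-range {n} g = cong (map (pathVal g)) (upTo-range (suc n))

  module _ (c : Marked) where
    private
      B : ℕ → ℤ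
      B = pathVal (b c)
      r t : ℕ
      r = q c ∸ p c
      t = m c ∸ q c
      p+r : p c ℕ.+ r ≡ q c
      p+r = ℕₚ.m+[n∸m]≡n (p≤q c)
      q+t : q c ℕ.+ t ≡ m c
      q+t = ℕₚ.m+[n∸m]≡n (q≤m c)
      len : suc (m c) ≡ p c ℕ.+ (suc r ℕ.+ t)
      len = trans (cong suc (trans (sym q+t) (trans (cong (ℕ._+ t) (sym p+r)) (ℕₚ.+-assoc (p c) r t)))) (sym (ℕₚ.+-suc (p c) (r ℕ.+ t)))

    -- Moves the run lengths from values to indices: the list prescribed by `InClass` is the image
    -- of a list of path positions, and that list is a walk.
    class-list : ∀ cs → take (p c) (pathList (b c)) ++ runs cs (take (suc r) (drop (p c) (pathList (b c)))) ++ drop (suc (q c)) (pathList (b c))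
      ≡ map B (range 0 (p c) ++ runs cs (range (p c) (suc r)) ++ range (suc (q c)) t)
    class-list cs = begin
      take (p c) (pathList (b c)) ++ runs cs (take (suc r) (drop (p c) (pathList (b c)))) ++ drop (suc (q c)) (pathList (b c))
        ≡⟨ cong (λ L → take (p c) L ++ runs cs (take (suc r) (drop (p c) L)) ++ drop (suc (q c)) L) (pathList-range (b c)) ⟩
      take (p c) L ++ runs cs (take (suc r) (drop (p c) L)) ++ drop (suc (q c)) L
        ≡⟨ cong₂ _++_ first (cong₂ _++_ (cong (runs cs) middle) last) ⟩
      map B (range 0 (p c)) ++ runs cs (map B (range (p c) (suc r))) ++ map B (range (suc (q c)) t)
        ≡⟨ cong (λ M → map B (range 0 (p c)) ++ M ++ map B (range (suc (q c)) t)) (sym (map-runs B cs (range (p c) (suc r)))) ⟩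
      map B (range 0 (p c)) ++ map B (runs cs (range (p c) (suc r))) ++ map B (range (suc (q c)) t)
        ≡⟨ cong (map B (range 0 (p c)) ++_) (sym (map-++ B (runs cs (range (p c) (suc r))) _)) ⟩
      map B (range 0 (p c)) ++ map B (runs cs (range (p c) (suc r)) ++ range (suc (q c)) t)
        ≡⟨ sym (map-++ B (range 0 (p c)) _) ⟩
      map B (range 0 (p c) ++ runs cs (range (p c) (suc r)) ++ range (suc (q c)) t) ∎
      where
      open ≡-Reasoning
      L : List ℤ
      L = map B (range 0 (suc (m c)))
      first : take (p c) L ≡ map B (range 0 (p c))
      first = trans (take-map {f = B} (p c) (range 0 (suc (m c)))) (cong (map B)
        (trans (cong (λ l → take (p c) (range 0 l)) len) (take-range 0 (p c) (suc r ℕ.+ t))))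
      dropped : drop (p c) L ≡ map B (range (p c) (suc r ℕ.+ t))
      dropped = trans (drop-map {f = B} (p c) (range 0 (suc (m c)))) (cong (map B)
        (trans (cong (λ l → drop (p c) (range 0 l)) len) (trans (drop-range 0 (p c) (suc r ℕ.+ t))
          (cong (λ a → range a (suc r ℕ.+ t)) (ℕₚ.+-identityʳ (p c))))))
      middle : take (suc r) (drop (p c) L) ≡ map B (range (p c) (suc r))
      middle = trans (cong (take (suc r)) dropped) (trans (take-map {f = B} (suc r) (range (p c) (suc r ℕ.+ t)))
        (cong (map B) (take-range (p c) (suc r) t)))
      last : drop (suc (q c)) L ≡ map B (range (suc (q c)) t)
      last = trans (drop-map {f = B} (suc (q c)) (range 0 (suc (m c)))) (cong (map B)
        (trans (cong (λ l → drop (suc (q c)) (range 0 (suc l))) (sym q+t)) (trans (drop-range 0 (suc (q c)) t)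
          (cong (λ a → range a t) (ℕₚ.+-identityʳ (suc (q c)))))))

    -- The index map is read off the run lengths, not off the values of `g`.
    InClass⇒Elt : ∀ {n g} → InClass c n g → Elt c n g
    InClass⇒Elt {n} {g} (offs , cs , ps , lcs , eq) = elt (nth 0 xs) (walk⇒fold walk lxs) offs vals
      where
      xs : List ℕ
      xs = range 0 (p c) ++ runs cs (range (p c) (suc r)) ++ range (suc (q c)) t
      walk : Walk (p c) (q c) 0 (m c) xs
      walk = walk-prefix (p c) 0 (subst₂ (λ a z → Walk (p c) (q c) a z (runs cs (range (p c) (suc r)) ++ range (suc (q c)) t))
        (sym (ℕₚ.+-identityʳ (p c))) q+t (walk-runs cs (p c) r t ps lcs ℕₚ.≤-refl p+r))
      same : map (pathVal g) (range 0 (suc n)) ≡ map B xs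
      same = trans (sym (pathList-range g)) (trans eq (class-list cs))
      lxs : length xs ≡ suc n
      lxs = trans (sym (length-map B xs)) (trans (cong length (sym same)) (trans (length-map (pathVal g) (range 0 (suc n))) (length-range 0 (suc n))))
      vals : ∀ i → i ≤ n → pathVal g i ≡ B (nth 0 xs i)
      vals i i≤n = begin
        pathVal g i                                        ≡⟨ cong (pathVal g) (sym (nth-range 0 (suc n) i (s≤s i≤n))) ⟩
        pathVal g (nth 0 (range 0 (suc n)) i)
          ≡⟨ sym (nth-map (pathVal g) 0 0ℤ (range 0 (suc n)) i (subst (i <_) (sym (length-range 0 (suc n))) (s≤s i≤n))) ⟩
        nth 0ℤ (map (pathVal g) (range 0 (suc n))) i       ≡⟨ cong (λ l → nth 0ℤ l i) same ⟩
        nth 0ℤ (map B xs) i                                ≡⟨ nth-map B 0 0ℤ xs i (subst (i <_) (sym lxs) (s≤s i≤n)) ⟩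
        B (nth 0 xs i) ∎
        where open ≡-Reasoning

    Elt⇒InClass : ∀ {n g} → Elt c n g → InClass c n g
    Elt⇒InClass {n} {g} (elt φ fold offs vals)
      with walk-split (p c) r (fold⇒walk fold) (ℕₚ.+-identityʳ (p c)) p+r (q≤m c)
    ... | cs , ps , lcs , t' , z≡ , xs≡ = offs , cs , ps , lcs , (begin
        pathList g                                   ≡⟨ pathList-range g ⟩
        map (pathVal g) (range 0 (suc n))            ≡⟨ map-range-cong 0 (suc n) (λ i _ i< → vals i (ℕₚ.≤-pred i<)) ⟩
        map (λ i → B (φ i)) (range 0 (suc n))        ≡⟨ map-∘ (range 0 (suc n)) ⟩
        map B (map φ (range 0 (suc n)))              ≡⟨ cong (map B) xs≡ ⟩
        map B (range 0 (p c) ++ runs cs (range (p c) (suc r)) ++ range (suc (q c)) t')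
          ≡⟨ cong (λ l → map B (range 0 (p c) ++ runs cs (range (p c) (suc r)) ++ range (suc (q c)) l)) t'≡t ⟩
        map B (range 0 (p c) ++ runs cs (range (p c) (suc r)) ++ range (suc (q c)) t) ≡⟨ sym (class-list cs) ⟩
        take (p c) (pathList (b c)) ++ runs cs (take (suc r) (drop (p c) (pathList (b c)))) ++ drop (suc (q c)) (pathList (b c)) ∎)
      where
      open ≡-Reasoning
      t'≡t : t' ≡ t
      t'≡t = ℕₚ.+-cancelˡ-≡ (q c) t' t (trans (sym z≡) (sym q+t))

  insertAt-< : ∀ r v (pv : ℕ → ℤ) {i} → i < r → insertAt r v pv i ≡ pv i
  insertAt-< r v pv i<r rewrite <ᵇ-true i<r = refl

  insertAt-≡ : ∀ r v (pv : ℕ → ℤ) → insertAt r v pv r ≡ v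
  insertAt-≡ r v pv rewrite <ᵇ-false {r} {r} ℕₚ.≤-refl | ≡ᵇ-refl r = refl

  insertAt-> : ∀ r v (pv : ℕ → ℤ) {i} → r ≤ i → insertAt r v pv (suc i) ≡ pv i
  insertAt-> r v pv {i} r≤i rewrite <ᵇ-false {suc i} {r} (ℕₚ.m≤n⇒m≤1+n r≤i) | ≡ᵇ-false {suc i} {r} (λ e → ℕₚ.<⇒≢ (s≤s r≤i) (sym e)) = refl

  reflectAt-at-off : ∀ {n} (g : V n → ℤ) {i} (i≤n : i ≤ n) {y} → y ≢ x → reflectAt g (at i i≤n) (inj₁ y) ≡ g (inj₁ y)
  reflectAt-at-off {n} g {i} i≤n {y} y≢x = trans (reflectAt-≗ g (at i i≤n) (inj₁ y)) (C.σ-other n (at i i≤n) g (λ e → off≢at {n} {i = i} {i≤n} y≢x (sym e)))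

  reflectAt-at-self : ∀ {n} (g : V n → ℤ) {i} (i≤n : i ≤ n) → reflectAt g (at i i≤n) (at i i≤n) ≡ newVal g i
  reflectAt-at-self g {i} i≤n = trans (reflectAt-≗ g _ _) (reflect-at g i i≤n)

  reflectAt-at-new : ∀ {n} (g : V n → ℤ) {i} (i≤n : i ≤ n) → pathVal (reflectAt g (at i i≤n)) i ≡ newVal g i
  reflectAt-at-new g {i} i≤n = trans (pathVal-at _ i i≤n) (reflectAt-at-self g i≤n)

  reflectAt-at-other : ∀ {n} (g : V n → ℤ) {i} (i≤n : i ≤ n) {j} → j ≤ n → j ≢ i → pathVal (reflectAt g (at i i≤n)) j ≡ pathVal g j
  reflectAt-at-other {n} g i≤n {j} j≤n j≢i = trans (pathVal-at _ j j≤n)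
    (trans (reflectAt-≗ g _ _) (trans (C.σ-other n _ g (λ e → j≢i (sym (at-injective e)))) (sym (pathVal-at g j j≤n))))

  reflectAt-off-self : ∀ {n} (g : V n → ℤ) {y} → y ≢ x → reflectAt g (inj₁ y) (inj₁ y) ≡ newOff g y
  reflectAt-off-self {n} g y≢x = trans (reflectAt-≗ g _ _) (reflect-off g y≢x)

  reflectAt-off-other : ∀ {n} (g : V n → ℤ) {y z} → z ≢ y → reflectAt g (inj₁ y) (inj₁ z) ≡ g (inj₁ z)
  reflectAt-off-other {n} g z≢y = trans (reflectAt-≗ g _ _) (C.σ-other n _ g (λ e → z≢y (sym (inj₁-injective e))))

  reflectAt-off-path : ∀ {n} (g : V n → ℤ) {y} → y ≢ x → ∀ {j} → j ≤ n → pathVal (reflectAt g (inj₁ y)) j ≡ pathVal g j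
  reflectAt-off-path {n} g y≢x {j} j≤n = trans (pathVal-at _ j j≤n)
    (trans (reflectAt-≗ g _ _) (trans (C.σ-other n _ g (off≢at y≢x)) (sym (pathVal-at g j j≤n))))

  reflectAt-nonNeg : ∀ {n} (g : V n → ℤ) z → (∀ v → 0ℤ ℤ.≤ g v) → 0ℤ ℤ.≤ reflectAt g z z → ∀ v → 0ℤ ℤ.≤ reflectAt g z v
  reflectAt-nonNeg {n} g z pos new v with decV n v z
  ... | no _ = pos v
  ... | yes refl with decV n v v
  ...   | yes _ = new
  ...   | no ¬p = ⊥-elim (¬p refl)

  pathVal-nonNeg : ∀ {n} (g : V n → ℤ) → (∀ v → 0ℤ ℤ.≤ g v) → ∀ i → 0ℤ ℤ.≤ pathVal g i
  pathVal-nonNeg g pos zero = pos (inj₁ x)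
  pathVal-nonNeg {n} g pos (suc i) with i ℕ.<? n
  ... | yes _ = pos _
  ... | no _  = ℤₚ.≤-refl

  mkFun-nonNeg : ∀ {n} f pv → (∀ y → 0ℤ ℤ.≤ f y) → (∀ i → i ≤ n → 0ℤ ℤ.≤ pv i) → ∀ v → 0ℤ ℤ.≤ mkFun n f pv v
  mkFun-nonNeg {n} f pv pf pp v with view v
  ... | off y y≢x = subst (0ℤ ℤ.≤_) (sym (mkFun-off {n} f pv y≢x)) (pf y)
  ... | on i i≤n  = subst (0ℤ ℤ.≤_) (sym (trans (sym (pathVal-at _ i i≤n)) (pathVal-mkFun f pv i i≤n))) (pp i i≤n)

  insertAt-nonNeg : ∀ r v (pv : ℕ → ℤ) → 0ℤ ℤ.≤ v → (∀ i → 0ℤ ℤ.≤ pv i) → ∀ i → 0ℤ ℤ.≤ insertAt r v pv i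
  insertAt-nonNeg r v pv pv≥0 pos i with i <ᵇ r
  ... | true = pos i
  ... | false with i ≡ᵇ r
  ...   | true  = pv≥0
  ...   | false = pos (i ∸ 1)

  SL-leftVal : ∀ c → SL c ≡ leftVal (b c) (p c)
  SL-leftVal c with p c
  ... | zero  = refl
  ... | suc _ = refl

  Elt-resp : ∀ {c n g h} → g ≗ h → Elt c n g → Elt c n h
  Elt-resp e (elt φ F offs vals) = elt φ F (λ y y≢x → trans (sym (e (inj₁ y))) (offs y y≢x))
    (λ i i≤n → trans (sym (pathVal-cong e i)) (vals i i≤n))

  -- The left neighbour of a position that begins a run lies over the left neighbour of its index;
  -- at position 0 both are `L_x`. With `fresh-right`, reflecting at a value that occurs once
  -- commutes with passing to the class.
  fresh-left : ∀ {m n p q} (f : V m → ℤ) (g : V n → ℤ) {φ} → Fold p q m n φ → (∀ y → y ≢ x → g (inj₁ y) ≡ f (inj₁ y)) →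
    (∀ i → i ≤ n → pathVal g i ≡ pathVal f (φ i)) → ∀ i → i ≤ n → FreshL φ i → leftVal g i ≡ leftVal f (φ i)
  fresh-left f g F offs vals zero    _   fl rewrite starts F = sumL-cong offs
  fresh-left f g F offs vals (suc i) i<n fl rewrite fl i refl = vals i (ℕₚ.<⇒≤ i<n)

  fresh-right : ∀ {m n p q} (f : V m → ℤ) (g : V n → ℤ) {φ} → Fold p q m n φ → (∀ y → y ≢ x → g (inj₁ y) ≡ f (inj₁ y)) →
    (∀ i → i ≤ n → pathVal g i ≡ pathVal f (φ i)) → ∀ i → i ≤ n → FreshR φ n i → rightVal g i ≡ rightVal f (φ i)
  fresh-right {m} {n} f g {φ} F offs vals i i≤n fr with i ℕ.≟ n
  ... | yes refl = trans (rightVal-end g) (trans (sumR-cong offs) (trans (sym (rightVal-end f)) (cong (rightVal f) (sym (ends F)))))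
  ... | no i≢n = trans (rightVal-inner g i<n) (trans (vals (suc i) i<n) (trans (cong (pathVal f) (fr i<n)) (sym (rightVal-inner f φi<m))))
    where
    i<n = ℕₚ.≤∧≢⇒< i≤n i≢n
    φi<m : φ i < m
    φi<m = subst (_≤ m) (fr i<n) (FoldLemmas.φ≤m F i<n)

  endOf-fold : ∀ {p q m n φ} → Fold p q m n φ → ∀ y → φ (endOf n y) ≡ endOf m y
  endOf-fold F y with inL y
  ... | true  = starts F
  ... | false = ends F

  endOf≤ : ∀ n y → endOf n y ≤ n
  endOf≤ n y with inL y
  ... | true  = z≤n
  ... | false = ℕₚ.≤-refl

  -- A vertex off the path sees the path only at its ends, and an index map preserves both.
  newOff-fold : ∀ {m n p q} (f : V m → ℤ) (g : V n → ℤ) {φ} → Fold p q m n φ → (∀ y → y ≢ x → g (inj₁ y) ≡ f (inj₁ y)) →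
    (∀ i → i ≤ n → pathVal g i ≡ pathVal f (φ i)) → ∀ y → y ≢ x → newOff g y ≡ newOff f y
  newOff-fold {m} {n} f g F offs vals y y≢x = cong₂ ℤ._-_ (offs y y≢x)
    (offPair-cong y offs (trans (vals (endOf n y) (endOf≤ n y)) (cong (pathVal f) (endOf-fold F y))))

-- Descent from an element of a class

module Descending {k : ℕ} (A : Fin k → Fin k → ℤ) (gcm : IsGCM A) (x : Fin k) (inL : Fin k → Bool)
  (α : Fin k → ℤ) (α≥0 : ∀ y → 0ℤ ℤ.≤ α y) where
  open Stretch A x inL
  open Stretched A gcm x inL

  InP⇒NonNeg : ∀ {c} → InP α c → NonNeg c
  InP⇒NonNeg base          = λ v → α≥0 (orig v)
  InP⇒NonNeg (step _ _ nn) = nn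

  unmarked-off : ∀ c {y} → y ≢ x → ¬ IsMarkedV c (inj₁ y)
  unmarked-off c y≢x (j , e , _) with trans (sym (pos-off {Marked.m c} y≢x)) e
  ... | ()

  unmarked-at : ∀ c {j} (j≤m : j ≤ m c) → ¬ (p c ≤ j × j ≤ q c) → ¬ IsMarkedV c (at j j≤m)
  unmarked-at c {j} j≤m ¬marked (j' , e , r) with just-injective (trans (sym (pos-at j j≤m)) e)
  ... | refl = ¬marked r

  Descends : ∀ n → (V n → ℤ) → Set
  Descends n h = Σ Marked λ c → InP α c × Elt c n h

  descend-off : ∀ {c n g} → InP α c → Elt c n g → ∀ {y} → y ≢ x → (∀ v → 0ℤ ℤ.≤ reflectAt g (inj₁ y) v) →
    reflectAt g (inj₁ y) (inj₁ y) ℤ.< g (inj₁ y) → Descends n (reflectAt g (inj₁ y))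
  descend-off {c} {n} {g} inP (elt φ F offs vals) {y} y≢x nonneg lower =
    withB c (reflectAt (b c) z') ,
    step inP (op1 c z' (unmarked-off c y≢x) (subst₂ ℤ._<_ same (offs y y≢x) lower))
      (reflectAt-nonNeg (b c) z' (InP⇒NonNeg inP) (subst (0ℤ ℤ.≤_) same (nonneg (inj₁ y)))) ,
    elt φ F offs' (λ i i≤n → trans (reflectAt-off-path g y≢x i≤n) (trans (vals i i≤n)
      (sym (reflectAt-off-path (b c) y≢x (FoldLemmas.φ≤m F i≤n)))))
    where
    z' : V (m c)
    z' = inj₁ y
    same : reflectAt g (inj₁ y) (inj₁ y) ≡ reflectAt (b c) z' z'
    same = trans (reflectAt-off-self g y≢x) (trans (newOff-fold (b c) g F offs vals y y≢x) (sym (reflectAt-off-self (b c) y≢x)))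
    offs' : ∀ z → z ≢ x → reflectAt g (inj₁ y) (inj₁ z) ≡ reflectAt (b c) z' (inj₁ z)
    offs' z z≢x = cases (z Fin.≟ y)
      where
      cases : Dec (z ≡ y) → reflectAt g (inj₁ y) (inj₁ z) ≡ reflectAt (b c) z' (inj₁ z)
      cases (yes refl) = same
      cases (no z≢y)   = trans (reflectAt-off-other g z≢y) (trans (offs z z≢x) (sym (reflectAt-off-other (b c) z≢y)))

  module _ {c : Marked} {n : ℕ} {g : V n → ℤ} (inP : InP α c) (φ : ℕ → ℕ) (F : Fold (p c) (q c) (m c) n φ)
    (offs : ∀ y → y ≢ x → g (inj₁ y) ≡ b c (inj₁ y)) (vals : ∀ i → i ≤ n → pathVal g i ≡ pathVal (b c) (φ i))
    (i : ℕ) (i≤n : i ≤ n) (nonneg : ∀ v → 0ℤ ℤ.≤ reflectAt g (at i i≤n) v)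
    (lower : newVal g i ℤ.< pathVal g i) where
    open FoldLemmas F

    private
      j : ℕ
      j = φ i
      j≤m : j ≤ m c
      j≤m = φ≤m i≤n
      z : V n
      z = at i i≤n
      z' : V (m c)
      z' = at j j≤m
      h : V n → ℤ
      h = reflectAt g z
      new≥0 : 0ℤ ℤ.≤ newVal g i
      new≥0 = subst (0ℤ ℤ.≤_) (reflectAt-at-self g i≤n) (nonneg z)

    -- The place of `j` relative to `p` and `q` selects the operation: 1 outside the marks, 2
    -- strictly inside, 4 at an end of a longer segment. Dropping a mark keeps the index map
    -- admissible because the value occurs once.
    descend-both-fresh : (p c ≡ q c → m c < n) → FreshL φ i → FreshR φ n i → Descends n h
    descend-both-fresh single fl fr = region
      where
      u : Unique-at φ n i
      u = fresh⇒unique fl fr i≤n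
      same : newVal g i ≡ newVal (b c) j
      same = cong₂ ℤ._-_ (cong₂ ℤ._+_ (fresh-left (b c) g F offs vals i i≤n fl) (fresh-right (b c) g F offs vals i i≤n fr)) (vals i i≤n)
      self : reflectAt (b c) z' z' ≡ newVal g i
      self = trans (reflectAt-at-self (b c) j≤m) (sym same)
      lower' : reflectAt (b c) z' z' ℤ.< b c z'
      lower' = subst₂ ℤ._<_ (sym self) (trans (vals i i≤n) (pathVal-at (b c) j j≤m)) lower
      nonneg' : ∀ v → 0ℤ ℤ.≤ reflectAt (b c) z' v
      nonneg' = reflectAt-nonNeg (b c) z' (InP⇒NonNeg inP) (subst (0ℤ ℤ.≤_) (sym self) new≥0)
      offs' : ∀ y → y ≢ x → h (inj₁ y) ≡ reflectAt (b c) z' (inj₁ y)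
      offs' y y≢x = trans (reflectAt-at-off g i≤n y≢x) (trans (offs y y≢x) (sym (reflectAt-at-off (b c) j≤m y≢x)))
      vals' : ∀ l → l ≤ n → pathVal h l ≡ pathVal (reflectAt (b c) z') (φ l)
      vals' l l≤n with l ℕ.≟ i
      ... | yes refl = trans (reflectAt-at-new g i≤n) (trans same (sym (reflectAt-at-new (b c) j≤m)))
      ... | no l≢i = trans (reflectAt-at-other g i≤n l≤n l≢i) (trans (vals l l≤n)
                       (sym (reflectAt-at-other (b c) j≤m (φ≤m l≤n) (λ e → l≢i (u l l≤n e)))))
      kept : InP α (withB c (reflectAt (b c) z')) → Descends n h
      kept inP' = _ , inP' , elt φ F offs' vals'
      region : Descends n h
      region with ℕₚ.<-cmp j (p c) | ℕₚ.<-cmp j (q c)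
      ... | tri< j<p _ _ | _ = kept (step inP (op1 c z' (unmarked-at c j≤m (λ r → ℕₚ.<⇒≱ j<p (proj₁ r))) lower') nonneg')
      ... | _ | tri> _ _ q<j = kept (step inP (op1 c z' (unmarked-at c j≤m (λ r → ℕₚ.<⇒≱ q<j (proj₂ r))) lower') nonneg')
      ... | tri> _ _ p<j | tri< j<q _ _ = kept (step inP (op2 c z' j (pos-at j j≤m) p<j j<q lower') nonneg')
      ... | tri≈ _ j≡p _ | tri< j<q _ _ = left (reflectAt (b c) z' z' ℤ.<? pathVal (b c) (suc (p c)))
        where
        p<q : p c < q c
        p<q = subst (_< q c) j≡p j<q
        pos-z' : pos z' ≡ just (p c)
        pos-z' = trans (pos-at j j≤m) (cong just j≡p)
        left : Dec (reflectAt (b c) z' z' ℤ.< pathVal (b c) (suc (p c))) → Descends n h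
        left (yes lt) = kept (step inP (op4L-keep c p<q z' pos-z' lower' lt) nonneg')
        left (no ≮) = _ , step inP (op4L-drop c p<q z' pos-z' lower' (ℤₚ.≮⇒≥ ≮)) nonneg' ,
          elt φ (fold-restrict restrict F) offs' vals'
          where
          restrict : ∀ a → p c ≤ a → a ≤ q c → (suc (p c) ≤ a × a ≤ q c) ⊎ (Σ ℕ λ l → φ l ≡ a × l ≤ n × Unique-at φ n l)
          restrict a p≤a a≤q with p c ℕ.≟ a
          ... | yes p≡a = inj₂ (i , trans j≡p p≡a , i≤n , u)
          ... | no p≢a  = inj₁ (ℕₚ.≤∧≢⇒< p≤a p≢a , a≤q)
      ... | tri> _ _ p<j | tri≈ _ j≡q _ = right (reflectAt (b c) z' z' ℤ.<? pathVal (b c) (q c ∸ 1))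
        where
        p<q : p c < q c
        p<q = subst (p c <_) j≡q p<j
        pos-z' : pos z' ≡ just (q c)
        pos-z' = trans (pos-at j j≤m) (cong just j≡q)
        right : Dec (reflectAt (b c) z' z' ℤ.< pathVal (b c) (q c ∸ 1)) → Descends n h
        right (yes lt) = kept (step inP (op4R-keep c p<q z' pos-z' lower' lt) nonneg')
        right (no ≮) = _ , step inP (op4R-drop c p<q z' pos-z' lower' (ℤₚ.≮⇒≥ ≮)) nonneg' ,
          elt φ (fold-restrict restrict F) offs' vals'
          where
          restrict : ∀ a → p c ≤ a → a ≤ q c → (p c ≤ a × a ≤ q c ∸ 1) ⊎ (Σ ℕ λ l → φ l ≡ a × l ≤ n × Unique-at φ n l)
          restrict a p≤a a≤q with a ℕ.≟ q c
          ... | yes a≡q = inj₂ (i , trans j≡q (sym a≡q) , i≤n , u)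
          ... | no a≢q  = inj₁ (p≤a , ℕₚ.pred-mono-≤ (ℕₚ.≤∧≢⇒< a≤q a≢q))
      -- The only vertex that may be repeated occurs once, so the index map is the identity and
      -- `m = n`, against `m < n`.
      ... | tri≈ _ j≡p _ | tri≈ _ j≡q _ = ⊥-elim (ℕₚ.<-irrefl m≡n (single (trans (sym j≡p) j≡q)))
        where
        identity : ∀ l → l ≤ n → φ l ≡ l
        identity zero    _   = starts F
        identity (suc l) l<n with steps F l l<n
        ... | inj₁ e = trans e (cong suc (identity l (ℕₚ.<⇒≤ l<n)))
        ... | inj₂ (e , p≤ , ≤q) = ⊥-elim (ℕₚ.1+n≢n (trans (u (suc l) l<n (trans e φl≡j)) (sym (u l (ℕₚ.<⇒≤ l<n) φl≡j))))
          where
          φl≡j : φ l ≡ j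
          φl≡j = ℕₚ.≤-antisym (subst (φ l ≤_) (sym j≡q) ≤q) (subst (_≤ φ l) (sym j≡p) p≤)
        m≡n : m c ≡ n
        m≡n = trans (sym (ends F)) (identity n ℕₚ.≤-refl)

    -- The equal left neighbour cancels the old value and leaves the right one. If `j < q`, the
    -- position joins the run of `suc j` and the class stays; if `j = q`, the new value is `SR` and
    -- the end of the run becomes the vertex inserted by operation 3.
    descend-left-repeat : ∀ i' → i ≡ suc i' → φ i ≡ φ i' → p c ≤ j → j ≤ q c → FreshR φ n i → Descends n h
    descend-left-repeat i' refl rep p≤j j≤q fr = region (ℕₚ.m≤n⇒m<n∨m≡n j≤q)
      where
      new : newVal g i ≡ rightVal (b c) j
      new = trans (cong₂ (λ l r → l ℤ.+ r ℤ.- pathVal g i) (trans (vals i' (ℕₚ.<⇒≤ i≤n)) (cong (pathVal (b c)) (sym rep)))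
                    (fresh-right (b c) g F offs vals i i≤n fr))
              (trans (cong (λ v → pathVal (b c) j ℤ.+ rightVal (b c) j ℤ.- v) (vals i i≤n)) (lem (pathVal (b c) j) (rightVal (b c) j)))
        where
        lem : ∀ v r → v ℤ.+ r ℤ.- v ≡ r
        lem = solve-∀
      offs' : ∀ y → y ≢ x → h (inj₁ y) ≡ b c (inj₁ y)
      offs' y y≢x = trans (reflectAt-at-off g i≤n y≢x) (offs y y≢x)
      region : j < q c ⊎ j ≡ q c → Descends n h
      region (inj₁ j<q) = c , inP , elt (upd φ i (suc j)) fold' offs' vals'
        where
        j<m : j < m c
        j<m = ℕₚ.<-≤-trans j<q (q≤m c)
        fold' : Fold (p c) (q c) (m c) n (upd φ i (suc j))
        fold' = fold-upd i (suc j) i≤n (λ ()) (λ { refl → ⊥-elim (ℕₚ.<⇒≢ j<m (ends F)) })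
          (λ { _ refl → inj₁ (cong suc rep) }) (λ i<n → inj₂ (fr i<n , ℕₚ.m≤n⇒m≤1+n p≤j , j<q))
        vals' : ∀ l → l ≤ n → pathVal h l ≡ pathVal (b c) (upd φ i (suc j) l)
        vals' l l≤n with l ℕ.≟ i
        ... | yes refl = trans (reflectAt-at-new g i≤n) (trans new (trans (rightVal-inner (b c) j<m) (cong (pathVal (b c)) (sym (upd-same φ i (suc j))))))
        ... | no l≢i = trans (reflectAt-at-other g i≤n l≤n l≢i) (trans (vals l l≤n) (cong (pathVal (b c)) (sym (upd-other φ i (suc j) l≢i))))
      region (inj₂ j≡q) = _ , step inP (op3R c (subst₂ ℤ._<_ (trans new (cong (rightVal (b c)) j≡q)) (trans (vals i i≤n) (cong (pathVal (b c)) j≡q)) lower)) nonneg' ,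
          elt (shiftFrom i φ) (fold-shift i' i≤n rep F) (λ y y≢x → trans (offs' y y≢x) (sym (mkFun-off {suc (m c)} (λ y → b c (inj₁ y)) pv y≢x)))
            (λ l l≤n → trans (vals' l l≤n) (sym (pathVal-mkFun (λ y → b c (inj₁ y)) pv (shiftFrom i φ l) (FoldLemmas.φ≤m (fold-shift i' i≤n rep F) l≤n))))
        where
        pv : ℕ → ℤ
        pv = insertAt (suc (q c)) (SR c) (pathVal (b c))
        SR≥0 : 0ℤ ℤ.≤ SR c
        SR≥0 = subst (0ℤ ℤ.≤_) (trans new (cong (rightVal (b c)) j≡q)) new≥0
        nonneg' : ∀ v → 0ℤ ℤ.≤ mkFun (suc (m c)) (λ y → b c (inj₁ y)) pv v
        nonneg' = mkFun-nonNeg (λ y → b c (inj₁ y)) pv (λ y → InP⇒NonNeg inP (inj₁ y))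
          (λ l _ → insertAt-nonNeg (suc (q c)) (SR c) (pathVal (b c)) SR≥0 (pathVal-nonNeg (b c) (InP⇒NonNeg inP)) l)
        vals' : ∀ l → l ≤ n → pathVal h l ≡ pv (shiftFrom i φ l)
        vals' l l≤n with ℕₚ.<-cmp l i
        ... | tri< l<i l≢i _ = trans (reflectAt-at-other g i≤n l≤n l≢i) (trans (vals l l≤n)
                (sym (trans (cong pv (shiftFrom-< φ l<i)) (insertAt-< (suc (q c)) (SR c) (pathVal (b c)) (s≤s (subst (φ l ≤_) j≡q (mono i (ℕₚ.<⇒≤ l<i) i≤n)))))))
        ... | tri≈ _ refl _ = trans (reflectAt-at-new g i≤n) (trans new (trans (cong (rightVal (b c)) j≡q)
                (sym (trans (cong pv (trans (shiftFrom-≥ φ ℕₚ.≤-refl) (cong suc j≡q))) (insertAt-≡ (suc (q c)) (SR c) (pathVal (b c)))))))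
        ... | tri> _ l≢i i<l = trans (reflectAt-at-other g i≤n l≤n l≢i) (trans (vals l l≤n)
                (sym (trans (cong pv (shiftFrom-≥ φ (ℕₚ.<⇒≤ i<l))) (insertAt-> (suc (q c)) (SR c) (pathVal (b c)) (subst (λ a → suc a ≤ φ l) j≡q (above fr i<l l≤n))))))

    -- The mirror image. At `j = p` the cut falls after `i`, so `i` keeps the index `p`, now that of
    -- the inserted vertex, and the rest of its run moves to `suc p`.
    descend-right-repeat : i < n → φ (suc i) ≡ φ i → p c ≤ j → j ≤ q c → FreshL φ i → Descends n h
    descend-right-repeat i<n rep p≤j j≤q fl = region (ℕₚ.m≤n⇒m<n∨m≡n p≤j)
      where
      new : newVal g i ≡ leftVal (b c) j
      new = trans (cong₂ (λ l r → l ℤ.+ r ℤ.- pathVal g i) (fresh-left (b c) g F offs vals i i≤n fl)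
                    (trans (rightVal-inner g i<n) (trans (vals (suc i) i<n) (cong (pathVal (b c)) rep))))
              (trans (cong (λ v → leftVal (b c) j ℤ.+ pathVal (b c) j ℤ.- v) (vals i i≤n)) (lem (leftVal (b c) j) (pathVal (b c) j)))
        where
        lem : ∀ l v → l ℤ.+ v ℤ.- v ≡ l
        lem = solve-∀
      offs' : ∀ y → y ≢ x → h (inj₁ y) ≡ b c (inj₁ y)
      offs' y y≢x = trans (reflectAt-at-off g i≤n y≢x) (offs y y≢x)
      region : p c < j ⊎ p c ≡ j → Descends n h
      region (inj₁ p<j) = c , inP , elt (upd φ i j⁻) fold' offs' vals'
        where
        j⁻ : ℕ
        j⁻ = ℕ.pred j
        j≡ : j ≡ suc j⁻
        j≡ = sym (ℕₚ.suc-pred j {{ℕ.>-nonZero (ℕₚ.≤-<-trans z≤n p<j)}})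
        p≤j⁻ : p c ≤ j⁻
        p≤j⁻ = ℕₚ.≤-pred (subst (p c <_) j≡ p<j)
        j⁻≤q : j⁻ ≤ q c
        j⁻≤q = ℕₚ.≤-trans (ℕₚ.n≤1+n j⁻) (subst (_≤ q c) j≡ j≤q)
        fold' : Fold (p c) (q c) (m c) n (upd φ i j⁻)
        fold' = fold-upd i j⁻ i≤n (λ { refl → cong ℕ.pred (starts F) }) (λ e → ⊥-elim (ℕₚ.<⇒≢ i<n e))
          (λ { i' refl → inj₂ (ℕₚ.suc-injective (trans (sym j≡) (fl i' refl)) ,
                subst (p c ≤_) (ℕₚ.suc-injective (trans (sym j≡) (fl i' refl))) p≤j⁻ ,
                subst (_≤ q c) (ℕₚ.suc-injective (trans (sym j≡) (fl i' refl))) j⁻≤q) })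
          (λ _ → inj₁ (trans rep j≡))
        vals' : ∀ l → l ≤ n → pathVal h l ≡ pathVal (b c) (upd φ i j⁻ l)
        vals' l l≤n with l ℕ.≟ i
        ... | yes refl = trans (reflectAt-at-new g i≤n) (trans new (trans (cong (leftVal (b c)) j≡) (cong (pathVal (b c)) (sym (upd-same φ i j⁻)))))
        ... | no l≢i = trans (reflectAt-at-other g i≤n l≤n l≢i) (trans (vals l l≤n) (cong (pathVal (b c)) (sym (upd-other φ i j⁻ l≢i))))
      region (inj₂ p≡j) = _ , step inP (op3L c (subst₂ ℤ._<_ new' (trans (vals i i≤n) (cong (pathVal (b c)) (sym p≡j))) lower)) nonneg' ,
          elt (shiftFrom (suc i) φ) (fold-shift i i<n rep F) (λ y y≢x → trans (offs' y y≢x) (sym (mkFun-off {suc (m c)} (λ y → b c (inj₁ y)) pv y≢x)))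
            (λ l l≤n → trans (vals' l l≤n) (sym (pathVal-mkFun (λ y → b c (inj₁ y)) pv (shiftFrom (suc i) φ l) (FoldLemmas.φ≤m (fold-shift i i<n rep F) l≤n))))
        where
        new' : newVal g i ≡ SL c
        new' = trans new (trans (cong (leftVal (b c)) (sym p≡j)) (sym (SL-leftVal c)))
        pv : ℕ → ℤ
        pv = insertAt (p c) (SL c) (pathVal (b c))
        nonneg' : ∀ v → 0ℤ ℤ.≤ mkFun (suc (m c)) (λ y → b c (inj₁ y)) pv v
        nonneg' = mkFun-nonNeg (λ y → b c (inj₁ y)) pv (λ y → InP⇒NonNeg inP (inj₁ y))
          (λ l _ → insertAt-nonNeg (p c) (SL c) (pathVal (b c)) (subst (0ℤ ℤ.≤_) new' new≥0) (pathVal-nonNeg (b c) (InP⇒NonNeg inP)) l)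
        vals' : ∀ l → l ≤ n → pathVal h l ≡ pv (shiftFrom (suc i) φ l)
        vals' l l≤n with ℕₚ.<-cmp l i
        ... | tri< l<i l≢i _ = trans (reflectAt-at-other g i≤n l≤n l≢i) (trans (vals l l≤n)
                (sym (trans (cong pv (shiftFrom-< φ (ℕₚ.m≤n⇒m≤1+n l<i))) (insertAt-< (p c) (SL c) (pathVal (b c)) (subst (φ l <_) (sym p≡j) (below fl i≤n l<i))))))
        ... | tri≈ _ refl _ = trans (reflectAt-at-new g i≤n) (trans new'
                (sym (trans (cong pv (trans (shiftFrom-< φ (ℕₚ.n<1+n i)) (sym p≡j))) (insertAt-≡ (p c) (SL c) (pathVal (b c))))))
        ... | tri> _ l≢i i<l = trans (reflectAt-at-other g i≤n l≤n l≢i) (trans (vals l l≤n)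
                (sym (trans (cong pv (shiftFrom-≥ φ i<l)) (insertAt-> (p c) (SL c) (pathVal (b c)) (subst (_≤ φ l) (sym p≡j) (mono l (ℕₚ.<⇒≤ i<l) l≤n))))))

    descend-at : (p c ≡ q c → m c < n) → Descends n h
    descend-at single with left-cases i i≤n | right-cases i
    ... | inj₁ fl | inj₁ fr = descend-both-fresh single fl fr
    ... | inj₂ (i' , i≡ , rep , p≤ , ≤q) | inj₁ fr = descend-left-repeat i' i≡ rep p≤ ≤q fr
    ... | inj₁ fl | inj₂ (i<n , rep , p≤ , ≤q) = descend-right-repeat i<n rep p≤ ≤q fl
    -- Inside a run both neighbours equal the value, which the reflection then leaves unchanged, so
    -- it does not lower it.
    ... | inj₂ (i' , refl , rep , _) | inj₂ (i<n , rep' , _) = ⊥-elim (ℤₚ.<-irrefl constant lower)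
      where
      constant : newVal g i ≡ pathVal g i
      constant = trans (cong₂ (λ l r → l ℤ.+ r ℤ.- pathVal g i)
          (trans (vals i' (ℕₚ.<⇒≤ i≤n)) (trans (cong (pathVal (b c)) (sym rep)) (sym (vals i i≤n))))
          (trans (rightVal-inner g i<n) (trans (vals (suc i) i<n) (trans (cong (pathVal (b c)) rep') (sym (vals i i≤n))))))
        (lem (pathVal g i))
        where
        lem : ∀ v → v ℤ.+ v ℤ.- v ≡ v
        lem = solve-∀

  descend-class : ∀ {c n g} → InP α c → (p c ≡ q c → m c < n) → Elt c n g → ∀ z → (∀ v → 0ℤ ℤ.≤ reflectAt g z v) →
    reflectAt g z z ℤ.< g z → Descends n (reflectAt g z)
  descend-class {g = g} inP single e@(elt φ F offs vals) z nonneg lower with view z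
  ... | off y y≢x = descend-off inP e y≢x nonneg lower
  ... | on i i≤n  = descend-at inP φ F offs vals i i≤n nonneg
      (subst₂ ℤ._<_ (reflectAt-at-self g i≤n) (sym (pathVal-at g i i≤n)) lower) single

-- Reaching all elements of a class

module Ascending {k : ℕ} (A : Fin k → Fin k → ℤ) (gcm : IsGCM A) (x : Fin k) (inL : Fin k → Bool)
  (α : Fin k → ℤ) (α≥0 : ∀ y → 0ℤ ℤ.≤ α y) (n : ℕ)
  (Good : (Stretch.V A x inL n → ℤ) → Set)
  (good-base : ∀ {g} → g ≗ Stretch.stRoot A x inL n α → Good g)
  (good-lower : ∀ {g h} z → Good g → Stretch.StΦ.refl A x inL n z g ≗ h → (∀ v → 0ℤ ℤ.≤ h v) → h z ℤ.< g z → Good h) where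
  open Stretch A x inL
  open Stretched A gcm x inL
  open Descending A gcm x inL α α≥0 using (InP⇒NonNeg)

  record Over {m : ℕ} (f : V m → ℤ) (φ : ℕ → ℕ) (g : V n → ℤ) : Set where
    constructor over
    field
      offs : ∀ y → y ≢ x → g (inj₁ y) ≡ f (inj₁ y)
      vals : ∀ i → i ≤ n → pathVal g i ≡ pathVal f (φ i)
  open Over

  -- Quantified over all index maps for the fixed `n`, because an element of the next class may be
  -- reached from an element of the present one with a different index map.
  ClassGood : Marked → Set
  ClassGood c = ∀ g φ → Fold (p c) (q c) (m c) n φ → Over (b c) φ g → Good g

  lift : ∀ {m} → (V m → ℤ) → (ℕ → ℕ) → V n → ℤ
  lift f φ = mkFun n (λ y → f (inj₁ y)) (λ i → pathVal f (φ i))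

  lift-over : ∀ {m} (f : V m → ℤ) φ → Over f φ (lift f φ)
  lift-over f φ .offs y y≢x = mkFun-off {n} (λ y → f (inj₁ y)) (λ i → pathVal f (φ i)) y≢x
  lift-over f φ .vals i i≤n = pathVal-mkFun (λ y → f (inj₁ y)) (λ i → pathVal f (φ i)) i i≤n

  over-nonNeg : ∀ {m} {f : V m → ℤ} {φ g} → (∀ v → 0ℤ ℤ.≤ f v) → Over f φ g → ∀ v → 0ℤ ℤ.≤ g v
  over-nonNeg {f = f} {φ} {g} pos o v with view v
  ... | off y y≢x = subst (0ℤ ℤ.≤_) (sym (offs o y y≢x)) (pos (inj₁ y))
  ... | on i i≤n  = subst (0ℤ ℤ.≤_) (trans (sym (vals o i i≤n)) (pathVal-at g i i≤n)) (pathVal-nonNeg f pos (φ i))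

  good-at : ∀ {g h} i → i ≤ n → Good g → (∀ y → y ≢ x → h (inj₁ y) ≡ g (inj₁ y)) →
    (∀ l → l ≤ n → l ≢ i → pathVal h l ≡ pathVal g l) → pathVal h i ≡ newVal g i → pathVal h i ℤ.< pathVal g i →
    (∀ v → 0ℤ ℤ.≤ h v) → Good h
  good-at {g} {h} i i≤n good same-off same-path new lower nonneg =
    good-lower (at i i≤n) good (reflect-at-≗ g h i i≤n same-off same-path new) nonneg
      (subst₂ ℤ._<_ (pathVal-at h i i≤n) (pathVal-at g i i≤n) lower)

  UniqueGood : Marked → ℕ → Set
  UniqueGood c j = ∀ g φ → Fold (p c) (q c) (m c) n φ → Over (b c) φ g → ∀ i → i ≤ n → φ i ≡ j → Unique-at φ n i → Good g

  index-of : ∀ {p q m φ} → Fold p q m n φ → ∀ j → j ≤ m → Σ ℕ λ s → s ≤ n × φ s ≡ j × FreshL φ s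
  index-of F j j≤m = FoldLemmas.first-index F n ℕₚ.≤-refl j (subst (j ≤_) (sym (ends F)) j≤m)

  -- An element repeating the value of x_j arises from one in which it occurs only once, by letting
  -- it spread over its larger right neighbour.
  module _ (c : Marked) (nn : NonNeg c) (j : ℕ) (p≤j : p c ≤ j) (j<q : j < q c)
    (smaller : pathVal (b c) j ℤ.< pathVal (b c) (suc j)) (unique-good : UniqueGood c j) where

    private
      B : ℕ → ℤ
      B = pathVal (b c)
      j<m : j < m c
      j<m = ℕₚ.<-≤-trans j<q (q≤m c)

    -- Induction on the run from `s` to `e`, of length `suc t`. Handing `e` over to the run of
    -- `suc j` gives an element with a shorter run; reflecting it at `e` returns
    -- `B j + B (suc j) − B (suc j) = B j`, a decrease by `smaller`.
    spread-right-loop : ∀ t s e → e ≡ s ℕ.+ t → ∀ φ g → Fold (p c) (q c) (m c) n φ → Over (b c) φ g → e ≤ n →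
      φ s ≡ j → φ e ≡ j → FreshL φ s → FreshR φ n e → Good g
    spread-right-loop zero s e eq φ g F o e≤n φs φe fl fr with trans eq (ℕₚ.+-identityʳ s)
    ... | refl = unique-good g φ F o s e≤n φs (FoldLemmas.fresh⇒unique F fl fr e≤n)
    spread-right-loop (suc t) s e eq φ g F o e≤n φs φe fl fr with trans eq (ℕₚ.+-suc s t)
    ... | refl = good-at e e≤n
        (spread-right-loop t s e' refl φ' g' F' (lift-over (b c) φ') e'≤n
          (trans (upd-other φ e (suc j) s≢e) φs) φ'e' fl' fr')
        (λ y y≢x → trans (offs o y y≢x) (sym (offs (lift-over (b c) φ') y y≢x)))
        (λ l l≤n l≢e → trans (vals o l l≤n) (sym (trans (vals (lift-over (b c) φ') l l≤n) (cong B (upd-other φ e (suc j) l≢e)))))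
        (trans h-e (sym new)) (subst₂ ℤ._<_ (sym h-e) (sym g'-e) smaller) (over-nonNeg nn o)
      where
      e' : ℕ
      e' = s ℕ.+ t
      e'≤n : e' ≤ n
      e'≤n = ℕₚ.<⇒≤ e≤n
      e<n : e < n
      e<n = ℕₚ.≤∧≢⇒< e≤n (λ e≡n → ℕₚ.<⇒≢ j<m (trans (sym φe) (trans (cong φ e≡n) (ends F))))
      s≢e : s ≢ e
      s≢e = ℕₚ.<⇒≢ (s≤s (ℕₚ.m≤m+n s t))
      φe' : φ e' ≡ j
      φe' = ℕₚ.≤-antisym (subst (φ e' ≤_) φe (FoldLemmas.mono F e (ℕₚ.n≤1+n e') e≤n))
                         (subst (_≤ φ e') φs (FoldLemmas.mono F e' (ℕₚ.m≤m+n s t) e'≤n))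
      φ' : ℕ → ℕ
      φ' = upd φ e (suc j)
      φ'e' : φ' e' ≡ j
      φ'e' = trans (upd-other φ e (suc j) (λ e → ℕₚ.1+n≢n (sym e))) φe'
      F' : Fold (p c) (q c) (m c) n φ'
      F' = FoldLemmas.fold-upd F e (suc j) e≤n (λ ()) (λ e≡n → ⊥-elim (ℕₚ.<⇒≢ e<n e≡n))
        (λ { _ refl → inj₁ (cong suc (sym φe')) })
        (λ _ → inj₂ (trans (fr e<n) (cong suc φe) , ℕₚ.m≤n⇒m≤1+n p≤j , j<q))
      fl' : FreshL φ' s
      fl' s' refl = trans (upd-other φ e (suc j) s≢e) (trans (fl s' refl)
        (cong suc (sym (upd-other φ e (suc j) (ℕₚ.<⇒≢ (s≤s (ℕₚ.≤-trans (ℕₚ.n≤1+n s') (ℕₚ.m≤m+n s t))))))))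
      fr' : FreshR φ' n e'
      fr' _ = trans (upd-same φ e (suc j)) (cong suc (sym φ'e'))
      g' : V n → ℤ
      g' = lift (b c) φ'
      h-e : pathVal g e ≡ B j
      h-e = trans (vals o e e≤n) (cong B φe)
      g'-e : pathVal g' e ≡ B (suc j)
      g'-e = trans (vals (lift-over (b c) φ') e e≤n) (cong B (upd-same φ e (suc j)))
      new : newVal g' e ≡ B j
      new = trans (cong₂ ℤ._-_ (cong₂ ℤ._+_
          (trans (vals (lift-over (b c) φ') e' e'≤n) (cong B φ'e'))
          (trans (rightVal-inner g' e<n) (trans (vals (lift-over (b c) φ') (suc e) e<n)
            (cong B (trans (upd-other φ e (suc j) ℕₚ.1+n≢n) (trans (fr e<n) (cong suc φe))))))) g'-e)
        (lem (B j) (B (suc j)))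
        where
        lem : ∀ u v → u ℤ.+ v ℤ.- v ≡ u
        lem = solve-∀

    spread-right : ClassGood c
    spread-right g φ F o with index-of F j (ℕₚ.<⇒≤ j<m)
    ... | s , s≤n , φs , fl with FoldLemmas.last-index F (n ∸ s) s (ℕₚ.m+[n∸m]≡n s≤n)
    ...   | t , le , φe , fr = spread-right-loop t s (s ℕ.+ t) refl φ g F o le φs (trans φe φs) fl fr

  module _ (c : Marked) (nn : NonNeg c) (j : ℕ) (p≤j : p c ≤ j) (j<q : j < q c)
    (smaller : pathVal (b c) (suc j) ℤ.< pathVal (b c) j) (unique-good : UniqueGood c (suc j)) where

    private
      B : ℕ → ℤ
      B = pathVal (b c)

    -- The mirror image: the run of `suc j` shrinks from its left end `s`, which is handed to the
    -- run of the larger left neighbour `j`.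
    spread-left-loop : ∀ t s e → e ≡ s ℕ.+ t → ∀ φ g → Fold (p c) (q c) (m c) n φ → Over (b c) φ g → e ≤ n →
      φ s ≡ suc j → φ e ≡ suc j → FreshL φ s → FreshR φ n e → Good g
    spread-left-loop zero s e eq φ g F o e≤n φs φe fl fr with trans eq (ℕₚ.+-identityʳ s)
    ... | refl = unique-good g φ F o s e≤n φs (FoldLemmas.fresh⇒unique F fl fr e≤n)
    spread-left-loop (suc t) zero e eq φ g F o e≤n φs φe fl fr with trans (sym φs) (starts F)
    ... | ()
    spread-left-loop (suc t) s@(suc s') e eq φ g F o e≤n φs φe fl fr =
      good-at s s≤n
        (spread-left-loop t (suc s) e (trans eq (ℕₚ.+-suc s t)) φ' g' F' (lift-over (b c) φ') e≤n
          φ's+ (trans (upd-other φ s j e≢s) φe) fl' fr')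
        (λ y y≢x → trans (offs o y y≢x) (sym (offs (lift-over (b c) φ') y y≢x)))
        (λ l l≤n l≢s → trans (vals o l l≤n) (sym (trans (vals (lift-over (b c) φ') l l≤n) (cong B (upd-other φ s j l≢s)))))
        (trans h-s (sym new)) (subst₂ ℤ._<_ (sym h-s) (sym g'-s) smaller) (over-nonNeg nn o)
      where
      s<e : s < e
      s<e = subst (s <_) (sym eq) (ℕₚ.m<m+n s (s≤s z≤n))
      s<n : s < n
      s<n = ℕₚ.<-≤-trans s<e e≤n
      s≤n : s ≤ n
      s≤n = ℕₚ.<⇒≤ s<n
      e≢s : e ≢ s
      e≢s eq' = ℕₚ.<⇒≢ s<e (sym eq')
      φs' : φ s' ≡ j
      φs' = ℕₚ.suc-injective (trans (sym (fl s' refl)) φs)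
      φs+ : φ (suc s) ≡ suc j
      φs+ = ℕₚ.≤-antisym (subst (φ (suc s) ≤_) φe (FoldLemmas.mono F e s<e e≤n))
                         (subst (_≤ φ (suc s)) φs (FoldLemmas.mono-suc F s s<n))
      φ' : ℕ → ℕ
      φ' = upd φ s j
      φ's+ : φ' (suc s) ≡ suc j
      φ's+ = trans (upd-other φ s j ℕₚ.1+n≢n) φs+
      F' : Fold (p c) (q c) (m c) n φ'
      F' = FoldLemmas.fold-upd F s j s≤n (λ ()) (λ s≡n → ⊥-elim (ℕₚ.<⇒≢ s<n s≡n))
        (λ { _ refl → inj₂ (sym φs' , subst (p c ≤_) (sym φs') p≤j , subst (_≤ q c) (sym φs') (ℕₚ.<⇒≤ j<q)) })
        (λ _ → inj₁ φs+)
      fl' : FreshL φ' (suc s)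
      fl' _ refl = trans φ's+ (cong suc (sym (upd-same φ s j)))
      fr' : FreshR φ' n e
      fr' e<n = trans (upd-other φ s j (λ eq' → ℕₚ.<⇒≢ (ℕₚ.m≤n⇒m≤1+n s<e) (sym eq')))
        (trans (fr e<n) (cong suc (sym (upd-other φ s j e≢s))))
      g' : V n → ℤ
      g' = lift (b c) φ'
      h-s : pathVal g s ≡ B (suc j)
      h-s = trans (vals o s s≤n) (cong B φs)
      g'-s : pathVal g' s ≡ B j
      g'-s = trans (vals (lift-over (b c) φ') s s≤n) (cong B (upd-same φ s j))
      new : newVal g' s ≡ B (suc j)
      new = trans (cong₂ ℤ._-_ (cong₂ ℤ._+_
          (trans (vals (lift-over (b c) φ') s' (ℕₚ.<⇒≤ s≤n)) (cong B (trans (upd-other φ s j (λ eq' → ℕₚ.1+n≢n (sym eq'))) φs')))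
          (trans (rightVal-inner g' s<n) (trans (vals (lift-over (b c) φ') (suc s) s<n) (cong B φ's+)))) g'-s)
        (lem (B j) (B (suc j)))
        where
        lem : ∀ u v → u ℤ.+ v ℤ.- u ≡ v
        lem = solve-∀

    spread-left : ClassGood c
    spread-left g φ F o with index-of F (suc j) (ℕₚ.≤-trans j<q (q≤m c))
    ... | s , s≤n , φs , fl with FoldLemmas.last-index F (n ∸ s) s (ℕₚ.m+[n∸m]≡n s≤n)
    ...   | t , le , φe , fr = spread-left-loop t s (s ℕ.+ t) refl φ g F o le φs (trans φe φs) fl fr

  -- The same index map defines an element of `c`. At a position that is alone over `j`, reflecting
  -- this element is reflecting the class, so one lowering reflection leads to `g`.
  reflected-good : ∀ c → ClassGood c → ∀ {j} (j≤m : j ≤ m c) → reflectAt (b c) (at j j≤m) (at j j≤m) ℤ.< b c (at j j≤m) →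
    (∀ v → 0ℤ ℤ.≤ reflectAt (b c) (at j j≤m) v) →
    ∀ g φ → Fold (p c) (q c) (m c) n φ → Over (reflectAt (b c) (at j j≤m)) φ g → ∀ i → i ≤ n → φ i ≡ j → Unique-at φ n i → Good g
  reflected-good c good {j} j≤m lower nonneg g φ F o i i≤n refl u =
    good-at i i≤n (good g' φ F o')
      (λ y y≢x → trans (offs o y y≢x) (trans (reflectAt-at-off (b c) j≤m y≢x) (sym (offs o' y y≢x))))
      (λ l l≤n l≢i → trans (vals o l l≤n) (trans (reflectAt-at-other (b c) j≤m (FoldLemmas.φ≤m F l≤n) (λ e → l≢i (u l l≤n e))) (sym (vals o' l l≤n))))
      (trans h-i (sym new))
      (subst₂ ℤ._<_ (trans (reflectAt-at-self (b c) j≤m) (sym h-i)) (trans (sym (pathVal-at (b c) j j≤m)) (sym (vals o' i i≤n))) lower)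
      (over-nonNeg nonneg o)
    where
    g' : V n → ℤ
    g' = lift (b c) φ
    o' : Over (b c) φ g'
    o' = lift-over (b c) φ
    h-i : pathVal g i ≡ newVal (b c) j
    h-i = trans (vals o i i≤n) (reflectAt-at-new (b c) j≤m)
    new : newVal g' i ≡ newVal (b c) j
    new = cong₂ ℤ._-_ (cong₂ ℤ._+_
      (fresh-left (b c) g' F (offs o') (vals o') i i≤n (FoldLemmas.unique⇒freshL F i≤n u))
      (fresh-right (b c) g' F (offs o') (vals o') i i≤n (FoldLemmas.unique⇒freshR F u))) (vals o' i i≤n)

  good-op1-off : ∀ c → ClassGood c → ∀ {y} → y ≢ x → reflectAt (b c) (inj₁ y) (inj₁ y) ℤ.< b c (inj₁ y) →
    (∀ v → 0ℤ ℤ.≤ reflectAt (b c) (inj₁ y) v) → ClassGood (withB c (reflectAt (b c) (inj₁ y)))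
  good-op1-off c good {y} y≢x lower nonneg g φ F o =
    good-lower (inj₁ y) (good g' φ F o')
      (reflect-off-≗ g' g y≢x
        (λ z z≢x z≢y → trans (offs o z z≢x) (trans (reflectAt-off-other (b c) z≢y) (sym (offs o' z z≢x))))
        (λ l l≤n → trans (vals o l l≤n) (trans (reflectAt-off-path (b c) y≢x (FoldLemmas.φ≤m F l≤n)) (sym (vals o' l l≤n))))
        (trans h-y (sym (newOff-fold (b c) g' F (offs o') (vals o') y y≢x))))
      (over-nonNeg nonneg o)
      (subst₂ ℤ._<_ (sym (offs o y y≢x)) (sym (offs o' y y≢x)) lower)
    where
    g' : V n → ℤ
    g' = lift (b c) φ
    o' : Over (b c) φ g'
    o' = lift-over (b c) φ
    h-y : g (inj₁ y) ≡ newOff (b c) y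
    h-y = trans (offs o y y≢x) (reflectAt-off-self (b c) y≢x)

  -- If the inserted vertex occurs once, at `i`, let `i` join the run of the old `x_p`: this is an
  -- element of `c`, and reflecting at `i` gives `SL + b(x_p) − b(x_p) = SL`. Since `SL` is below
  -- `b(x_p)`, now its right neighbour, the repeated case follows by spreading to the right.
  good-op3L : ∀ c → ClassGood c → SL c ℤ.< pathVal (b c) (p c) →
    (c⁺≥0 : ∀ v → 0ℤ ℤ.≤ mkFun (suc (m c)) (λ y → b c (inj₁ y)) (insertAt (p c) (SL c) (pathVal (b c))) v) →
    ClassGood (mk (suc (m c)) (mkFun (suc (m c)) (λ y → b c (inj₁ y)) (insertAt (p c) (SL c) (pathVal (b c))))
      (p c) (suc (q c)) (ℕₚ.m≤n⇒m≤1+n (p≤q c)) (s≤s (q≤m c)))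
  good-op3L c good lower nonneg = spread-right c⁺ nonneg (p c) ℕₚ.≤-refl (s≤s (p≤q c))
      (subst₂ ℤ._<_ (sym at-p) (sym at-p+) lower) unique-good
    where
    f : Fin k → ℤ
    f y = b c (inj₁ y)
    pv : ℕ → ℤ
    pv = insertAt (p c) (SL c) (pathVal (b c))
    c⁺ : Marked
    c⁺ = mk (suc (m c)) (mkFun (suc (m c)) f pv) (p c) (suc (q c)) (ℕₚ.m≤n⇒m≤1+n (p≤q c)) (s≤s (q≤m c))
    p≤m : p c ≤ m c
    p≤m = ℕₚ.≤-trans (p≤q c) (q≤m c)
    at-p : pathVal (b c⁺) (p c) ≡ SL c
    at-p = trans (pathVal-mkFun f pv (p c) (ℕₚ.m≤n⇒m≤1+n p≤m)) (insertAt-≡ (p c) (SL c) (pathVal (b c)))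
    at-p+ : pathVal (b c⁺) (suc (p c)) ≡ pathVal (b c) (p c)
    at-p+ = trans (pathVal-mkFun f pv (suc (p c)) (s≤s p≤m)) (insertAt-> (p c) (SL c) (pathVal (b c)) ℕₚ.≤-refl)
    unique-good : UniqueGood c⁺ (p c)
    unique-good g φ F o i i≤n φi u = good-at i i≤n (good g' ψ F' o')
        (λ y y≢x → trans (offs o y y≢x) (trans (mkFun-off {suc (m c)} f pv y≢x) (sym (offs o' y y≢x))))
        same-path (trans h-i (sym new)) (subst₂ ℤ._<_ (sym h-i) (sym g'-i) lower) (over-nonNeg nonneg o)
      where
      open FoldLemmas F
      i<n : i < n
      i<n = ℕₚ.≤∧≢⇒< i≤n (λ { refl → ℕₚ.<⇒≢ (s≤s p≤m) (trans (sym φi) (ends F)) })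
      fl = unique⇒freshL i≤n u
      fr = unique⇒freshR u
      ψ : ℕ → ℕ
      ψ = unshiftFrom (suc i) φ
      F' : Fold (p c) (q c) (m c) n ψ
      F' = fold-unshift i i<n (fr i<n) (ℕₚ.≤-reflexive (sym φi)) (subst (_≤ q c) (sym φi) (p≤q c)) F
      g' : V n → ℤ
      g' = lift (b c) ψ
      o' : Over (b c) ψ g'
      o' = lift-over (b c) ψ
      ψi : ψ i ≡ p c
      ψi = trans (unshiftFrom-< (suc i) φ ℕₚ.≤-refl) φi
      g'-i : pathVal g' i ≡ pathVal (b c) (p c)
      g'-i = trans (vals o' i i≤n) (cong (pathVal (b c)) ψi)
      h-i : pathVal g i ≡ SL c
      h-i = trans (vals o i i≤n) (trans (cong (pathVal (b c⁺)) φi) at-p)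
      fl' : FreshL ψ i
      fl' i' refl = trans (unshiftFrom-< (suc i) φ ℕₚ.≤-refl) (trans (fl i' refl)
        (cong suc (sym (unshiftFrom-< (suc i) φ (ℕₚ.n≤1+n i)))))
      new : newVal g' i ≡ SL c
      new = trans (cong₂ ℤ._-_ (cong₂ ℤ._+_
          (trans (fresh-left (b c) g' F' (offs o') (vals o') i i≤n fl') (trans (cong (leftVal (b c)) ψi) (sym (SL-leftVal c))))
          (trans (rightVal-inner g' i<n) (trans (vals o' (suc i) i<n)
            (cong (pathVal (b c)) (unshiftFrom-≥ (suc i) φ ℕₚ.≤-refl (trans (fr i<n) (cong suc φi))))))) g'-i)
        (lem (SL c) (pathVal (b c) (p c)))
        where
        lem : ∀ u v → u ℤ.+ v ℤ.- v ≡ u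
        lem = solve-∀
      same-path : ∀ l → l ≤ n → l ≢ i → pathVal g l ≡ pathVal g' l
      same-path l l≤n l≢i = trans (vals o l l≤n) (trans (pathVal-mkFun f pv (φ l) (φ≤m l≤n))
          (trans (side (ℕₚ.<-cmp l i)) (sym (vals o' l l≤n))))
        where
        side : _ → pv (φ l) ≡ pathVal (b c) (ψ l)
        side (tri< l<i _ _) = trans (insertAt-< (p c) (SL c) (pathVal (b c)) (subst (φ l <_) φi (below fl i≤n l<i)))
          (cong (pathVal (b c)) (sym (unshiftFrom-< (suc i) φ (ℕₚ.m≤n⇒m≤1+n l<i))))
        side (tri≈ _ l≡i _) = ⊥-elim (l≢i l≡i)
        side (tri> _ _ i<l) with pred-of (subst (_< φ l) φi (above fr i<l l≤n))
        ... | a , φl≡ , p≤a = trans (cong pv φl≡) (trans (insertAt-> (p c) (SL c) (pathVal (b c)) p≤a)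
          (cong (pathVal (b c)) (sym (unshiftFrom-≥ (suc i) φ i<l φl≡))))

  -- The mirror image: a single occurrence of the inserted vertex comes from the run of `x_q`, and
  -- the repeated case by spreading to the left.
  good-op3R : ∀ c → ClassGood c → SR c ℤ.< pathVal (b c) (q c) →
    (c⁺≥0 : ∀ v → 0ℤ ℤ.≤ mkFun (suc (m c)) (λ y → b c (inj₁ y)) (insertAt (suc (q c)) (SR c) (pathVal (b c))) v) →
    ClassGood (mk (suc (m c)) (mkFun (suc (m c)) (λ y → b c (inj₁ y)) (insertAt (suc (q c)) (SR c) (pathVal (b c))))
      (p c) (suc (q c)) (ℕₚ.m≤n⇒m≤1+n (p≤q c)) (s≤s (q≤m c)))
  good-op3R c good lower nonneg = spread-left c⁺ nonneg (q c) (p≤q c) ℕₚ.≤-refl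
      (subst₂ ℤ._<_ (sym at-q+) (sym at-q) lower) unique-good
    where
    f : Fin k → ℤ
    f y = b c (inj₁ y)
    pv : ℕ → ℤ
    pv = insertAt (suc (q c)) (SR c) (pathVal (b c))
    c⁺ : Marked
    c⁺ = mk (suc (m c)) (mkFun (suc (m c)) f pv) (p c) (suc (q c)) (ℕₚ.m≤n⇒m≤1+n (p≤q c)) (s≤s (q≤m c))
    at-q+ : pathVal (b c⁺) (suc (q c)) ≡ SR c
    at-q+ = trans (pathVal-mkFun f pv (suc (q c)) (s≤s (q≤m c))) (insertAt-≡ (suc (q c)) (SR c) (pathVal (b c)))
    at-q : pathVal (b c⁺) (q c) ≡ pathVal (b c) (q c)
    at-q = trans (pathVal-mkFun f pv (q c) (ℕₚ.m≤n⇒m≤1+n (q≤m c))) (insertAt-< (suc (q c)) (SR c) (pathVal (b c)) ℕₚ.≤-refl)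
    unique-good : UniqueGood c⁺ (suc (q c))
    unique-good g φ F o zero i≤n φi u with trans (sym φi) (starts F)
    ... | ()
    unique-good g φ F o i@(suc i') i≤n φi u = good-at i i≤n (good g' ψ F' o')
        (λ y y≢x → trans (offs o y y≢x) (trans (mkFun-off {suc (m c)} f pv y≢x) (sym (offs o' y y≢x))))
        same-path (trans h-i (sym new)) (subst₂ ℤ._<_ (sym h-i) (sym g'-i) lower) (over-nonNeg nonneg o)
      where
      open FoldLemmas F
      i'≤n : i' ≤ n
      i'≤n = ℕₚ.<⇒≤ i≤n
      fl = unique⇒freshL i≤n u
      fr = unique⇒freshR u
      φi' : φ i' ≡ q c
      φi' = ℕₚ.suc-injective (trans (sym (fl i' refl)) φi)
      ψ : ℕ → ℕ
      ψ = unshiftFrom i φ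
      F' : Fold (p c) (q c) (m c) n ψ
      F' = fold-unshift i' i≤n (fl i' refl) (subst (p c ≤_) (sym φi') (p≤q c)) (ℕₚ.≤-reflexive φi') F
      g' : V n → ℤ
      g' = lift (b c) ψ
      o' : Over (b c) ψ g'
      o' = lift-over (b c) ψ
      ψi : ψ i ≡ q c
      ψi = unshiftFrom-≥ i φ ℕₚ.≤-refl φi
      g'-i : pathVal g' i ≡ pathVal (b c) (q c)
      g'-i = trans (vals o' i i≤n) (cong (pathVal (b c)) ψi)
      h-i : pathVal g i ≡ SR c
      h-i = trans (vals o i i≤n) (trans (cong (pathVal (b c⁺)) φi) at-q+)
      fr' : FreshR ψ n i
      fr' i<n = trans (unshiftFrom-≥ i φ (ℕₚ.n≤1+n i) (trans (fr i<n) (cong suc φi))) (cong suc (sym ψi))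
      new : newVal g' i ≡ SR c
      new = trans (cong₂ ℤ._-_ (cong₂ ℤ._+_
          (trans (vals o' i' i'≤n) (cong (pathVal (b c)) (trans (unshiftFrom-< i φ ℕₚ.≤-refl) φi')))
          (trans (fresh-right (b c) g' F' (offs o') (vals o') i i≤n fr') (cong (rightVal (b c)) ψi))) g'-i)
        (lem (pathVal (b c) (q c)) (SR c))
        where
        lem : ∀ u v → u ℤ.+ v ℤ.- u ≡ v
        lem = solve-∀
      same-path : ∀ l → l ≤ n → l ≢ i → pathVal g l ≡ pathVal g' l
      same-path l l≤n l≢i = trans (vals o l l≤n) (trans (pathVal-mkFun f pv (φ l) (φ≤m l≤n))
          (trans (side (ℕₚ.<-cmp l i)) (sym (vals o' l l≤n))))
        where
        side : _ → pv (φ l) ≡ pathVal (b c) (ψ l)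
        side (tri< l<i _ _) = trans (insertAt-< (suc (q c)) (SR c) (pathVal (b c)) (subst (φ l <_) φi (below fl i≤n l<i)))
          (cong (pathVal (b c)) (sym (unshiftFrom-< i φ l<i)))
        side (tri≈ _ l≡i _) = ⊥-elim (l≢i l≡i)
        side (tri> _ _ i<l) with pred-of (subst (_< φ l) φi (above fr i<l l≤n))
        ... | a , φl≡ , q<a = trans (cong pv φl≡) (trans (insertAt-> (suc (q c)) (SR c) (pathVal (b c)) q<a)
          (cong (pathVal (b c)) (sym (unshiftFrom-≥ i φ (ℕₚ.<⇒≤ i<l) φl≡))))

  -- Marks are taken after the operation, so that one argument serves both operation 1 and the
  -- dropped marks of operation 4: an unmarked vertex occurs once, and an index map for fewer marks
  -- is also one for more.
  good-unmarked : ∀ c → ClassGood c → ∀ {p' q' j} (j≤m : j ≤ m c) → p c ≤ p' → q' ≤ q c → ¬ (p' ≤ j × j ≤ q') →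
    reflectAt (b c) (at j j≤m) (at j j≤m) ℤ.< b c (at j j≤m) → (∀ v → 0ℤ ℤ.≤ reflectAt (b c) (at j j≤m) v) →
    ∀ g φ → Fold p' q' (m c) n φ → Over (reflectAt (b c) (at j j≤m)) φ g → Good g
  good-unmarked c good {p'} {q'} {j} j≤m p≤p' q'≤q ¬marked lower nonneg g φ F o with index-of F j j≤m
  ... | i , i≤n , refl , _ = reflected-good c good j≤m lower nonneg g φ (fold-weaken p≤p' q'≤q F) o i i≤n refl
        (FoldLemmas.unmarked-unique F i≤n ¬marked)

  good-step : ∀ {c c'} → ClassGood c → Step c c' → NonNeg c' → ClassGood c'
  good-step good (op1 c z ¬marked lower) nonneg with view z
  ... | off y y≢x = good-op1-off c good y≢x lower nonneg
  ... | on j j≤m = good-unmarked c good j≤m ℕₚ.≤-refl ℕₚ.≤-refl (λ r → ¬marked (j , pos-at j j≤m , r)) lower nonneg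
  good-step good (op2 c z j pz p<j j<q lower) nonneg with pos⇒at z pz | pred-of p<j
  ... | j≤m , refl | j' , refl , p≤j' = split (pathVal b' j ℤ.<? pathVal b' (suc j))
    where
    B : ℕ → ℤ
    B = pathVal (b c)
    b' : V (m c) → ℤ
    b' = reflectAt (b c) (at j j≤m)
    j<m : j < m c
    j<m = ℕₚ.<-≤-trans j<q (q≤m c)
    left-same : pathVal b' j' ≡ B j'
    left-same = reflectAt-at-other (b c) j≤m (ℕₚ.<⇒≤ j≤m) (λ e → ℕₚ.1+n≢n (sym e))
    right-same : pathVal b' (suc j) ≡ B (suc j)
    right-same = reflectAt-at-other (b c) j≤m j<m ℕₚ.1+n≢n
    new : pathVal b' j ≡ B j' ℤ.+ B (suc j) ℤ.- B j
    new = trans (reflectAt-at-new (b c) j≤m) (cong (λ r → B j' ℤ.+ r ℤ.- B j) (rightVal-inner (b c) j<m))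
    lower' : pathVal b' j ℤ.< B j
    lower' = subst₂ ℤ._<_ (sym (pathVal-at b' j j≤m)) (sym (pathVal-at (b c) j j≤m)) lower
    core : UniqueGood (withB c b') j
    core = reflected-good c good j≤m lower nonneg
    split : Dec (pathVal b' j ℤ.< pathVal b' (suc j)) → ClassGood (withB c b')
    split (yes lt) = spread-right (withB c b') nonneg j (ℕₚ.<⇒≤ p<j) j<q lt core
    -- Not being below the right neighbour means `B (suc j) ≤ new < B j`; then
    -- `new = B j' + B (suc j) − B j` lies below the left neighbour `B j'`.
    split (no ≮) = spread-left (withB c b') nonneg j' p≤j' (ℕₚ.<⇒≤ j<q) (subst₂ ℤ._<_ (sym new) (trans (lem (B j') (B j)) (sym left-same))
        (ℤₚ.+-monoˡ-< (- B j) (ℤₚ.+-monoʳ-< (B j') (ℤₚ.≤-<-trans (subst (ℤ._≤ pathVal b' j) right-same (ℤₚ.≮⇒≥ ≮)) lower')))) core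
      where
      lem : ∀ l v → l ℤ.+ v ℤ.- v ≡ l
      lem = solve-∀
  good-step good (op3L c lower) nonneg = good-op3L c good lower nonneg
  good-step good (op3R c lower) nonneg = good-op3R c good lower nonneg
  good-step good (op4L-keep c p<q z pz lower lt) nonneg with pos⇒at z pz
  ... | p≤m , refl = spread-right (withB c b') nonneg (p c) ℕₚ.≤-refl p<q
      (subst₂ ℤ._<_ (sym (pathVal-at b' (p c) p≤m)) (sym (reflectAt-at-other (b c) p≤m (ℕₚ.≤-trans p<q (q≤m c)) ℕₚ.1+n≢n)) lt)
      (reflected-good c good p≤m lower nonneg)
    where
    b' : V (m c) → ℤ
    b' = reflectAt (b c) (at (p c) p≤m)
  good-step good (op4L-drop c p<q z pz lower _) nonneg with pos⇒at z pz
  ... | p≤m , refl = good-unmarked c good p≤m (ℕₚ.n≤1+n (p c)) ℕₚ.≤-refl (λ r → ℕₚ.1+n≰n (proj₁ r)) lower nonneg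
  good-step good (op4R-keep c p<q z pz lower lt) nonneg with pos⇒at z pz | pred-of p<q
  ... | q≤m' , refl | q' , q≡ , p≤q' = spread-left (withB c b') nonneg q' p≤q' (ℕₚ.≤-reflexive (sym q≡))
      (subst₂ ℤ._<_ (trans (sym (pathVal-at b' (q c) q≤m')) (cong (pathVal b') q≡))
        (trans (cong (λ a → pathVal (b c) (a ∸ 1)) q≡) (sym (reflectAt-at-other (b c) q≤m' (ℕₚ.<⇒≤ (subst (_≤ m c) q≡ q≤m'))
          (λ e → ℕₚ.1+n≢n (sym (trans e q≡)))))) lt)
      (subst (UniqueGood (withB c b')) q≡ (reflected-good c good q≤m' lower nonneg))
    where
    b' : V (m c) → ℤ
    b' = reflectAt (b c) (at (q c) q≤m')
  good-step good (op4R-drop c p<q z pz lower _) nonneg with pos⇒at z pz | pred-of p<q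
  ... | q≤m' , refl | q' , q≡ , _ = good-unmarked c good q≤m' ℕₚ.≤-refl (ℕₚ.m∸n≤m (q c) 1)
      (λ r → ℕₚ.1+n≰n (subst₂ _≤_ q≡ (cong (_∸ 1) q≡) (proj₂ r))) lower nonneg

  good-base-class : ClassGood (alphaStar α)
  good-base-class g φ F o = good-base (ext (λ y y≢x → offs o y y≢x)
    (λ i i≤n → trans (vals o i i≤n) (trans (cong (pathVal (stRoot 0 α)) (ℕₚ.n≤0⇒n≡0 (FoldLemmas.φ≤m F i≤n))) (sym (pathVal-stRoot n α i i≤n)))))

  class-good : ∀ {c} → InP α c → ClassGood c
  class-good base            = good-base-class
  class-good (step inP s nn) = good-step (class-good inP) s nn

-- The ideal below the stretched root.

module Ideal {k : ℕ} (A : Fin k → Fin k → ℤ) (gcm : IsGCM A) (x : Fin k) (inL : Fin k → Bool)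
  (α : Fin k → ℤ) (α-root : Stretch.Φ.IsPosRoot A x inL α)
  (n₀ : ℕ) (isN₀ : Stretch.IsN0 A x inL α n₀) (n : ℕ) (n₀<n : n₀ < n) where
  open Stretch A x inL
  open Stretched A gcm x inL
  open Descending A gcm x inL α (proj₂ α-root)
  open StΦ n using (_≤R_; IsPosRoot; ≤R-refl; ≤R-step)

  -- An index map rises by at most one per position, so a class with an element for `n₀` has
  -- `m ≤ n₀`.
  single⇒m<n : ∀ {c} → InP α c → p c ≡ q c → m c < n
  single⇒m<n {c} inP p≡q with proj₁ isN₀ c inP p≡q
  ... | g , inClass = ℕₚ.≤-<-trans (FoldLemmas.m≤n (Elt.fold (InClass⇒Elt c inClass))) n₀<n

  stRoot-in-base : Elt (alphaStar α) n (stRoot n α)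
  stRoot-in-base = elt (λ _ → 0) (record { starts = refl ; ends = refl ; steps = λ _ _ → inj₂ (refl , z≤n , z≤n) })
    (λ _ _ → refl) (pathVal-stRoot n α)

  -- The chain is unwound from its top: the last reflection is undone, which lowers the coordinate
  -- because it raised the depth, and the class follows by one descent.
  ideal⇒class : ∀ {β γ} → β ≤R γ → Descends n γ → Descends n β
  ideal⇒class (≤R-refl e) (c , inP , el) = c , inP , Elt-resp (λ v → sym (e v)) el
  ideal⇒class (≤R-step {γ} i d β≤γ depth depth' e) (c , inP , el) = ideal⇒class β≤γ (transport (descend-class inP (single⇒m<n inP)
      (Elt-resp (λ v → sym (e v)) el) i nonneg lower))
    where
    h : V n → ℤ
    h = reflectAt (StΦ.refl n i γ) i
    back : h ≗ γ
    back v = trans (reflectAt-≗ (StΦ.refl n i γ) i v) (C.σ-involutive n i γ v)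
    nonneg : ∀ v → 0ℤ ℤ.≤ h v
    nonneg v = subst (0ℤ ℤ.≤_) (sym (back v)) (proj₂ (proj₁ depth) v)
    lower : h i ℤ.< StΦ.refl n i γ i
    lower = subst (ℤ._< StΦ.refl n i γ i) (sym (back i)) (C.depth-lower n i {γ} depth depth')
    transport : Descends n h → Descends n γ
    transport (c' , inP' , el') = c' , inP' , Elt-resp back el'

  Below : (V n → ℤ) → Set
  Below β = IsPosRoot β × β ≤R stRoot n α

  stRoot-isPosRoot : IsPosRoot (stRoot n α)
  stRoot-isPosRoot = stRoot-isRoot n {α} (proj₁ α-root) , λ v → proj₂ α-root (orig v)

  below-resp : ∀ {β γ} → β ≗ γ → Below β → Below γ
  below-resp {β} {γ} e (r , le) = C.IsPosRoot-resp n {β} {γ} e r , C.≤R-trans n {γ} {β} {stRoot n α} (≤R-refl (λ v → sym (e v))) le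

  below-lower : ∀ {g h} z → Below g → StΦ.refl n z g ≗ h → (∀ v → 0ℤ ℤ.≤ h v) → h z ℤ.< g z → Below h
  below-lower {g} {h} z (r , le) e nonneg lower = conclude (C.lower⇒≤R n z {g} r (subst (ℤ._< g z) (sym (e z)) lower)
      (λ v → subst (0ℤ ℤ.≤_) (sym (e v)) (nonneg v)))
    where
    conclude : IsPosRoot (StΦ.refl n z g) × StΦ.refl n z g ≤R g → Below h
    conclude (r' , le') = below-resp {StΦ.refl n z g} {h} e (r' , C.≤R-trans n {StΦ.refl n z g} {g} {stRoot n α} le' le)

  class⇒ideal : ∀ {β c} → InP α c → Elt c n β → Below β
  class⇒ideal {β} inP (elt φ F offs vals) = class-good inP β φ F (over offs vals)
    where
    -- The ideal itself is the predicate carried along `P`: it contains the stretched root and is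
    -- closed under lowering reflections with nonnegative result.
    open Ascending A gcm x inL α (proj₂ α-root) n Below
      (λ {g} e → below-resp {stRoot n α} {g} (λ v → sym (e v)) (stRoot-isPosRoot , ≤R-refl (λ _ → refl))) below-lower

theorem3p4 : (k : ℕ) (A : Fin k → Fin k → ℤ) → IsGCM A →
    (x : Fin k) (inL : Fin k → Bool) (α : Fin k → ℤ) →
    Stretch.Φ.IsPosRoot A x inL α →
    (n₀ : ℕ) → Stretch.IsN0 A x inL α n₀ →
    (n : ℕ) → suc n₀ ≤ n → (β : Stretch.V A x inL n → ℤ) →
    ((Stretch.StΦ.IsPosRoot A x inL n β × Stretch.StΦ._≤R_ A x inL n β (Stretch.stRoot A x inL n α)) →
    Σ (Stretch.Marked A x inL) (λ c → Stretch.InP A x inL α c × Stretch.InClass A x inL c n β)) ×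
    (Σ (Stretch.Marked A x inL) (λ c → Stretch.InP A x inL α c × Stretch.InClass A x inL c n β) →
    (Stretch.StΦ.IsPosRoot A x inL n β × Stretch.StΦ._≤R_ A x inL n β (Stretch.stRoot A x inL n α)))
theorem3p4 k A gcm x inL α α-root n₀ isN₀ n n₀<n β = to , from
  where
  open Stretch A x inL using (InP; InClass; Marked; base)
  open Stretched A gcm x inL
  open Ideal A gcm x inL α α-root n₀ isN₀ n n₀<n
  to : Below β → Σ Marked λ c → InP α c × InClass c n β
  to (_ , le) with ideal⇒class le (Stretch.alphaStar A x inL α , base , stRoot-in-base)
  ... | c , inP , el = c , inP , Elt⇒InClass c el
  from : (Σ Marked λ c → InP α c × InClass c n β) → Below β
  from (c , inP , inClass) = class⇒ideal inP (InClass⇒Elt c inClass)
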